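{- Let $k$ be a positive integer and $p$ a prime with $p \equiv 7 \pmod 8$. Let $r$ be a non-negative integer such that $p$ divides $8r+7$. Then for every non-negative integer $n$: (i) $a_2\left( p^{k+1} n + p r + \frac{7p-1}{8}\right) \equiv (-1)\left(\frac{ -2}{p}\right) a_2\left( p^{k-1} n + \frac{8r+7-p}{8p}\right) \pmod 2$; (ii) $a_{13}\left( 104 p^{k+1} n + 104 p r + 91 p - 7\right) \equiv (-1)\left(\frac{ -2}{p}\right) a_{13}\left( 104 p^{k-1} n + \frac{104 r + 91}{p} - 7\right) \pmod 2$.
   Context: For a positive integer $t$, a partition of $n$ is a $t$-core partition if none of the hook numbers of its Young diagram is divisible by $t$; $a_t(n)$ denotes the number of $t$-core partitions of $n$ (with $a_t(0)=1$). Equivalently, $\sum_{n\ge 0} a_t(n) q^n = \prod_{n\ge1} \frac{(1-q^{tn})^t}{1-q^n}$. $\left(\frac{ -2}{p}\right)$ denotes the Legendre symbol. -}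

module Defs where

open import Data.Nat using (ℕ; zero; suc; _+_; _*_; _∸_; _<_; _≤_; _<?_; _≟_; _⊓_)
open import Data.Nat.DivMod using (_%_)
open import Data.Nat.Divisibility using (_∣_; _∣?_)
open import Data.List using (List; []; _∷_; [_]; map; concatMap; length; filter; sum; upTo; applyUpTo; zip)
open import Data.List.Relation.Unary.All using (All; all?)
open import Data.List.Relation.Unary.Any using (any?)
open import Data.Integer as ℤ using (ℤ; +_; -_; 0ℤ; 1ℤ; -1ℤ)
import Data.Integer.DivMod as ℤD
open import Relation.Nullary using (¬_; yes; no; ¬?)
open import Relation.Unary using (Decidable)

-- Integer partitions, represented as non-increasing lists of positive
-- parts (largest part first).

-- partitions of n whose parts are all ≤ m; 'fuel' bounds the number of
-- parts (fuel = n suffices, as every part is ≥ 1).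
partsBounded : (fuel m n : ℕ) → List (List ℕ)
partsBounded _          _ zero    = [ [] ]
partsBounded zero       _ (suc n) = []
partsBounded (suc fuel) m (suc n) =
  concatMap (λ k → map (k ∷_) (partsBounded fuel k (suc n ∸ k)))
            (applyUpTo suc (m ⊓ suc n))

partitions : ℕ → List (List ℕ)
partitions n = partsBounded n n n

-- conjugate part λ'_j (0-indexed column j): number of parts > j
conj : List ℕ → ℕ → ℕ
conj λs j = length (filter (j <?_) λs)

-- hook length of cell (i , j) (0-indexed, row i of length λ_i):
-- (λ_i - j) + (λ'_j - i) - 1
hooksFrom : List ℕ → ℕ → List ℕ → List ℕ
hooksFrom λs i []         = []
hooksFrom λs i (l ∷ rows) =
  applyUpTo (λ j → (l ∸ j) + (conj λs j ∸ i) ∸ 1) l ++' hooksFrom λs (suc i) rows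
  where
    _++'_ : List ℕ → List ℕ → List ℕ
    [] ++' ys = ys
    (x ∷ xs) ++' ys = x ∷ (xs ++' ys)

hooks : List ℕ → List ℕ
hooks λs = hooksFrom λs 0 λs

IsCore : ℕ → List ℕ → Set
IsCore t λs = All (λ h → ¬ (t ∣ h)) (hooks λs)

isCore? : (t : ℕ) → Decidable (IsCore t)
isCore? t λs = all? (λ h → ¬? (t ∣? h)) (hooks λs)

a : ℕ → ℕ → ℕ
a t n = length (filter (isCore? t) (partitions n))

legendre : ℤ → ℕ → ℤ
legendre x zero = 0ℤ
legendre x p@(suc _) with (x ℤD.%ℕ p) ≟ 0
... | yes _ = 0ℤ
... | no _ with any? (λ y → ((y * y) % p) ≟ (x ℤD.%ℕ p)) (upTo p)
...   | yes _ = 1ℤ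
...   | no _  = -1ℤ

{-# OPTIONS --safe #-}

-- A partition is a t-core iff its beta set is closed under subtracting t, so
-- t-cores are abaci, given by t − 1 bead counts.  For t = 2 this yields the
-- triangular numbers: a₂(n) = 1 iff 8n + 1 is a square.  For t = 13 conjugation
-- is an involution on the cores, and its fixed points of size n correspond to
-- the x ∈ ℤ⁶ with xₖ ≡ 2ᵏ mod 13 and |x|² = 13 (n + 7), which is 169 (8m + 1) if
-- n = 104m + 6.  Negacyclic shifts bring such x to a standard parity pattern, at
-- the cost of multiplying its class modulo 13; then reflections orthogonal to
-- (1, 2, 4, 8, 16, 32) modulo 13 pair off all but a ternary family, the vectors
-- with y² + 8s² + 16d² = 169 (8m + 1) that are nonzero modulo 13 and lie there on
-- a fixed isotropic line, up to sign.  The reflection in (4, 3, −1) maps them to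
-- 13 times the vectors of norm 8m + 1 not orthogonal to that line, and it acts
-- freely, up to sign, on the orthogonal ones.  So the parity is that of all
-- vectors of norm 8m + 1 up to sign, where changing signs leaves s = d = 0:
-- a₁₃(104m + 6) is odd iff 8m + 1 is a square.  Finally, passing between the two
-- indices in the theorem multiplies 8m + 1 by p².
module Submission where

open import Data.Bool using (Bool; true; false; not; _xor_)
open import Data.Empty using (⊥; ⊥-elim)
open import Data.Product using (∃; Σ; _×_; _,_; proj₁; proj₂)
open import Data.Product.Properties using (≡-dec)
open import Data.Sum using (_⊎_; inj₁; inj₂)
open import Data.Unit using (⊤; tt)
open import Function using (_∘_; _⇔_; mk⇔; Equivalence)
open import Relation.Binary.Definitions using (DecidableEquality; tri<; tri≈; tri>)
open import Relation.Binary.PropositionalEquality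
open import Relation.Nullary using (¬_; Dec; yes; no; contradiction)
open import Relation.Nullary.Decidable using (_×-dec_; _→-dec_; _⊎-dec_; ¬?; map′; toWitness; decidable-stable)

-- The residue 6 modulo 104 makes the norm 169 (8m + 1): the factor 13² pays for the descent, and
-- being 1 modulo 8 controls all parities. A norm that is 1 modulo 4 leaves one or five odd
-- coordinates out of six, so exactly one negacyclic shift reaches the standard pattern. The pattern
-- is there because the reflecting vectors (1, -1, -1, -1, 0, 0) and (1, 1, -1, 1, 2, 0) have norms
-- 4 and 8, so their reflections are integral only under parity conditions. The number j of shifts
-- has to be remembered, as it determines the class 2ʲ. This costs nothing in the end: 2 is a
-- primitive root modulo 13, so ±2ʲ for j < 6 runs once through the nonzero residues, and the six
-- classes merge into the single condition of not being orthogonal to the isotropic line. That line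
-- is spanned by (4, 3, -1), whose norm 104 vanishes modulo 13. The inner product with it is 4
-- `func₃`, so its reflection subtracts `func₃` / 13 times the vector: integral where `func₃`
-- vanishes modulo 13, and integral everywhere once multiplied by 13.

module Parity where

  open import Data.Bool.Properties using (not-involutive; not-distribˡ-xor; not-distribʳ-xor)
  open import Data.List using (List; []; _∷_; length; filter; _++_)
  open import Data.List.Membership.Propositional using (_∈_; _∉_)
  open import Data.List.Membership.Propositional.Properties using (∈-filter⁺; ∈-filter⁻; ∈-∃++)
  open import Data.List.Membership.Propositional.Properties.WithK using (unique∧set⇒bag)
  open import Data.List.Relation.Binary.BagAndSetEquality using (∼bag⇒↭)
  open import Data.List.Relation.Binary.Permutation.Propositional using (_↭_; ↭-sym; ↭⇒↭ₛ)
  open import Data.List.Relation.Binary.Permutation.Propositional.Properties using (shift; ↭-length; ∈-resp-↭)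
  import Data.List.Relation.Binary.Permutation.Setoid.Properties as ↭ₛ
  open import Data.List.Relation.Unary.All as All using ([]; _∷_)
  open import Data.List.Relation.Unary.AllPairs using ([]; _∷_)
  open import Data.List.Relation.Unary.Any using (here; there)
  open import Data.List.Relation.Unary.Unique.Propositional using (Unique)
  open import Data.List.Relation.Unary.Unique.Propositional.Properties as Unique using (Unique[x∷xs]⇒x∉xs)
  open import Data.Nat using (ℕ; zero; suc; _≤_; s≤s)
  open import Data.Nat.Properties using (≤-refl; ≤-trans; n≤1+n; ≤-reflexive)
  open import Relation.Unary using (Decidable)

  -- Parities of finite sets under bijections and involutions

  odd? : ℕ → Bool
  odd? zero    = false
  odd? (suc n) = not (odd? n)

  -- b = true means that P has an odd number of elements.
  record HasParity {A : Set} (P : A → Set) (b : Bool) : Set where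
    constructor hasParity
    field
      elems    : List A
      unique   : Unique elems
      sound    : ∀ {x} → x ∈ elems → P x
      complete : ∀ {x} → P x → x ∈ elems
      parity   : odd? (length elems) ≡ b

  open HasParity

  Unique-resp-↭ : ∀ {A : Set} {xs ys : List A} → xs ↭ ys → Unique xs → Unique ys
  Unique-resp-↭ p = ↭ₛ.Unique-resp-↭ (setoid _) (↭⇒↭ₛ p)

  unique∧set⇒↭ : ∀ {A : Set} {xs ys : List A} → Unique xs → Unique ys →
    (∀ {x} → x ∈ xs → x ∈ ys) → (∀ {x} → x ∈ ys → x ∈ xs) → xs ↭ ys
  unique∧set⇒↭ uxs uys f g = ∼bag⇒↭ (unique∧set⇒bag uxs uys (mk⇔ f g))

  parity-unique : ∀ {A : Set} {P : A → Set} {b c} → HasParity P b → HasParity P c → b ≡ c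
  parity-unique h k = trans (sym (parity h)) (trans (cong odd? (↭-length
    (unique∧set⇒↭ (unique h) (unique k) (complete k ∘ sound h) (complete h ∘ sound k)))) (parity k))

  resp-⇔ : ∀ {A : Set} {P Q : A → Set} {b} → (∀ {x} → P x → Q x) → (∀ {x} → Q x → P x) →
    HasParity P b → HasParity Q b
  resp-⇔ f g (hasParity xs u s c p) = hasParity xs u (f ∘ s) (c ∘ g) p

  infix 4 _≅_via_

  -- A bijection is given by a relation so that each direction can use whichever map is explicit.
  -- Between partitions and bead counts, for instance, the relation is a permutation of lists.
  record _≅_via_ {A B : Set} (P : A → Set) (Q : B → Set) (R : A → B → Set) : Set where
    field
      total      : ∀ {x} → P x → ∃ λ y → Q y × R x y
      surjective : ∀ {y} → Q y → ∃ λ x → P x × R x y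
      functional : ∀ {x y z} → P x → Q y → Q z → R x y → R x z → y ≡ z
      injective  : ∀ {x y z} → P x → P y → Q z → R x z → R y z → x ≡ y

  transfer : ∀ {A B : Set} {P : A → Set} {Q : B → Set} {R : A → B → Set} {b} →
    P ≅ Q via R → HasParity P b → HasParity Q b
  transfer {A} {B} {P} {Q} {R} iso h with images (elems h) (unique h) (sound h)
    where
    open _≅_via_ iso
    images : ∀ xs → Unique xs → (∀ {x} → x ∈ xs → P x) →
      Σ (List B) λ ys → Unique ys × (∀ {y} → y ∈ ys → Q y × (∃ λ x → x ∈ xs × R x y))
        × (∀ {x} → x ∈ xs → ∃ λ y → y ∈ ys × R x y) × length ys ≡ length xs
    images [] _ _ = [] , [] , (λ ()) , (λ ()) , refl
    images (x ∷ xs) u@(_ ∷ uxs) s with total (s (here refl)) | images xs uxs (s ∘ there)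
    ... | y , Qy , Rxy | ys , uys , back , forth , len =
      y ∷ ys , All.tabulate (λ z∈ys y≡z → y∉ys (subst (_∈ ys) (sym y≡z) z∈ys)) ∷ uys ,
      (λ { (here refl) → Qy , x , here refl , Rxy
         ; (there y∈) → let (Qy′ , x′ , x′∈ , r) = back y∈ in Qy′ , x′ , there x′∈ , r }) ,
      (λ { (here refl) → y , here refl , Rxy
         ; (there x∈) → let (y′ , y′∈ , r) = forth x∈ in y′ , there y′∈ , r }) ,
      cong suc len
      where
      y∉ys : y ∉ ys
      y∉ys y∈ with back y∈
      ... | Qy′ , x′ , x′∈ , r with injective (s (here refl)) (s (there x′∈)) Qy Rxy r
      ...   | refl = Unique[x∷xs]⇒x∉xs u x′∈
  ... | ys , uys , back , forth , len =
    hasParity ys uys (proj₁ ∘ back) compl (trans (cong odd? len) (parity h))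
    where
    open _≅_via_ iso
    compl : ∀ {y} → Q y → y ∈ ys
    compl Qy with surjective Qy
    ... | x , Px , r with forth (complete h Px)
    ...   | y′ , y′∈ , r′ = subst (_∈ ys) (functional Px (proj₁ (back y′∈)) Qy r′ r) y′∈

  odd?-suc-suc : ∀ n → odd? (suc (suc n)) ≡ odd? n
  odd?-suc-suc n = not-involutive (odd? n)

  module _ {A : Set} (_≟_ : DecidableEquality A) (f : A → A) where

    private
      FixedPoints : List A → Set
      FixedPoints xs = Σ (List A) λ ys → Unique ys × (∀ {x} → x ∈ ys → x ∈ xs × f x ≡ x)
        × (∀ {x} → x ∈ xs → f x ≡ x → x ∈ ys) × odd? (length ys) ≡ odd? (length xs)

      -- The first argument bounds the length of the list.
      fixedPoints : ∀ n xs → length xs ≤ n → Unique xs →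
        (∀ {x} → x ∈ xs → f x ∈ xs) → (∀ {x} → x ∈ xs → f (f x) ≡ x) → FixedPoints xs
      fixedPoints _ [] _ _ _ _ = [] , [] , (λ ()) , (λ ()) , refl
      fixedPoints (suc n) (x ∷ xs) (s≤s len) u@(_ ∷ uxs) closed inv with f x ≟ x
      ... | yes fx≡x = extend (fixedPoints n xs len uxs closed′ (inv ∘ there))
        where
        closed′ : ∀ {y} → y ∈ xs → f y ∈ xs
        closed′ {y} y∈ with closed (there y∈)
        ... | there fy∈ = fy∈
        ... | here fy≡x = contradiction
          (subst (_∈ xs) (trans (sym (inv (there y∈))) (trans (cong f fy≡x) fx≡x)) y∈)
          (Unique[x∷xs]⇒x∉xs u)
        extend : FixedPoints xs → FixedPoints (x ∷ xs)
        extend (ys , uys , back , forth , par) =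
          x ∷ ys , All.tabulate (λ z∈ x≡z → Unique[x∷xs]⇒x∉xs u (subst (_∈ xs) (sym x≡z) (proj₁ (back z∈)))) ∷ uys ,
          (λ { (here refl) → here refl , fx≡x ; (there y∈) → let (p , q) = back y∈ in there p , q }) ,
          (λ { (here refl) _ → here refl ; (there y∈) e → there (forth y∈ e) }) ,
          cong not par
      ... | no fx≢x with closed (here refl)
      ...   | here fx≡x = contradiction fx≡x fx≢x
      ...   | there fx∈ with ∈-∃++ fx∈
      -- Dropping `x` and `f x` together keeps the parity of the length and leaves a list that is
      -- still closed under `f`.
      ...     | as , bs , refl = finish (fixedPoints n zs lenzs (drop₁ uperm) closed′ (inv ∘ there ∘ zs⊆))
        where
        zs = as ++ bs
        perm : as ++ f x ∷ bs ↭ f x ∷ zs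
        perm = shift (f x) as bs
        uperm : Unique (f x ∷ zs)
        uperm = Unique-resp-↭ perm uxs
        drop₁ : ∀ {y ys} → Unique (y ∷ ys) → Unique ys
        drop₁ (_ ∷ p) = p
        zs⊆ : ∀ {y} → y ∈ zs → y ∈ as ++ f x ∷ bs
        zs⊆ y∈ = ∈-resp-↭ (↭-sym perm) (there y∈)
        lenzs : length zs ≤ n
        lenzs = ≤-trans (n≤1+n _) (≤-trans (≤-reflexive (sym (↭-length perm))) len)
        closed′ : ∀ {y} → y ∈ zs → f y ∈ zs
        closed′ {y} y∈ with closed (there (zs⊆ y∈))
        ... | here fy≡x = contradiction (subst (_∈ zs) (trans (sym (inv (there (zs⊆ y∈)))) (cong f fy≡x)) y∈)
                            (Unique[x∷xs]⇒x∉xs uperm)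
        ... | there fy∈ with ∈-resp-↭ perm fy∈
        ...   | there q = q
        ...   | here fy≡fx = contradiction
                  (subst (_∈ as ++ f x ∷ bs) (trans (sym (inv (there (zs⊆ y∈))))
                    (trans (cong f fy≡fx) (inv (here refl)))) (zs⊆ y∈))
                  (Unique[x∷xs]⇒x∉xs u)
        finish : FixedPoints zs → FixedPoints (x ∷ as ++ f x ∷ bs)
        finish (ys , uys , back , forth , par) =
          ys , uys , (λ y∈ → let (p , q) = back y∈ in there (zs⊆ p) , q) ,
          forth′ , trans par (sym (trans (cong (not ∘ odd?) (↭-length perm)) (odd?-suc-suc (length zs))))
          where
          forth′ : ∀ {y} → y ∈ x ∷ as ++ f x ∷ bs → f y ≡ y → y ∈ ys
          forth′ (here refl) e = contradiction e fx≢x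
          forth′ (there y∈) e with ∈-resp-↭ perm y∈
          ... | there q = forth q e
          ... | here refl = contradiction (trans (sym e) (inv (here refl))) fx≢x

    -- The elements that are not fixed pair off.
    involution : ∀ {P : A → Set} {b} → (∀ {x} → P x → P (f x)) → (∀ {x} → P x → f (f x) ≡ x) →
      HasParity P b → HasParity (λ x → P x × f x ≡ x) b
    involution pres inv (hasParity xs u s c p)
      with fixedPoints (length xs) xs ≤-refl u (c ∘ pres ∘ s) (inv ∘ s)
    ... | ys , uys , back , forth , par =
      hasParity ys uys (λ y∈ → let (q , e) = back y∈ in s q , e) (λ { (q , e) → forth (c q) e }) (trans par p)

  empty-even : ∀ {A : Set} {P : A → Set} {b} → (∀ {x} → ¬ P x) → HasParity P b → b ≡ false
  empty-even ¬P (hasParity [] u s c p) = sym p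
  empty-even ¬P (hasParity (x ∷ xs) u s c p) = ⊥-elim (¬P (s (here refl)))

  split : ∀ {A : Set} {P Q : A → Set} {b} → Decidable Q → HasParity P b →
    ∃ λ c → ∃ λ d → HasParity (λ x → P x × Q x) c × HasParity (λ x → P x × ¬ Q x) d × b ≡ c xor d
  split {A} {P} {Q} Q? (hasParity xs u s c p) = _ , _ , part Q? , part (¬? ∘ Q?) , trans (sym p) (count xs)
    where
    part : ∀ {S : A → Set} (S? : Decidable S) → HasParity (λ x → P x × S x) (odd? (length (filter S? xs)))
    part S? = hasParity (filter S? xs) (Unique.filter⁺ S? u)
      (λ x∈ → let (p , q) = ∈-filter⁻ S? x∈ in s p , q) (λ { (Px , Sx) → ∈-filter⁺ S? (c Px) Sx }) refl
    count : ∀ ys → odd? (length ys) ≡ odd? (length (filter Q? ys)) xor odd? (length (filter (¬? ∘ Q?) ys))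
    count [] = refl
    count (y ∷ ys) with Q? y
    ... | yes _ = trans (cong not (count ys)) (not-distribˡ-xor (odd? (length (filter Q? ys))) _)
    ... | no  _ = trans (cong not (count ys)) (not-distribʳ-xor (odd? (length (filter Q? ys))) _)

  subsingleton-parity : ∀ {A : Set} {P : A → Set} {b} → (∀ {x y} → P x → P y → x ≡ y) → HasParity P b →
    (b ≡ true → ∃ P) × (∃ P → b ≡ true)
  subsingleton-parity uniq (hasParity [] u s c refl) = (λ ()) , λ { (x , Px) → contradiction (c Px) λ () }
  subsingleton-parity uniq (hasParity (x ∷ []) u s c refl) = (λ _ → x , s (here refl)) , λ _ → refl
  subsingleton-parity uniq (hasParity (x ∷ y ∷ xs) ((x≢y ∷ _) ∷ _) s c _) =
    contradiction (uniq (s (here refl)) (s (there (here refl)))) x≢y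

open Parity

-- Integers modulo 2 and modulo 13

module Lattice where

  open import Data.Bool as Bool using ()
  open import Data.Fin as Fin using (Fin; toℕ; zero; suc)
  import Data.Fin.Properties as Fin
  open import Data.Integer hiding (suc; pred)
  open import Data.Integer.DivMod using (a≡a%ℕn+[a/ℕn]*n; n%ℕd<d)
  open import Data.Integer.Divisibility.Signed using (_∣_; divides; _∣?_)
  open import Data.Integer.Properties
  open import Data.Integer.Tactic.RingSolver using (solve-∀)
  open import Data.List using (List; map; _++_; upTo; cartesianProduct; filter)
  open import Data.List.Membership.Propositional using (_∈_)
  open import Data.List.Membership.Propositional.Properties
  open import Data.List.Relation.Unary.Unique.Propositional using (Unique)
  import Data.List.Relation.Unary.Unique.Propositional.Properties as Unique
  open import Data.Nat as ℕ using (ℕ; zero; suc)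
  import Data.Nat.Properties as ℕ

  ⟦_⟧ : Bool → ℤ
  ⟦ true ⟧  = + 1
  ⟦ false ⟧ = + 0

  abstract

    -- Opaque, so that integer division does not unfold in later goals; everything about `half` and
    -- `par` is derived from `half-eq`.
    half : ℤ → ℤ
    half x = x /ℕ 2

    par : ℤ → Bool
    par x = (x %ℕ 2) ℕ.≡ᵇ 1

    half-eq : ∀ x → x ≡ + 2 * half x + ⟦ par x ⟧
    half-eq x = trans (a≡a%ℕn+[a/ℕn]*n x 2) (trans (+-comm (+ (x %ℕ 2)) (x /ℕ 2 * + 2))
      (cong₂ _+_ (*-comm (half x) (+ 2)) (bit (x %ℕ 2) (n%ℕd<d x 2))))
      where
      bit : ∀ r → r ℕ.< 2 → + r ≡ ⟦ r ℕ.≡ᵇ 1 ⟧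
      bit 0 _ = refl
      bit 1 _ = refl
      bit (suc (suc _)) (ℕ.s≤s (ℕ.s≤s ()))

  2*≢1 : ∀ k → + 2 * k ≢ + 1
  2*≢1 (+ suc (suc n)) ()
  2*≢1 (+ 1) ()
  2*≢1 (+ 0) ()
  2*≢1 -[1+ n ] ()

  div2-unique : ∀ {h k} b c → + 2 * h + ⟦ b ⟧ ≡ + 2 * k + ⟦ c ⟧ → b ≡ c × h ≡ k
  div2-unique {h} {k} false false e = refl , *-cancelˡ-≡ (+ 2) h k
    (trans (sym (+-identityʳ _)) (trans e (+-identityʳ _)))
  div2-unique {h} {k} true true e = refl , *-cancelˡ-≡ (+ 2) h k
    (trans (l (+ 2 * h)) (trans (cong (_- + 1) e) (sym (l (+ 2 * k)))))
    where
    l : ∀ u → u ≡ u + + 1 - + 1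
    l = solve-∀
  div2-unique {h} {k} true false e = contradiction
    (trans (lem h k) (trans (cong (_- + 2 * h) (sym e)) (lem′ h))) (2*≢1 (k - h))
    where
    lem : ∀ h k → + 2 * (k - h) ≡ (+ 2 * k + + 0) - + 2 * h
    lem = solve-∀
    lem′ : ∀ h → (+ 2 * h + + 1) - + 2 * h ≡ + 1
    lem′ = solve-∀
  div2-unique {h} {k} false true e with div2-unique {k} {h} true false (sym e)
  ... | () , _

  par-unique : ∀ x h b → x ≡ + 2 * h + ⟦ b ⟧ → par x ≡ b
  par-unique x h b e = proj₁ (div2-unique {half x} {h} (par x) b (trans (sym (half-eq x)) e))

  half-unique : ∀ x h → x ≡ + 2 * h → half x ≡ h
  half-unique x h e = proj₂ (div2-unique {half x} {h} (par x) false
    (trans (sym (half-eq x)) (trans e (sym (+-identityʳ _)))))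

  half-even : ∀ x → par x ≡ false → x ≡ + 2 * half x
  half-even x e = trans (half-eq x) (trans (cong (λ b → + 2 * half x + ⟦ b ⟧) e) (+-identityʳ _))

  half-odd : ∀ x → par x ≡ true → x ≡ + 2 * half x + + 1
  half-odd x e = trans (half-eq x) (cong (λ b → + 2 * half x + ⟦ b ⟧) e)

  par-2* : ∀ h → par (+ 2 * h) ≡ false
  par-2* h = par-unique (+ 2 * h) h false (sym (+-identityʳ _))

  par-+ : ∀ x y → par (x + y) ≡ par x xor par y
  par-+ x y = trans (cong₂ (λ u v → par (u + v)) (half-eq x) (half-eq y)) (go (par x) (par y))
    where
    a = half x
    b = half y
    e₁ : ∀ a b → (+ 2 * a + + 1) + (+ 2 * b + + 1) ≡ + 2 * (a + b + + 1) + + 0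
    e₁ = solve-∀
    e₂ : ∀ a b c d → (+ 2 * a + c) + (+ 2 * b + d) ≡ + 2 * (a + b) + (c + d)
    e₂ = solve-∀
    go : ∀ c d → par ((+ 2 * a + ⟦ c ⟧) + (+ 2 * b + ⟦ d ⟧)) ≡ c xor d
    go true  true  = par-unique _ (a + b + + 1) false (e₁ a b)
    go true  false = par-unique _ (a + b) true  (e₂ a b (+ 1) (+ 0))
    go false true  = par-unique _ (a + b) true  (e₂ a b (+ 0) (+ 1))
    go false false = par-unique _ (a + b) false (e₂ a b (+ 0) (+ 0))

  par-neg : ∀ x → par (- x) ≡ par x
  par-neg x = par-unique _ (- half x - ⟦ par x ⟧) (par x) (trans (cong -_ (half-eq x)) (go (half x) (par x)))
    where
    e : ∀ h c → - (+ 2 * h + c) ≡ + 2 * (- h - c) + c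
    e = solve-∀
    go : ∀ h b → - (+ 2 * h + ⟦ b ⟧) ≡ + 2 * (- h - ⟦ b ⟧) + ⟦ b ⟧
    go h b = e h ⟦ b ⟧

  par-sub : ∀ x y → par (x - y) ≡ par x xor par y
  par-sub x y = trans (par-+ x (- y)) (cong (par x xor_) (par-neg y))

  -- This is what makes odd squares 1 modulo 8, and not only modulo 4.
  pronic-even : ∀ h → ∃ λ t → h * (h + + 1) ≡ + 2 * t
  pronic-even h with par h in e
  ... | false = half h * (h + + 1) , trans (cong (_* (h + + 1)) (half-even h e)) (*-assoc (+ 2) (half h) _)
  ... | true  = h * (half h + + 1) , trans (cong (λ u → h * (u + + 1)) (half-odd h e)) (l h (half h))
    where
    l : ∀ h k → h * (+ 2 * k + + 1 + + 1) ≡ + 2 * (h * (k + + 1))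
    l = solve-∀

  infix 4 _≈_ _≈?_

  -- The quotient is explicit, so that matching on `mod13 q refl` turns a residue condition into a
  -- new integer coordinate.
  record _≈_ (a b : ℤ) : Set where
    constructor mod13
    field
      quotient : ℤ
      equation : a ≡ b + + 13 * quotient

  ≈-refl : ∀ {a} → a ≈ a
  ≈-refl {a} = mod13 (+ 0) (sym (+-identityʳ a))

  ≈-shift : ∀ {a b c} k → a ≈ b → b ≡ c + + 13 * k → a ≈ c
  ≈-shift {c = c} k (mod13 q refl) refl = mod13 (k + q) (l c k q)
    where
    l : ∀ c k q → c + + 13 * k + + 13 * q ≡ c + + 13 * (k + q)
    l = solve-∀

  ≈-reflexive : ∀ {a b} → a ≡ b → a ≈ b
  ≈-reflexive refl = ≈-refl

  ≈-respˡ : ∀ {a b c} → a ≡ b → a ≈ c → b ≈ c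
  ≈-respˡ refl p = p

  ≈-trans : ∀ {a b c} → a ≈ b → b ≈ c → a ≈ c
  ≈-trans p (mod13 q e) = ≈-shift q p e

  ≈-sym : ∀ {a b} → a ≈ b → b ≈ a
  ≈-sym {b = b} (mod13 q refl) = mod13 (- q) (l b q)
    where
    l : ∀ b q → b ≡ b + + 13 * q + + 13 * - q
    l = solve-∀

  +-cong≈ : ∀ {a b c d} → a ≈ b → c ≈ d → a + c ≈ b + d
  +-cong≈ {b = b} {d = d} (mod13 q refl) (mod13 r refl) = mod13 (q + r) (l b d q r)
    where
    l : ∀ b d q r → b + + 13 * q + (d + + 13 * r) ≡ b + d + + 13 * (q + r)
    l = solve-∀

  neg-cong≈ : ∀ {a b} → a ≈ b → - a ≈ - b
  neg-cong≈ {b = b} (mod13 q refl) = mod13 (- q) (l b q)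
    where
    l : ∀ b q → - (b + + 13 * q) ≡ - b + + 13 * - q
    l = solve-∀

  sub-cong≈ : ∀ {a b c d} → a ≈ b → c ≈ d → a - c ≈ b - d
  sub-cong≈ p q = +-cong≈ p (neg-cong≈ q)

  *-cong≈ : ∀ {a b} c → a ≈ b → c * a ≈ c * b
  *-cong≈ {b = b} c (mod13 q refl) = mod13 (c * q) (l b c q)
    where
    l : ∀ b c q → c * (b + + 13 * q) ≡ c * b + + 13 * (c * q)
    l = solve-∀

  -- The inverse of 2 modulo 13 is 7.
  halve≈ : ∀ {a b} → + 2 * a ≈ + 2 * b → a ≈ b
  halve≈ {a} {b} (mod13 q e) = mod13 (b - a + + 7 * q)
    (trans (l₁ a) (trans (cong (λ u → + 7 * u - + 13 * a) e) (l₂ a b q)))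
    where
    l₁ : ∀ a → a ≡ + 7 * (+ 2 * a) - + 13 * a
    l₁ = solve-∀
    l₂ : ∀ a b q → + 7 * (+ 2 * b + + 13 * q) - + 13 * a ≡ b + + 13 * (b - a + + 7 * q)
    l₂ = solve-∀

  _≈?_ : ∀ a b → Dec (a ≈ b)
  a ≈? b = map′ from to (+ 13 ∣? a - b)
    where
    l : ∀ a b → a ≡ b + (a - b)
    l = solve-∀
    l′ : ∀ b q → b + + 13 * q - b ≡ q * + 13
    l′ = solve-∀
    from : + 13 ∣ a - b → a ≈ b
    from (divides q e) = mod13 q (trans (l a b) (cong (_+_ b) (trans e (*-comm q (+ 13)))))
    to : a ≈ b → + 13 ∣ a - b
    to (mod13 q e) = divides q (trans (cong (_- b) e) (l′ b q))

  -- Six-dimensional vectors and negacyclic shifts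

  ℤ⁶ : Set
  ℤ⁶ = ℤ × ℤ × ℤ × ℤ × ℤ × ℤ

  _≟₆_ : DecidableEquality ℤ⁶
  _≟₆_ = ≡-dec _≟_ (≡-dec _≟_ (≡-dec _≟_ (≡-dec _≟_ (≡-dec _≟_ _≟_))))

  norm₆ : ℤ⁶ → ℤ
  norm₆ (x0 , x1 , x2 , x3 , x4 , x5) = x0 * x0 + x1 * x1 + x2 * x2 + x3 * x3 + x4 * x4 + x5 * x5

  -- The powers of 2 are left unreduced: a shift then doubles `g` by definition in five coordinates,
  -- and only the wrapped one needs 64 ≡ -1.
  Class : ℤ → ℤ⁶ → Set
  Class g (x0 , x1 , x2 , x3 , x4 , x5) =
    x0 ≈ g × x1 ≈ + 2 * g × x2 ≈ + 4 * g × x3 ≈ + 8 * g × x4 ≈ + 16 * g × x5 ≈ + 32 * g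

  Bits : Set
  Bits = Bool × Bool × Bool × Bool × Bool × Bool

  bits : ℤ⁶ → Bits
  bits (x0 , x1 , x2 , x3 , x4 , x5) = par x0 , par x1 , par x2 , par x3 , par x4 , par x5

  -- Either only the last coordinate is odd, or only the fifth is even. In both cases the first four
  -- agree in parity, which makes the two reflections below integral.
  Good : Bits → Set
  Good (b0 , b1 , b2 , b3 , b4 , b5) = b1 ≡ b0 × b2 ≡ b0 × b3 ≡ b0 × b4 ≡ false × b5 ≡ true

  good? : ∀ b → Dec (Good b)
  good? (b0 , b1 , b2 , b3 , b4 , b5) =
    (b1 Bool.≟ b0) ×-dec (b2 Bool.≟ b0) ×-dec (b3 Bool.≟ b0) ×-dec (b4 Bool.≟ false) ×-dec (b5 Bool.≟ true)

  rotBits : ℕ → Bits → Bits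
  rotBits zero b = b
  rotBits (suc k) (b0 , b1 , b2 , b3 , b4 , b5) = rotBits k (b1 , b2 , b3 , b4 , b5 , b0)

  -- The negacyclic shift: 2⁶ = −1 modulo 13, so it multiplies the class by 2.
  rot : ℕ → ℤ⁶ → ℤ⁶
  rot zero x = x
  rot (suc k) (x0 , x1 , x2 , x3 , x4 , x5) = rot k (x1 , x2 , x3 , x4 , x5 , - x0)

  rot⁻ : ℕ → ℤ⁶ → ℤ⁶
  rot⁻ zero x = x
  rot⁻ (suc k) x = let (x0 , x1 , x2 , x3 , x4 , x5) = rot⁻ k x in (- x5 , x0 , x1 , x2 , x3 , x4)

  tuple₆ : ∀ {x0 x1 x2 x3 x4 x5 y0 y1 y2 y3 y4 y5 : ℤ} → x0 ≡ y0 → x1 ≡ y1 → x2 ≡ y2 → x3 ≡ y3 → x4 ≡ y4 → x5 ≡ y5 →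
    (x0 , x1 , x2 , x3 , x4 , x5) ≡ (y0 , y1 , y2 , y3 , y4 , y5)
  tuple₆ refl refl refl refl refl refl = refl

  rot-rot⁻ : ∀ k x → rot k (rot⁻ k x) ≡ x
  rot-rot⁻ zero x = refl
  rot-rot⁻ (suc k) x = trans (cong (rot k) (tuple₆ refl refl refl refl refl (neg-involutive _))) (rot-rot⁻ k x)

  rot⁻-rot : ∀ k x → rot⁻ k (rot k x) ≡ x
  rot⁻-rot zero x = refl
  rot⁻-rot (suc k) x rewrite rot⁻-rot k (proj₁ (proj₂ x) , proj₁ (proj₂ (proj₂ x)) , proj₁ (proj₂ (proj₂ (proj₂ x))) ,
      proj₁ (proj₂ (proj₂ (proj₂ (proj₂ x)))) , proj₂ (proj₂ (proj₂ (proj₂ (proj₂ x)))) , - proj₁ x) =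
    tuple₆ (neg-involutive _) refl refl refl refl refl

  norm-rot : ∀ k x → norm₆ (rot k x) ≡ norm₆ x
  norm-rot zero x = refl
  norm-rot (suc k) x@(x0 , x1 , x2 , x3 , x4 , x5) = trans (norm-rot k (x1 , x2 , x3 , x4 , x5 , - x0))
    (l x0 x1 x2 x3 x4 x5)
    where
    l : ∀ x0 x1 x2 x3 x4 x5 → x1 * x1 + x2 * x2 + x3 * x3 + x4 * x4 + x5 * x5 + - x0 * - x0
      ≡ x0 * x0 + x1 * x1 + x2 * x2 + x3 * x3 + x4 * x4 + x5 * x5
    l = solve-∀

  bits-rot : ∀ k x → bits (rot k x) ≡ rotBits k (bits x)
  bits-rot zero x = refl
  bits-rot (suc k) x@(x0 , x1 , x2 , x3 , x4 , x5) = trans (bits-rot k (x1 , x2 , x3 , x4 , x5 , - x0))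
    (cong (λ b → rotBits k (par x1 , par x2 , par x3 , par x4 , par x5 , b)) (par-neg x0))

  2^ : ℕ → ℤ
  2^ k = + (2 ℕ.^ k)

  class-rot : ∀ k g x → Class g x → Class (2^ k * g) (rot k x)
  class-rot zero g x c = subst (λ h → Class h x) (sym (*-identityˡ g)) c
  class-rot (suc k) g x@(x0 , x1 , x2 , x3 , x4 , x5) (c0 , c1 , c2 , c3 , c4 , c5) =
    subst (λ h → Class h (rot (suc k) x)) eq (class-rot k (+ 2 * g) (x1 , x2 , x3 , x4 , x5 , - x0)
     (c1 , ≈-shift (+ 0) c2 (l2 g) , ≈-shift (+ 0) c3 (l3 g) , ≈-shift (+ 0) c4 (l4 g) , ≈-shift (+ 0) c5
       (l5 g) , ≈-shift (- (+ 5 * g)) (neg-cong≈ c0) (l0 g)))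
    where
    l2 : ∀ g → + 4 * g ≡ + 2 * (+ 2 * g) + + 13 * + 0
    l2 = solve-∀
    l3 : ∀ g → + 8 * g ≡ + 4 * (+ 2 * g) + + 13 * + 0
    l3 = solve-∀
    l4 : ∀ g → + 16 * g ≡ + 8 * (+ 2 * g) + + 13 * + 0
    l4 = solve-∀
    l5 : ∀ g → + 32 * g ≡ + 16 * (+ 2 * g) + + 13 * + 0
    l5 = solve-∀
    l0 : ∀ g → - g ≡ + 32 * (+ 2 * g) + + 13 * - (+ 5 * g)
    l0 = solve-∀
    l : ∀ a g → a * (+ 2 * g) ≡ (+ 2 * a) * g
    l = solve-∀
    eq : 2^ k * (+ 2 * g) ≡ 2^ (suc k) * g
    eq = trans (l (2^ k) g) (cong (_* g) (sym (pos-* 2 (2 ℕ.^ k))))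

  class-rot⁻ : ∀ k g x → Class (2^ k * g) x → Class g (rot⁻ k x)
  class-rot⁻ zero g x c = subst (λ h → Class h x) (*-identityˡ g) c
  class-rot⁻ (suc k) g x c with class-rot⁻ k (+ 2 * g) x (subst (λ h → Class h x) (sym eq) c)
    where
    l : ∀ a g → a * (+ 2 * g) ≡ (+ 2 * a) * g
    l = solve-∀
    eq : 2^ k * (+ 2 * g) ≡ 2^ (suc k) * g
    eq = trans (l (2^ k) g) (cong (_* g) (sym (pos-* 2 (2 ℕ.^ k))))
  ... | (c0 , c1 , c2 , c3 , c4 , c5) =
    ≈-shift (- (+ 5 * g)) (neg-cong≈ c5) (l0 g) , c0 , ≈-shift (+ 0) c1 (l2 g) , ≈-shift (+ 0) c2 (l3 g) ,
      ≈-shift (+ 0) c3 (l4 g) , ≈-shift (+ 0) c4 (l5 g)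
    where
    l2 : ∀ g → + 2 * (+ 2 * g) ≡ + 4 * g + + 13 * + 0
    l2 = solve-∀
    l3 : ∀ g → + 4 * (+ 2 * g) ≡ + 8 * g + + 13 * + 0
    l3 = solve-∀
    l4 : ∀ g → + 8 * (+ 2 * g) ≡ + 16 * g + + 13 * + 0
    l4 = solve-∀
    l5 : ∀ g → + 16 * (+ 2 * g) ≡ + 32 * g + + 13 * + 0
    l5 = solve-∀
    l0 : ∀ g → - (+ 32 * (+ 2 * g)) ≡ g + + 13 * - (+ 5 * g)
    l0 = solve-∀

  -- Parity patterns and their unique rotation

  bit : Bool → ℕ
  bit true = 1
  bit false = 0

  weight : Bits → ℕ
  weight (b0 , b1 , b2 , b3 , b4 , b5) = bit b0 ℕ.+ bit b1 ℕ.+ bit b2 ℕ.+ bit b3 ℕ.+ bit b4 ℕ.+ bit b5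

  allBool? : {P : Bool → Set} → (∀ b → Dec (P b)) → Dec (∀ b → P b)
  allBool? P? = map′ (λ { (p , q) true → p ; (p , q) false → q }) (λ h → h true , h false) (P? true ×-dec P? false)

  allBits? : {P : Bits → Set} → (∀ b → Dec (P b)) → Dec (∀ b → P b)
  allBits? P? = map′ (λ { h (b0 , b1 , b2 , b3 , b4 , b5) → h b0 b1 b2 b3 b4 b5 }) (λ h _ _ _ _ _ _ → h _)
    (allBool? λ b0 → allBool? λ b1 → allBool? λ b2 → allBool? λ b3 → allBool? λ b4 → allBool? λ b5 → P?
      (b0 , b1 , b2 , b3 , b4 , b5))

  abstract

    -- A weight that is 1 modulo 4 is 1 or 5: the only odd coordinate is rotated to the last place,
    -- or the only even one to the fifth. The 64 patterns are checked by evaluation.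
    good-rotation : ∀ b → + 4 ∣ + weight b - + 1 → ∃ λ (j : Fin 6) → Good (rotBits (toℕ j) b)
    good-rotation = toWitness {a? = allBits? λ b → (+ 4 ∣? + weight b - + 1) →-dec Fin.any? λ j → good?
      (rotBits (toℕ j) b)} tt

    -- The place of the exceptional coordinate determines the rotation.
    good-rotation-unique : ∀ b (j k : Fin 6) → Good (rotBits (toℕ j) b) → Good (rotBits (toℕ k) b) → j ≡ k
    good-rotation-unique = toWitness {a? = allBits? λ b → Fin.all? λ j → Fin.all? λ k →
      good? (rotBits (toℕ j) b) →-dec (good? (rotBits (toℕ k) b) →-dec (j Fin.≟ k))} tt

  gen : Fin 6 → ℤ
  gen j = 2^ (toℕ j)

  square₄ : ∀ x → ∃ λ k → x * x ≡ + 4 * k + + bit (par x)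
  square₄ x with par x in e
  ... | true  = half x * half x + half x , trans (cong (λ u → u * u) (half-odd x e)) (l (half x))
    where
    l : ∀ h → (+ 2 * h + + 1) * (+ 2 * h + + 1) ≡ + 4 * (h * h + h) + + 1
    l = solve-∀
  ... | false = half x * half x , trans (cong (λ u → u * u) (half-even x e)) (l (half x))
    where
    l : ∀ h → (+ 2 * h) * (+ 2 * h) ≡ + 4 * (h * h) + + 0
    l = solve-∀

  -- A square is 0 or 1 modulo 4 according to parity, so the norm counts the odd coordinates modulo
  -- 4.
  norm-weight : ∀ x → ∃ λ k → norm₆ x ≡ + 4 * k + + weight (bits x)
  norm-weight (x0 , x1 , x2 , x3 , x4 , x5) =
    add (add (add (add (add (square₄ x0) (square₄ x1)) (square₄ x2)) (square₄ x3)) (square₄ x4)) (square₄ x5)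
    where
    l : ∀ k k′ b b′ → (+ 4 * k + b) + (+ 4 * k′ + b′) ≡ + 4 * (k + k′) + (b + b′)
    l = solve-∀
    add : ∀ {a c b d} → (∃ λ k → a ≡ + 4 * k + + b) → (∃ λ k → c ≡ + 4 * k + + d) → ∃ λ k → a + c ≡ + 4 * k + +
      (b ℕ.+ d)
    add {b = b} {d} (k , refl) (k′ , refl) = k + k′ , l k k′ (+ b) (+ d)

  Sextuple : ℤ → ℤ⁶ → Set
  Sextuple T x = Class (+ 1) x × norm₆ x ≡ T

  Rotated : ℤ → Fin 6 × ℤ⁶ → Set
  Rotated T (j , x) = Class (gen j) x × norm₆ x ≡ T × Good (bits x)

  module _ (M : ℤ) {T : ℤ} (T≡ : T ≡ + 169 * (+ 8 * M + + 1)) where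

    weight≡1 : ∀ x → Sextuple T x → + 4 ∣ + weight (bits x) - + 1
    weight≡1 x (_ , e) with norm-weight x
    ... | k , e′ = divides (+ 42 + + 169 * (+ 2 * M) - k)
      (trans (l k (+ weight (bits x))) (trans (cong (_- (+ 4 * k + + 1)) (trans (sym e′) (trans e T≡))) (l′ M k)))
      where
      l : ∀ k w → w - + 1 ≡ (+ 4 * k + w) - (+ 4 * k + + 1)
      l = solve-∀
      l′ : ∀ M k → + 169 * (+ 8 * M + + 1) - (+ 4 * k + + 1) ≡ (+ 42 + + 169 * (+ 2 * M) - k) * + 4
      l′ = solve-∀

    norm-rot⁻ : ∀ k y → norm₆ (rot⁻ k y) ≡ norm₆ y
    norm-rot⁻ k y = trans (sym (norm-rot k (rot⁻ k y))) (cong norm₆ (rot-rot⁻ k y))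

    to-good : ∀ x → Sextuple T x → ∃ λ p → Rotated T p × x ≡ rot⁻ (toℕ (proj₁ p)) (proj₂ p)
    to-good x p@(c , e) = go (good-rotation (bits x) (weight≡1 x p))
      where
      go : (∃ λ (j : Fin 6) → Good (rotBits (toℕ j) (bits x))) → ∃ λ p → Rotated T p × x ≡ rot⁻ (toℕ (proj₁ p))
        (proj₂ p)
      go (j , g) = (j , rot (toℕ j) x) ,
        (subst (λ h → Class h (rot (toℕ j) x)) (*-identityʳ (gen j)) (class-rot (toℕ j) (+ 1) x c) ,
         trans (norm-rot (toℕ j) x) e , subst Good (sym (bits-rot (toℕ j) x)) g) , sym (rot⁻-rot (toℕ j) x)

    good-bits : ∀ {x y} (j : Fin 6) → x ≡ rot⁻ (toℕ j) y → Good (bits y) → Good (rotBits (toℕ j) (bits x))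
    good-bits {x} {y} j refl g = subst Good (trans (cong bits (sym (rot-rot⁻ (toℕ j) y)))
      (bits-rot (toℕ j) (rot⁻ (toℕ j) y))) g

    rot⁻-cancel : ∀ {x y z} {j k : Fin 6} → x ≡ rot⁻ (toℕ j) y → x ≡ rot⁻ (toℕ k) z → j ≡ k → (j , y) ≡ (k , z)
    rot⁻-cancel {y = y} {z = z} {j} refl q refl =
        cong (j ,_) (trans (sym (rot-rot⁻ (toℕ j) y)) (trans (cong (rot (toℕ j)) q) (rot-rot⁻ (toℕ j) z)))

    from-good : ∀ j y → Rotated T (j , y) → Sextuple T (rot⁻ (toℕ j) y)
    from-good j y (c , e , g) = class-rot⁻ (toℕ j) (+ 1) y
      (subst (λ h → Class h y) (sym (*-identityʳ (gen j))) c) , trans (norm-rot⁻ (toℕ j) y) e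

    good-unique : ∀ {x j y k z} → Rotated T (j , y) → Rotated T (k , z) → x ≡ rot⁻ (toℕ j) y → x ≡ rot⁻
      (toℕ k) z → (j , y) ≡ (k , z)
    good-unique {x} {j} {y} {k} {z} (_ , _ , g) (_ , _ , g′) r r′ = rot⁻-cancel {j = j} {k} r r′
      (good-rotation-unique (bits x) j k (good-bits j r g) (good-bits k r′ g′))

    -- Each vector has exactly one shift with the standard pattern. Its number j stays as a label,
    -- since the class has become 2ʲ and the shift must be undone.
    sextuples≅rotated : Sextuple T ≅ Rotated T via λ x p → x ≡ rot⁻ (toℕ (proj₁ p)) (proj₂ p)
    sextuples≅rotated = record
      { total = λ {x} → to-good x
      ; surjective = λ {p} h → rot⁻ (toℕ (proj₁ p)) (proj₂ p) , from-good (proj₁ p) (proj₂ p) h , refl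
      ; functional = λ _ → good-unique
      ; injective = λ { _ _ _ r s → trans r (sym s) }
      }

  -- Two reflections that cut down to a four-dimensional slice

  Labelled⁶ : Set
  Labelled⁶ = Fin 6 × ℤ⁶

  _≟ˡ⁶_ : DecidableEquality Labelled⁶
  _≟ˡ⁶_ = ≡-dec Fin._≟_ _≟₆_

  defect₁ : ℤ⁶ → ℤ
  defect₁ (x0 , x1 , x2 , x3 , _) = x0 - x1 - x2 - x3

  -- The reflection in ½ (1, −1, −1, −1, 0, 0).
  reflect₁ : ℤ → ℤ⁶ → ℤ⁶
  reflect₁ d (x0 , x1 , x2 , x3 , x4 , x5) = x0 - d , x1 + d , x2 + d , x3 + d , x4 , x5

  σ₁ : Labelled⁶ → Labelled⁶
  σ₁ (j , x) = j , reflect₁ (half (defect₁ x)) x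

  defect₁-even : ∀ x → Good (bits x) → defect₁ x ≡ + 2 * half (defect₁ x)
  defect₁-even (x0 , x1 , x2 , x3 , _) (e1 , e2 , e3 , _) = half-even (x0 - x1 - x2 - x3)
    (trans (par-sub (x0 - x1 - x2) x3)
      (trans (cong₂ _xor_ (trans (par-sub (x0 - x1) x2)
        (cong₂ _xor_ (trans (par-sub x0 x1) (cong (par x0 xor_) e1)) e2)) e3) (go (par x0))))
    where
    go : ∀ b → ((b xor b) xor b) xor b ≡ false
    go true  = refl
    go false = refl

  -- As 1 - 2 - 4 - 8 = -13, the inner product with the reflecting vector vanishes modulo 13. So
  -- does its half `d`, and no coordinate changes its residue.
  class-reflect₁ : ∀ g d x → defect₁ x ≡ + 2 * d → Class g x → Class g (reflect₁ d x)
  class-reflect₁ g d x@(x0 , x1 , x2 , x3 , x4 , x5) e (c0 , c1 , c2 , c3 , c4 , c5) =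
    ≈-shift (+ 0) (sub-cong≈ c0 d≈0) (l₀ g) , add c1 , add c2 , add c3 , c4 , c5
    where
    l₀ : ∀ g → g - + 0 ≡ g + + 13 * + 0
    l₀ = solve-∀
    l₁ : ∀ g → g - + 2 * g - + 4 * g - + 8 * g ≡ + 2 * + 0 + + 13 * - g
    l₁ = solve-∀
    d≈0 : d ≈ + 0
    d≈0 = halve≈ (≈-respˡ e (≈-shift (- g) (sub-cong≈ (sub-cong≈ (sub-cong≈ c0 c1) c2) c3) (l₁ g)))
    add : ∀ {a b} → a ≈ b → a + d ≈ b
    add {a} {b} p = ≈-trans (+-cong≈ p d≈0) (≈-reflexive (+-identityʳ b))

  norm-reflect₁ : ∀ d x → defect₁ x ≡ + 2 * d → norm₆ (reflect₁ d x) ≡ norm₆ x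
  norm-reflect₁ d x@(x0 , x1 , x2 , x3 , x4 , x5) e = trans (l x0 x1 x2 x3 x4 x5 d)
    (trans (cong (λ u → norm₆ x + + 2 * d * (+ 2 * d - u)) e) (l′ (norm₆ x) d))
    where
    l : ∀ x0 x1 x2 x3 x4 x5 d → (x0 - d) * (x0 - d) + (x1 + d) * (x1 + d) + (x2 + d) * (x2 + d) + (x3 + d) *
      (x3 + d) + x4 * x4 + x5 * x5
      ≡ (x0 * x0 + x1 * x1 + x2 * x2 + x3 * x3 + x4 * x4 + x5 * x5) + + 2 * d * (+ 2 * d - (x0 - x1 - x2 - x3))
    l = solve-∀
    l′ : ∀ n d → n + + 2 * d * (+ 2 * d - + 2 * d) ≡ n
    l′ = solve-∀

  -- The first four coordinates all change by ±`d`, so their parities move together.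
  good-reflect₁ : ∀ d x → Good (bits x) → Good (bits (reflect₁ d x))
  good-reflect₁ d (x0 , x1 , x2 , x3 , x4 , x5) (e1 , e2 , e3 , e4 , e5) = f x1 e1 , f x2 e2 , f x3 e3 , e4 , e5
    where
    f : ∀ y → par y ≡ par x0 → par (y + d) ≡ par (x0 - d)
    f y e = trans (par-+ y d) (trans (cong (_xor par d) e) (sym (par-sub x0 d)))

  reflect₁-involutive : ∀ x → Good (bits x) → reflect₁ (half (defect₁ (reflect₁ (half (defect₁ x)) x)))
    (reflect₁ (half (defect₁ x)) x) ≡ x
  reflect₁-involutive x@(x0 , x1 , x2 , x3 , x4 , x5) g =
    trans (cong (λ u → reflect₁ u (reflect₁ d x)) (half-unique (defect₁ (reflect₁ d x)) (- d)
      (trans (l x0 x1 x2 x3 d) (trans (cong (λ u → u - + 4 * d) (defect₁-even x g)) (l′ d)))))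
      (tuple₆ (m x0 d) (n x1 d) (n x2 d) (n x3 d) refl refl)
    where
    d = half (defect₁ x)
    l : ∀ x0 x1 x2 x3 d → (x0 - d) - (x1 + d) - (x2 + d) - (x3 + d) ≡ (x0 - x1 - x2 - x3) - + 4 * d
    l = solve-∀
    l′ : ∀ d → + 2 * d - + 4 * d ≡ + 2 * - d
    l′ = solve-∀
    m : ∀ x d → (x - d) - - d ≡ x
    m = solve-∀
    n : ∀ x d → (x + d) + - d ≡ x
    n = solve-∀

  σ₁-preserves : ∀ {T p} → Rotated T p → Rotated T (σ₁ p)
  σ₁-preserves {T} {j , x} (c , e , g) = class-reflect₁ (gen j) d x (defect₁-even x g) c , trans
    (norm-reflect₁ d x (defect₁-even x g)) e , good-reflect₁ d x g
    where
    d = half (defect₁ x)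

  Slice₁ : ℤ → Labelled⁶ → Set
  Slice₁ T (j , x) = Rotated T (j , x) × defect₁ x ≡ + 0

  fixed₁ : ∀ {T b} → HasParity (Rotated T) b → HasParity (Slice₁ T) b
  fixed₁ {T} h = resp-⇔ (λ {p} → to p) (λ {p} → from p) (involution _≟ˡ⁶_ σ₁ (λ {p} → σ₁-preserves {T} {p})
    (λ { {j , x} (_ , _ , g) → cong (j ,_) (reflect₁-involutive x g) }) h)
    where
    to : ∀ p → Rotated T p × σ₁ p ≡ p → Slice₁ T p
    to p@(j , x@(x0 , _)) (q@(_ , _ , g) , e) = q , trans (defect₁-even x g) (cong (+ 2 *_) d≡0)
      where
      d = half (defect₁ x)
      l : ∀ x d → d ≡ x - (x - d)
      l = solve-∀
      d≡0 : d ≡ + 0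
      d≡0 = trans (l x0 d) (trans (cong (λ p → x0 - proj₁ (proj₂ p)) e) (+-inverseʳ x0))
    from : ∀ p → Slice₁ T p → Rotated T p × σ₁ p ≡ p
    from p@(j , x@(x0 , x1 , x2 , x3 , x4 , x5)) (q , e) = q , cong (j ,_)
      (trans (cong (λ d → reflect₁ d x) (half-unique (defect₁ x) (+ 0) e))
      (tuple₆ (+-identityʳ x0) (+-identityʳ x1) (+-identityʳ x2) (+-identityʳ x3) refl refl))

  -- The inner product with (1, 1, -1, 1, 2, 0) is 2 `defect₂` + `defect₁`. On the slice where
  -- `defect₁` vanishes, `defect₂` is therefore half of it, and even, so the reflection is integral
  -- there.
  defect₂ : ℤ⁶ → ℤ
  defect₂ (_ , x1 , _ , x3 , x4 , _) = x1 + x3 + x4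

  -- The reflection in ½ (1, 1, −1, 1, 2, 0).
  reflect₂ : ℤ → ℤ⁶ → ℤ⁶
  reflect₂ d (x0 , x1 , x2 , x3 , x4 , x5) = x0 - d , x1 - d , x2 + d , x3 - d , x4 - + 2 * d , x5

  σ₂ : Labelled⁶ → Labelled⁶
  σ₂ (j , x) = j , reflect₂ (half (defect₂ x)) x

  defect₂-even : ∀ x → Good (bits x) → defect₂ x ≡ + 2 * half (defect₂ x)
  defect₂-even (x0 , x1 , _ , x3 , x4 , _) (e1 , _ , e3 , e4 , _) = half-even (x1 + x3 + x4)
    (trans (par-+ (x1 + x3) x4) (trans (cong₂ _xor_ (trans (par-+ x1 x3) (cong₂ _xor_ e1 e3)) e4) (go (par x0))))
    where
    go : ∀ b → (b xor b) xor false ≡ false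
    go true  = refl
    go false = refl

  -- Here 2 + 8 + 16 = 26 is the multiple of 13 that makes `d` vanish modulo 13.
  class-reflect₂ : ∀ g d x → defect₂ x ≡ + 2 * d → Class g x → Class g (reflect₂ d x)
  class-reflect₂ g d x@(x0 , x1 , x2 , x3 , x4 , x5) e (c0 , c1 , c2 , c3 , c4 , c5) =
    sub c0 d≈0 , sub c1 d≈0 , ≈-trans (+-cong≈ c2 d≈0) (≈-reflexive (+-identityʳ _)) , sub c3 d≈0 , sub c4
      (*-cong≈ (+ 2) d≈0) , c5
    where
    l₁ : ∀ g → + 2 * g + + 8 * g + + 16 * g ≡ + 2 * + 0 + + 13 * (+ 2 * g)
    l₁ = solve-∀
    d≈0 : d ≈ + 0
    d≈0 = halve≈ (≈-respˡ e (≈-shift (+ 2 * g) (+-cong≈ (+-cong≈ c1 c3) c4) (l₁ g)))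
    sub : ∀ {a b c} → a ≈ b → c ≈ + 0 → a - c ≈ b
    sub {a} {b} p q = ≈-trans (sub-cong≈ p q) (≈-reflexive (+-identityʳ b))

  norm-reflect₂ : ∀ d x → defect₁ x ≡ + 0 → defect₂ x ≡ + 2 * d → norm₆ (reflect₂ d x) ≡ norm₆ x
  norm-reflect₂ d x@(x0 , x1 , x2 , x3 , x4 , x5) e₁ e₂ = trans (l x0 x1 x2 x3 x4 x5 d)
    (trans (cong₂ (λ u v → norm₆ x + + 4 * d * (+ 2 * d - u) - + 2 * d * v) e₂ e₁) (l′ (norm₆ x) d))
    where
    l : ∀ x0 x1 x2 x3 x4 x5 d → (x0 - d) * (x0 - d) + (x1 - d) * (x1 - d) + (x2 + d) * (x2 + d) + (x3 - d) * (x3 - d)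
        + (x4 - + 2 * d) * (x4 - + 2 * d) + x5 * x5
      ≡ (x0 * x0 + x1 * x1 + x2 * x2 + x3 * x3 + x4 * x4 + x5 * x5) + + 4 * d * (+ 2 * d - (x1 + x3 + x4)) - +
        2 * d * (x0 - x1 - x2 - x3)
    l = solve-∀
    l′ : ∀ n d → n + + 4 * d * (+ 2 * d - + 2 * d) - + 2 * d * + 0 ≡ n
    l′ = solve-∀

  good-reflect₂ : ∀ d x → Good (bits x) → Good (bits (reflect₂ d x))
  good-reflect₂ d (x0 , x1 , x2 , x3 , x4 , x5) (e1 , e2 , e3 , e4 , e5) =
    f x1 e1 , trans (par-+ x2 d) (trans (cong (_xor par d) e2) (sym (par-sub x0 d))) , f x3 e3 ,
    trans (par-sub x4 (+ 2 * d)) (cong₂ _xor_ e4 (par-2* d)) , e5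
    where
    f : ∀ y → par y ≡ par x0 → par (y - d) ≡ par (x0 - d)
    f y e = trans (par-sub y d) (trans (cong (_xor par d) e) (sym (par-sub x0 d)))

  -- The two reflecting vectors are orthogonal.
  defect₁-reflect₂ : ∀ d x → defect₁ (reflect₂ d x) ≡ defect₁ x
  defect₁-reflect₂ d (x0 , x1 , x2 , x3 , _) = l x0 x1 x2 x3 d
    where
    l : ∀ x0 x1 x2 x3 d → (x0 - d) - (x1 - d) - (x2 + d) - (x3 - d) ≡ x0 - x1 - x2 - x3
    l = solve-∀

  reflect₂-involutive : ∀ x → Good (bits x) → reflect₂ (half (defect₂ (reflect₂ (half (defect₂ x)) x)))
    (reflect₂ (half (defect₂ x)) x) ≡ x
  reflect₂-involutive x@(x0 , x1 , x2 , x3 , x4 , x5) g =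
    trans (cong (λ u → reflect₂ u (reflect₂ d x)) (half-unique (defect₂ (reflect₂ d x)) (- d)
      (trans (l x1 x3 x4 d) (trans (cong (λ u → u - + 4 * d) (defect₂-even x g)) (l′ d)))))
      (tuple₆ (m x0 d) (m x1 d) (n x2 d) (m x3 d) (k x4 d) refl)
    where
    d = half (defect₂ x)
    l : ∀ x1 x3 x4 d → (x1 - d) + (x3 - d) + (x4 - + 2 * d) ≡ (x1 + x3 + x4) - + 4 * d
    l = solve-∀
    l′ : ∀ d → + 2 * d - + 4 * d ≡ + 2 * - d
    l′ = solve-∀
    m : ∀ x d → (x - d) - - d ≡ x
    m = solve-∀
    n : ∀ x d → (x + d) + - d ≡ x
    n = solve-∀
    k : ∀ x d → (x - + 2 * d) - + 2 * - d ≡ x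
    k = solve-∀

  σ₂-preserves : ∀ {T p} → Slice₁ T p → Slice₁ T (σ₂ p)
  σ₂-preserves {T} {j , x} ((c , e , g) , e₁) =
    (class-reflect₂ (gen j) d x (defect₂-even x g) c , trans (norm-reflect₂ d x e₁ (defect₂-even x g)) e ,
      good-reflect₂ d x g) ,
    trans (defect₁-reflect₂ d x) e₁
    where
    d = half (defect₂ x)

  Slice₂ : ℤ → Labelled⁶ → Set
  Slice₂ T (j , x) = Slice₁ T (j , x) × defect₂ x ≡ + 0

  fixed₂ : ∀ {T b} → HasParity (Slice₁ T) b → HasParity (Slice₂ T) b
  fixed₂ {T} h = resp-⇔ (λ {p} → to p) (λ {p} → from p) (involution _≟ˡ⁶_ σ₂ (λ {p} → σ₂-preserves {T} {p})
    (λ { {j , x} ((_ , _ , g) , _) → cong (j ,_) (reflect₂-involutive x g) }) h)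
    where
    to : ∀ p → Slice₁ T p × σ₂ p ≡ p → Slice₂ T p
    to p@(j , x@(x0 , _)) (q@((_ , _ , g) , _) , e) = q , trans (defect₂-even x g) (cong (+ 2 *_) d≡0)
      where
      d = half (defect₂ x)
      l : ∀ x d → d ≡ x - (x - d)
      l = solve-∀
      d≡0 : d ≡ + 0
      d≡0 = trans (l x0 d) (trans (cong (λ p → x0 - proj₁ (proj₂ p)) e) (+-inverseʳ x0))
    from : ∀ p → Slice₂ T p → Slice₁ T p × σ₂ p ≡ p
    from p@(j , x@(x0 , x1 , x2 , x3 , x4 , x5)) (q , e) = q , cong (j ,_)
      (trans (cong (λ d → reflect₂ d x) (half-unique (defect₂ x) (+ 0) e))
      (tuple₆ (+-identityʳ x0) (+-identityʳ x1) (+-identityʳ x2) (+-identityʳ x3) (+-identityʳ x4) refl))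

  -- The vectors of Slice₂, written as (e + 2s, e + 2d, 2s − e, e − 2d, −2e, y).
  Labelled⁴ : Set
  Labelled⁴ = Fin 6 × ℤ × ℤ × ℤ × ℤ

  _≟ˡ⁴_ : DecidableEquality Labelled⁴
  _≟ˡ⁴_ = ≡-dec Fin._≟_ (≡-dec _≟_ (≡-dec _≟_ (≡-dec _≟_ _≟_)))

  -- The residues solve the linear equations that `Class` imposes on the parametrisation. That `d`
  -- and `e` receive the same residue is what allows them to be exchanged later.
  Quadruple : ℤ → Labelled⁴ → Set
  Quadruple T (j , y , s , d , e) = (y ≈ + 32 * gen j × s ≈ - (+ 2 * gen j) × d ≈ + 5 * gen j × e ≈ + 5 * gen j) ×
    y * y + + 8 * (s * s + d * d + e * e) ≡ T

  embed : Labelled⁴ → Labelled⁶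
  embed (j , y , s , d , e) = j , e + + 2 * s , e + + 2 * d , + 2 * s - e , e - + 2 * d , - (+ 2 * e) , y

  embed-injective : ∀ {p q} → embed p ≡ embed q → p ≡ q
  embed-injective {p} {q} eq = trans (sym (retract p)) (trans (cong project eq) (retract q))
    where
    project : Labelled⁶ → Labelled⁴
    project (j , x0 , x1 , x2 , x3 , x4 , x5) = let e = half (- x4) in j , x5 , half (x0 - e) , half (x1 - e) , e
    h₁ : ∀ e → half (- - (+ 2 * e)) ≡ e
    h₁ e = half-unique _ e (neg-involutive (+ 2 * e))
    l : ∀ e s → (e + + 2 * s) - e ≡ + 2 * s
    l = solve-∀
    retract : ∀ p → project (embed p) ≡ p
    retract (j , y , s , d , e) = trans
      (cong (λ u → j , y , half (e + + 2 * s - u) , half (e + + 2 * d - u) , u) (h₁ e))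
      (cong₂ (λ u v → j , y , u , v , e) (half-unique _ s (l e s)) (half-unique _ d (l e d)))

  embed-class : ∀ j y s d e → (y ≈ + 32 * gen j × s ≈ - (+ 2 * gen j) × d ≈ + 5 * gen j × e ≈ + 5 * gen j) →
    Class (gen j) (proj₂ (embed (j , y , s , d , e)))
  embed-class j y s d e (cy , cs , cd , ce) =
    ≈-shift (+ 0) (+-cong≈ ce (*-cong≈ (+ 2) cs)) (l0 g) ,
    ≈-shift g (+-cong≈ ce (*-cong≈ (+ 2) cd)) (l1 g) ,
    ≈-shift (- g) (sub-cong≈ (*-cong≈ (+ 2) cs) ce) (l2 g) ,
    ≈-shift (- g) (sub-cong≈ ce (*-cong≈ (+ 2) cd)) (l3 g) ,
    ≈-shift (- (+ 2 * g)) (neg-cong≈ (*-cong≈ (+ 2) ce)) (l4 g) , cy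
    where
    g = gen j
    l0 : ∀ g → + 5 * g + + 2 * - (+ 2 * g) ≡ g + + 13 * + 0
    l0 = solve-∀
    l1 : ∀ g → + 5 * g + + 2 * (+ 5 * g) ≡ + 2 * g + + 13 * g
    l1 = solve-∀
    l2 : ∀ g → + 2 * - (+ 2 * g) - + 5 * g ≡ + 4 * g + + 13 * - g
    l2 = solve-∀
    l3 : ∀ g → + 5 * g - + 2 * (+ 5 * g) ≡ + 8 * g + + 13 * - g
    l3 = solve-∀
    l4 : ∀ g → - (+ 2 * (+ 5 * g)) ≡ + 16 * g + + 13 * - (+ 2 * g)
    l4 = solve-∀

  embed-norm : ∀ y s d e → norm₆ (e + + 2 * s , e + + 2 * d , + 2 * s - e , e - + 2 * d , - (+ 2 * e) , y) ≡ y
    * y + + 8 * (s * s + d * d + e * e)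
  embed-norm = l
    where
    l : ∀ y s d e → (e + + 2 * s) * (e + + 2 * s) + (e + + 2 * d) * (e + + 2 * d) + (+ 2 * s - e) * (+ 2 * s - e)
      + (e - + 2 * d) * (e - + 2 * d) + - (+ 2 * e) * - (+ 2 * e) + y * y ≡ y * y + + 8 * (s * s + d * d + e * e)
    l = solve-∀

  par-square : ∀ y → par (y * y) ≡ par y
  par-square y = par-unique (y * y) (+ 2 * proj₁ (square₄ y)) (par y)
    (trans (proj₂ (square₄ y)) (trans (cong (λ u → + 4 * proj₁ (square₄ y) + u) (go (par y)))
      (m (proj₁ (square₄ y)) ⟦ par y ⟧)))
    where
    go : ∀ b → + bit b ≡ ⟦ b ⟧
    go true = refl
    go false = refl
    m : ∀ k b → + 4 * k + b ≡ + 2 * (+ 2 * k) + b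
    m = solve-∀

  odd-norm : ∀ M y k → y * y + + 8 * k ≡ + 169 * (+ 8 * M + + 1) → par y ≡ true
  odd-norm M y k eq = trans (sym (par-square y)) (par-unique (y * y) (+ 169 * (+ 4 * M) + + 84 - + 4 * k) true
    (trans (l (y * y) k) (trans (cong (_- + 8 * k) eq) (l′ M k))))
    where
    l : ∀ u k → u ≡ (u + + 8 * k) - + 8 * k
    l = solve-∀
    l′ : ∀ M k → + 169 * (+ 8 * M + + 1) - + 8 * k ≡ + 2 * (+ 169 * (+ 4 * M) + + 84 - + 4 * k) + + 1
    l′ = solve-∀

  odd-square : ∀ y → par y ≡ true → ∃ λ t → y * y ≡ + 8 * t + + 1
  odd-square y e with pronic-even (half y)
  ... | t , e′ = t , trans (cong (λ u → u * u) (half-odd y e))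
    (trans (l (half y)) (trans (cong (λ u → + 4 * u + + 1) e′) (l′ t)))
    where
    l : ∀ h → (+ 2 * h + + 1) * (+ 2 * h + + 1) ≡ + 4 * (h * (h + + 1)) + + 1
    l = solve-∀
    l′ : ∀ t → + 4 * (+ 2 * t) + + 1 ≡ + 8 * t + + 1
    l′ = solve-∀

  module _ (M : ℤ) {T : ℤ} (T≡ : T ≡ + 169 * (+ 8 * M + + 1)) where

    -- If s and d were odd, the left side would be 5 modulo 8.
    both-even : ∀ y s d e → par y ≡ true → par d ≡ par s → y * y + + 2 * (s * s + d * d + + 4 * (e * e)) ≡ T →
      par s ≡ false
    both-even y s d e py pd eq = go (par s) refl
      where
      go : ∀ b → par s ≡ b → par s ≡ false
      go false q = q
      go true  q with odd-square y py | odd-square s q | odd-square d (trans pd q)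
      ... | t , e₁ | u , e₂ | v , e₃ = contradiction
        (*-cancelˡ-≡ (+ 4) (+ 2 * (+ 169 * M + + 21 - t - + 2 * u - + 2 * v - e * e)) (+ 1)
          (trans (l M t u v (e * e)) (trans
            (cong (λ z → z - (+ 8 * t + + 1 + + 2 * (+ 8 * u + + 1 + (+ 8 * v + + 1) + + 4 * (e * e))) + + 4)
            (trans (sym T≡) (trans (sym eq)
              (cong₂ _+_ e₁ (cong (λ w → + 2 * (w + + 4 * (e * e))) (cong₂ _+_ e₂ e₃))))))
            (l′ (+ 8 * t + + 1 + + 2 * (+ 8 * u + + 1 + (+ 8 * v + + 1) + + 4 * (e * e)))))))
        (2*≢1 (+ 169 * M + + 21 - t - + 2 * u - + 2 * v - e * e))
        where
        l : ∀ M t u v f → + 4 * (+ 2 * (+ 169 * M + + 21 - t - + 2 * u - + 2 * v - f)) ≡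
          + 169 * (+ 8 * M + + 1) - (+ 8 * t + + 1 + + 2 * (+ 8 * u + + 1 + (+ 8 * v + + 1) + + 4 * f)) + + 4
        l = solve-∀
        l′ : ∀ w → w - w + + 4 ≡ + 4 * + 1
        l′ = solve-∀

    embed-slice₂ : ∀ q → Quadruple T q → Slice₂ T (embed q)
    embed-slice₂ (j , y , s , d , e) (c , n) =
      ((embed-class j y s d e c , trans (embed-norm y s d e) n ,
        trans (add d) (sym (add s)) , trans sub (sym (add s)) , trans (par-sub e (+ 2 * d))
          (trans (cong (par e xor_) (par-2* d)) (trans (xor-false (par e)) (sym (add s)))) ,
        trans (par-neg (+ 2 * e)) (par-2* e) , odd-norm M y (s * s + d * d + e * e) (trans n T≡)) , l₁ e s d) , l₂ e d
      where
      xor-false : ∀ b → b xor false ≡ b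
      xor-false true = refl
      xor-false false = refl
      add : ∀ s → par (e + + 2 * s) ≡ par e
      add s = trans (par-+ e (+ 2 * s)) (trans (cong (par e xor_) (par-2* s)) (xor-false (par e)))
      sub : par (+ 2 * s - e) ≡ par e
      sub = trans (par-sub (+ 2 * s) e) (cong (_xor par e) (par-2* s))
      l₁ : ∀ e s d → (e + + 2 * s) - (e + + 2 * d) - (+ 2 * s - e) - (e - + 2 * d) ≡ + 0
      l₁ = solve-∀
      l₂ : ∀ e d → (e + + 2 * d) + (e - + 2 * d) + - (+ 2 * e) ≡ + 0
      l₂ = solve-∀

    -- The two orthogonality relations and an even x4 give the form (e + s′, e + d′, s′ - e, e - d′,
    -- -2e, y). That s′ and d′ are even is not linear: it comes from the norm modulo 8.
    unembed : ∀ p → Slice₂ T p → ∃ λ q → p ≡ embed q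
    unembed (j , x@(x0 , x1 , x2 , x3 , x4 , y)) (((c , n , (b1 , b2 , b3 , b4 , b5)) , δ₁) , δ₂) =
      (j , y , half s′ , half d′ , e) , cong (j ,_) (tuple₆ r0 r1 r2 r3 r4 refl)
      where
      e = half (- x4)
      s′ = x2 + e
      d′ = x1 - e
      -x4≡ : - x4 ≡ + 2 * e
      -x4≡ = half-even (- x4) (trans (par-neg x4) b4)
      r4 : x4 ≡ - (+ 2 * e)
      r4 = trans (sym (neg-involutive x4)) (cong -_ -x4≡)
      x3≡ : x3 ≡ e - d′
      x3≡ = trans (l x1 x3 x4) (trans (cong₂ (λ u v → u + v - x1) δ₂ -x4≡) (l′ x1 e))
        where
        l : ∀ x1 x3 x4 → x3 ≡ (x1 + x3 + x4) + - x4 - x1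
        l = solve-∀
        l′ : ∀ x1 e → + 0 + + 2 * e - x1 ≡ e - (x1 - e)
        l′ = solve-∀
      x1≡ : x1 ≡ e + d′
      x1≡ = l x1 e
        where
        l : ∀ x1 e → x1 ≡ e + (x1 - e)
        l = solve-∀
      x2≡ : x2 ≡ s′ - e
      x2≡ = l x2 e
        where
        l : ∀ x2 e → x2 ≡ x2 + e - e
        l = solve-∀
      x0≡ : x0 ≡ e + s′
      x0≡ = trans (l x0 x1 x2 x3) (trans (cong₂ (λ u v → u + x1 + x2 + v) δ₁ x3≡) (l′ x1 x2 e))
        where
        l : ∀ x0 x1 x2 x3 → x0 ≡ (x0 - x1 - x2 - x3) + x1 + x2 + x3
        l = solve-∀
        l′ : ∀ x1 x2 e → + 0 + x1 + x2 + (e - (x1 - e)) ≡ e + (x2 + e)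
        l′ = solve-∀
      norm′ : y * y + + 2 * (s′ * s′ + d′ * d′ + + 4 * (e * e)) ≡ T
      norm′ = trans (l y s′ d′ e) (trans (cong norm₆ (sym (tuple₆ x0≡ x1≡ x2≡ x3≡ r4 (refl {x = y})))) n)
        where
        l : ∀ y s d e → y * y + + 2 * (s * s + d * d + + 4 * (e * e)) ≡ (e + s) * (e + s) + (e + d) * (e + d) +
          (s - e) * (s - e) + (e - d) * (e - d)
          + - (+ 2 * e) * - (+ 2 * e) + y * y
        l = solve-∀
      par-d′ : par d′ ≡ par s′
      par-d′ = trans (par-sub x1 e) (trans (cong (_xor par e) (trans b1 (sym b2))) (sym (par-+ x2 e)))
      s-even : par s′ ≡ false
      s-even = both-even y s′ d′ e b5 par-d′ norm′
      s≡ : s′ ≡ + 2 * half s′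
      s≡ = half-even s′ s-even
      d≡ : d′ ≡ + 2 * half d′
      d≡ = half-even d′ (trans par-d′ s-even)
      r0 : x0 ≡ e + + 2 * half s′
      r0 = trans x0≡ (cong (_+_ e) s≡)
      r1 : x1 ≡ e + + 2 * half d′
      r1 = trans x1≡ (cong (_+_ e) d≡)
      r2 : x2 ≡ + 2 * half s′ - e
      r2 = trans x2≡ (cong (_- e) s≡)
      r3 : x3 ≡ e - + 2 * half d′
      r3 = trans x3≡ (cong (_-_ e) d≡)

    embed-quadruple : ∀ q → Slice₂ T (embed q) → Quadruple T q
    embed-quadruple (j , y , s , d , e) (((((c0 , c1 , c2 , c3 , c4 , c5) , n , _) , _) , _)) =
      (c5 , cs , cd , ce) , trans (sym (embed-norm y s d e)) n
      where
      g = gen j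
      l : ∀ e → - (- (+ 2 * e)) ≡ + 2 * e
      l e = neg-involutive (+ 2 * e)
      l₀ : ∀ g → - (+ 16 * g) ≡ + 2 * (+ 5 * g) + + 13 * - (+ 2 * g)
      l₀ = solve-∀
      ce : e ≈ + 5 * g
      ce = halve≈ (≈-respˡ (l e) (≈-shift (- (+ 2 * g)) (neg-cong≈ c4) (l₀ g)))
      l₁ : ∀ e d → (e + + 2 * d) - e ≡ + 2 * d
      l₁ = solve-∀
      l₂ : ∀ g → + 2 * g - + 5 * g ≡ + 2 * (+ 5 * g) + + 13 * - g
      l₂ = solve-∀
      l₃ : ∀ g → g - + 5 * g ≡ + 2 * - (+ 2 * g) + + 13 * + 0
      l₃ = solve-∀
      cd : d ≈ + 5 * g
      cd = halve≈ (≈-respˡ (l₁ e d) (≈-shift (- g) (sub-cong≈ c1 ce) (l₂ g)))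
      cs : s ≈ - (+ 2 * g)
      cs = halve≈ (≈-respˡ (l₁ e s) (≈-shift (+ 0) (sub-cong≈ c0 ce) (l₃ g)))

    slice₂≅quadruples : Slice₂ T ≅ Quadruple T via λ p q → p ≡ embed q
    slice₂≅quadruples = record
      { total = λ {p} h → let (q , eq) = unembed p h in q , embed-quadruple q (subst (Slice₂ T) eq h) , eq
      ; surjective = λ {q} h → embed q , embed-slice₂ q h , refl
      ; functional = λ _ _ _ r s → embed-injective (trans (sym r) s)
      ; injective = λ _ _ _ r s → trans r (sym s)
      }

  Triple : ℤ → Fin 6 × ℤ × ℤ × ℤ → Set
  Triple T (j , y , s , d) = Quadruple T (j , y , s , d , d)

  swap : Labelled⁴ → Labelled⁴
  swap (j , y , s , d , e) = j , y , s , e , d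

  -- The last two coordinates have the same residue and enter the norm symmetrically.
  fixed-swap : ∀ {T b} → HasParity (Quadruple T) b → HasParity (Triple T) b
  fixed-swap {T} h = transfer iso (involution _≟ˡ⁴_ swap (λ {p} → pres p) (λ _ → refl) h)
    where
    pres : ∀ p → Quadruple T p → Quadruple T (swap p)
    pres (j , y , s , d , e) ((cy , cs , cd , ce) , n) = (cy , cs , ce , cd) , trans (l y s d e) n
      where
      l : ∀ y s d e → y * y + + 8 * (s * s + e * e + d * d) ≡ y * y + + 8 * (s * s + d * d + e * e)
      l = solve-∀
    dup : Fin 6 × ℤ × ℤ × ℤ → Labelled⁴
    dup (j , y , s , d) = j , y , s , d , d
    undup : Labelled⁴ → Fin 6 × ℤ × ℤ × ℤ
    undup (j , y , s , d , _) = j , y , s , d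
    iso : (λ p → Quadruple T p × swap p ≡ p) ≅ Triple T via λ p q → p ≡ dup q
    iso = record
      { total = λ { {p@(j , y , s , d , e)} (w , eq) → undup p , subst (Quadruple T) (eq′ p eq) w , eq′ p eq }
      ; surjective = λ {q} v → dup q , (v , refl) , refl
      ; functional = λ { _ _ _ r s → cong undup (trans (sym r) s) }
      ; injective = λ _ _ _ r s → trans r (sym s)
      }
      where
      eq′ : ∀ p → swap p ≡ p → p ≡ dup (undup p)
      eq′ (j , y , s , d , e) eq = cong (λ u → j , y , s , d , u) (cong (λ q → proj₁ (proj₂ (proj₂ (proj₂ q)))) eq)

  -- Descent by 13 for the ternary form

  ℤ³ : Set
  ℤ³ = ℤ × ℤ × ℤ

  _≟₃_ : DecidableEquality ℤ³
  _≟₃_ = ≡-dec _≟_ (≡-dec _≟_ _≟_)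

  norm₃ : ℤ³ → ℤ
  norm₃ (a , b , c) = a * a + + 8 * (b * b + c * c + c * c)

  -- A quarter of the inner product with (4, 3, -1) for the form `norm₃`.
  func₃ : ℤ³ → ℤ
  func₃ (a , b , c) = a + + 6 * b - + 4 * c

  neg₃ : ℤ³ → ℤ³
  neg₃ (a , b , c) = - a , - b , - c

  tuple₃ : ∀ {a b c a′ b′ c′ : ℤ} → a ≡ a′ → b ≡ b′ → c ≡ c′ → (a , b , c) ≡ (a′ , b′ , c′)
  tuple₃ refl refl refl = refl

  -- Modulo 13, `lift z` is -`func₃ z` times (4, 3, -1), while a triple is (32, -2, 5) ≡ -5 (4, 3,
  -- -1) times `gen j`. Hence the residue 5 `gen j`.
  Descended : ℤ → Fin 6 × ℤ³ → Set
  Descended N (j , z) = func₃ z ≈ + 5 * gen j × norm₃ z ≡ N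

  gen-inverse : ∀ j → ∃ λ h → h * gen j ≈ + 1
  gen-inverse zero = + 1 , mod13 (+ 0) refl
  gen-inverse (suc zero) = + 7 , mod13 (+ 1) refl
  gen-inverse (suc (suc zero)) = + 10 , mod13 (+ 3) refl
  gen-inverse (suc (suc (suc zero))) = + 5 , mod13 (+ 3) refl
  gen-inverse (suc (suc (suc (suc zero)))) = + 9 , mod13 (+ 11) refl
  gen-inverse (suc (suc (suc (suc (suc zero))))) = + 11 , mod13 (+ 27) refl

  gen-cancel : ∀ j {u} → gen j * u ≈ + 0 → u ≈ + 0
  gen-cancel j {u} p with gen-inverse j
  ... | h , mod13 q e = ≈-trans (≈-sym (≈-shift (q * u) (≈-reflexive (trans (l h (gen j) u) (cong (_* u) e)))
    (l′ q u)))
      (≈-trans (*-cong≈ h p) (≈-reflexive (*-zeroʳ h)))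
    where
    l : ∀ h g u → h * (g * u) ≡ (h * g) * u
    l = solve-∀
    l′ : ∀ q u → (+ 1 + + 13 * q) * u ≡ u + + 13 * (q * u)
    l′ = solve-∀

  -- 13 times the reflection in (4, 3, −1), which has norm 104 and interchanges the
  -- lattice with its 13-neighbour.
  lift : ℤ³ → ℤ³
  lift z@(a , b , c) = + 13 * a - + 4 * func₃ z , + 13 * b - + 3 * func₃ z , + 13 * c + func₃ z

  lift-norm : ∀ z → norm₃ (lift z) ≡ + 169 * norm₃ z
  lift-norm (a , b , c) = l a b c
    where
    l : ∀ a b c → (+ 13 * a - + 4 * (a + + 6 * b - + 4 * c)) * (+ 13 * a - + 4 * (a + + 6 * b - + 4 * c))
      + + 8 * ((+ 13 * b - + 3 * (a + + 6 * b - + 4 * c)) * (+ 13 * b - + 3 * (a + + 6 * b - + 4 * c))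
        + (+ 13 * c + (a + + 6 * b - + 4 * c)) * (+ 13 * c + (a + + 6 * b - + 4 * c))
        + (+ 13 * c + (a + + 6 * b - + 4 * c)) * (+ 13 * c + (a + + 6 * b - + 4 * c)))
      ≡ + 169 * (a * a + + 8 * (b * b + c * c + c * c))
    l = solve-∀

  func-lift : ∀ z → func₃ (lift z) ≡ + 13 * - func₃ z
  func-lift (a , b , c) = l a b c (a + + 6 * b - + 4 * c) refl
    where
    l₁ : ∀ a b c f → (+ 13 * a - + 4 * f) + + 6 * (+ 13 * b - + 3 * f) - + 4 * (+ 13 * c + f) ≡ + 13 *
      (a + + 6 * b - + 4 * c) - + 26 * f
    l₁ = solve-∀
    l₂ : ∀ f → + 13 * f - + 26 * f ≡ + 13 * - f
    l₂ = solve-∀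
    l : ∀ a b c f → a + + 6 * b - + 4 * c ≡ f → (+ 13 * a - + 4 * f) + + 6 * (+ 13 * b - + 3 * f) - + 4 *
      (+ 13 * c + f) ≡ + 13 * - f
    l a b c f e = trans (l₁ a b c f) (trans (cong (λ u → + 13 * u - + 26 * f) e) (l₂ f))

  lift-injective : ∀ {z w} → lift z ≡ lift w → z ≡ w
  lift-injective {z@(a , b , c)} {w@(a′ , b′ , c′)} eq =
    tuple₃ (go a a′ (trans (l₁ a f) (trans (cong₂ (λ u v → proj₁ u + + 4 * v) eq f≡) (sym (l₁ a′ f′)))))
           (go b b′ (trans (l₂ b f) (trans (cong₂ (λ u v → proj₁ (proj₂ u) + + 3 * v) eq f≡) (sym (l₂ b′ f′)))))
           (go c c′ (trans (l₃ c f) (trans (cong₂ (λ u v → proj₂ (proj₂ u) - v) eq f≡) (sym (l₃ c′ f′)))))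
    where
    f = func₃ z
    f′ = func₃ w
    go : ∀ x y → + 13 * x ≡ + 13 * y → x ≡ y
    go x y e = *-cancelˡ-≡ (+ 13) x y e
    f≡ : f ≡ f′
    f≡ = neg-injective (go (- f) (- f′) (trans (sym (func-lift z)) (trans (cong func₃ eq) (func-lift w))))
    l₁ : ∀ a f → + 13 * a ≡ (+ 13 * a - + 4 * f) + + 4 * f
    l₁ = solve-∀
    l₂ : ∀ a f → + 13 * a ≡ (+ 13 * a - + 3 * f) + + 3 * f
    l₂ = solve-∀
    l₃ : ∀ a f → + 13 * a ≡ (+ 13 * a + f) - f
    l₃ = solve-∀

  -- The vector (32, -2, 5) has norm 1456 = 13 · 112. Since the whole norm is divisible by 169, the
  -- rest of it, divided by 13, must vanish modulo 13, which is a linear condition on η, σ, δ.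
  isotropic : ∀ g η σ δ N → (+ 32 * g + + 13 * η) * (+ 32 * g + + 13 * η) + + 8 *
    ((- (+ 2 * g) + + 13 * σ) * (- (+ 2 * g) + + 13 * σ)
      + (+ 5 * g + + 13 * δ) * (+ 5 * g + + 13 * δ) + (+ 5 * g + + 13 * δ) * (+ 5 * g + + 13 * δ)) ≡ + 169 * N →
    g * (+ 8 * g - (η + + 6 * σ - + 4 * δ)) ≈ + 0
  isotropic g η σ δ N e = finish (g * (+ 8 * g - (η + + 6 * σ - + 4 * δ)))
    (N - (η * η + + 8 * (σ * σ + δ * δ + δ * δ) + + 8 * (g * g) + g * (+ 5 * η - + 2 * σ + + 12 * δ)))
      (trans (l g η σ δ) (trans (cong
        (λ z → z - + 169 * (η * η + + 8 * (σ * σ + δ * δ + δ * δ) + + 8 * (g * g) + g *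
          (+ 5 * η - + 2 * σ + + 12 * δ))) e)
            (l′ N (η * η + + 8 * (σ * σ + δ * δ + δ * δ) + + 8 * (g * g) + g * (+ 5 * η - + 2 * σ + + 12 * δ)))))
    where
    l : ∀ g η σ δ → + 13 * (g * (+ 8 * g - (η + + 6 * σ - + 4 * δ))) ≡
      ((+ 32 * g + + 13 * η) * (+ 32 * g + + 13 * η) + + 8 * ((- (+ 2 * g) + + 13 * σ) * (- (+ 2 * g) + + 13 * σ)
        + (+ 5 * g + + 13 * δ) * (+ 5 * g + + 13 * δ) + (+ 5 * g + + 13 * δ) * (+ 5 * g + + 13 * δ)))
      - + 169 * (η * η + + 8 * (σ * σ + δ * δ + δ * δ) + + 8 * (g * g) + g * (+ 5 * η - + 2 * σ + + 12 * δ))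
    l = solve-∀
    l′ : ∀ N q → + 169 * N - + 169 * q ≡ + 13 * (+ 0 + + 13 * (N - q))
    l′ = solve-∀
    finish : ∀ u r → + 13 * u ≡ + 13 * (+ 0 + + 13 * r) → u ≈ + 0
    finish u r e = mod13 r (*-cancelˡ-≡ (+ 13) u (+ 0 + + 13 * r) e)

  lift-≡ : ∀ a b c f {y s d} → a + + 6 * b - + 4 * c ≡ f →
    y ≡ + 13 * a - + 4 * f → s ≡ + 13 * b - + 3 * f → d ≡ + 13 * c + f → (y , s , d) ≡ lift (a , b , c)
  lift-≡ a b c f refl refl refl refl = refl

  -- By `func-lift`, the preimage must have `func₃` equal to -1/13 of that of the given vector,
  -- which is 13κ - 8g. Undoing `lift` with this value and dividing by 13 gives the three
  -- coordinates.
  descend : ∀ g η σ δ κ → η ≡ + 8 * g - + 6 * σ + + 4 * δ - + 13 * κ →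
    (+ 32 * g + + 13 * η , - (+ 2 * g) + + 13 * σ , + 5 * g + + 13 * δ) ≡ lift
      (η + + 4 * κ , σ - + 2 * g + + 3 * κ , δ + g - κ)
  descend g η σ δ κ e = lift-≡ (η + + 4 * κ) (σ - + 2 * g + + 3 * κ) (δ + g - κ) (+ 13 * κ - + 8 * g)
    (trans (cong (λ η → (η + + 4 * κ) + + 6 * (σ - + 2 * g + + 3 * κ) - + 4 * (δ + g - κ)) e) (l₀ g σ δ κ))
      (l₁ g η κ) (l₂ g σ κ) (l₃ g δ κ)
    where
    l₀ : ∀ g σ δ κ → (+ 8 * g - + 6 * σ + + 4 * δ - + 13 * κ + + 4 * κ) + + 6 * (σ - + 2 * g + + 3 * κ) - + 4 *
      (δ + g - κ) ≡ + 13 * κ - + 8 * g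
    l₀ = solve-∀
    l₁ : ∀ g η κ → + 32 * g + + 13 * η ≡ + 13 * (η + + 4 * κ) - + 4 * (+ 13 * κ - + 8 * g)
    l₁ = solve-∀
    l₂ : ∀ g σ κ → - (+ 2 * g) + + 13 * σ ≡ + 13 * (σ - + 2 * g + + 3 * κ) - + 3 * (+ 13 * κ - + 8 * g)
    l₂ = solve-∀
    l₃ : ∀ g δ κ → + 5 * g + + 13 * δ ≡ + 13 * (δ + g - κ) + (+ 13 * κ - + 8 * g)
    l₃ = solve-∀

  module _ (N : ℤ) {T : ℤ} (T≡ : T ≡ + 169 * N) where

    lift-triple : ∀ j z → Descended N (j , z) → Triple T (j , lift z)
    lift-triple j z@(a , b , c) (cf , n) =
      (c₁ , c₂ , c₃ , c₃) , trans (lift-norm z) (trans (cong (+ 169 *_) n) (sym T≡))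
      where
      g = gen j
      f = func₃ z
      13*≈0 : ∀ u → + 13 * u ≈ + 0
      13*≈0 u = mod13 u (sym (+-identityˡ (+ 13 * u)))
      c₁ : + 13 * a - + 4 * f ≈ + 32 * g
      c₁ = ≈-trans (sub-cong≈ (13*≈0 a) (*-cong≈ (+ 4) cf)) (mod13 (- (+ 4 * g)) (l g))
        where
        l : ∀ g → + 0 - + 4 * (+ 5 * g) ≡ + 32 * g + + 13 * - (+ 4 * g)
        l = solve-∀
      c₂ : + 13 * b - + 3 * f ≈ - (+ 2 * g)
      c₂ = ≈-trans (sub-cong≈ (13*≈0 b) (*-cong≈ (+ 3) cf)) (mod13 (- g) (l g))
        where
        l : ∀ g → + 0 - + 3 * (+ 5 * g) ≡ - (+ 2 * g) + + 13 * - g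
        l = solve-∀
      c₃ : + 13 * c + f ≈ + 5 * g
      c₃ = ≈-trans (+-cong≈ (13*≈0 c) cf) (≈-reflexive (+-identityˡ (+ 5 * g)))

    unlift : ∀ j x → Triple T (j , x) → ∃ λ z → x ≡ lift z
    unlift j (y , s , d) ((mod13 η refl , mod13 σ refl , mod13 δ refl , _) , n) =
      from (gen-cancel j (isotropic (gen j) η σ δ N (trans n T≡)))
      where
      from : + 8 * gen j - (η + + 6 * σ - + 4 * δ) ≈ + 0 → ∃ λ z →
        (+ 32 * gen j + + 13 * η , - (+ 2 * gen j) + + 13 * σ , + 5 * gen j + + 13 * δ) ≡ lift z
      from (mod13 κ e) = (η + + 4 * κ , σ - + 2 * gen j + + 3 * κ , δ + gen j - κ) , descend (gen j) η σ δ κ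
        (trans (l (gen j) η σ δ) (cong (λ u → + 8 * gen j - + 6 * σ + + 4 * δ - u)
          (trans e (+-identityˡ (+ 13 * κ)))))
        where
        l : ∀ g η σ δ → η ≡ + 8 * g - + 6 * σ + + 4 * δ - (+ 8 * g - (η + + 6 * σ - + 4 * δ))
        l = solve-∀

    lift-descended : ∀ j z → Triple T (j , lift z) → Descended N (j , z)
    lift-descended j z@(a , b , c) ((_ , _ , mod13 q e , _) , n) =
      mod13 (q - c) (trans (l c (func₃ z)) (trans (cong (_- + 13 * c) e) (l′ (+ 5 * gen j) q c))) ,
      *-cancelˡ-≡ (+ 169) (norm₃ z) N (trans (sym (lift-norm z)) (trans n T≡))
      where
      l : ∀ c f → f ≡ + 13 * c + f - + 13 * c
      l = solve-∀
      l′ : ∀ u q c → u + + 13 * q - + 13 * c ≡ u + + 13 * (q - c)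
      l′ = solve-∀

    triples≅descended : Triple T ≅ Descended N via λ p q → p ≡ (proj₁ q , lift (proj₂ q))
    triples≅descended = record
      { total = λ {p} h → let (z , eq) = unlift (proj₁ p) (proj₂ p) h in
          (proj₁ p , z) , lift-descended (proj₁ p) z (subst (λ x → Triple T (proj₁ p , x)) eq h) , cong
            (proj₁ p ,_) eq
      ; surjective = λ {q} h → (proj₁ q , lift (proj₂ q)) , lift-triple (proj₁ q) (proj₂ q) h , refl
      ; functional = λ _ _ _ r s → cong₂ _,_ (cong proj₁ (trans (sym r) s))
        (lift-injective (cong proj₂ (trans (sym r) s)))
      ; injective = λ _ _ _ r s → trans r (sym s)
      }

  -- Ternary vectors up to sign

  Pos : ℤ → Set
  Pos a = ∃ λ n → a ≡ +[1+ n ]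

  Pos₃ : ℤ³ → Set
  Pos₃ (a , _) = Pos a

  pos-or-neg : ∀ {a} → a ≢ + 0 → Pos a ⊎ Pos (- a)
  pos-or-neg { +0 } a≢0       = contradiction refl a≢0
  pos-or-neg { +[1+ n ] } _   = inj₁ (n , refl)
  pos-or-neg { -[1+ n ] } _   = inj₂ (n , refl)

  not-both-pos : ∀ {a} → Pos a → ¬ Pos (- a)
  not-both-pos (_ , refl) (_ , ())

  neg₃-involutive : ∀ z → neg₃ (neg₃ z) ≡ z
  neg₃-involutive (a , b , c) = tuple₃ (neg-involutive a) (neg-involutive b) (neg-involutive c)

  norm-neg₃ : ∀ z → norm₃ (neg₃ z) ≡ norm₃ z
  norm-neg₃ (a , b , c) = l a b c
    where
    l : ∀ a b c → - a * - a + + 8 * (- b * - b + - c * - c + - c * - c) ≡ a * a + + 8 * (b * b + c * c + c * c)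
    l = solve-∀

  func-neg₃ : ∀ z → func₃ (neg₃ z) ≡ - func₃ z
  func-neg₃ (a , b , c) = l a b c
    where
    l : ∀ a b c → - a + + 6 * - b - + 4 * - c ≡ - (a + + 6 * b - + 4 * c)
    l = solve-∀

  abstract

    5gen≉0 : ∀ j → ¬ (+ 5 * gen j ≈ + 0)
    5gen≉0 = toWitness {a? = Fin.all? λ j → ¬? (+ 5 * gen j ≈? + 0)} tt

    5gen-injective : ∀ j k → + 5 * gen j ≈ + 5 * gen k → j ≡ k
    5gen-injective = toWitness {a? = Fin.all? λ j → Fin.all? λ k → (+ 5 * gen j ≈? + 5 * gen k) →-dec (j Fin.≟ k)} tt

    5gen≉-5gen : ∀ j k → ¬ (+ 5 * gen j ≈ - (+ 5 * gen k))
    5gen≉-5gen = toWitness {a? = Fin.all? λ j → Fin.all? λ k → ¬? (+ 5 * gen j ≈? - (+ 5 * gen k))} tt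

    -- Since 2 is a primitive root and 2⁶ ≡ -1, the residues ±5 · 2ʲ with j < 6 exhaust the nonzero
    -- ones; the two preceding facts say that none is repeated.
    residue-class : ∀ (r : Fin 13) → ¬ (+ toℕ r ≈ + 0) → ∃ λ j → (+ toℕ r ≈ + 5 * gen j) ⊎ (+ toℕ r ≈ - (+ 5 * gen j))
    residue-class = toWitness {a? = Fin.all? λ r → ¬? (+ toℕ r ≈? + 0) →-dec
      Fin.any? λ j → (+ toℕ r ≈? + 5 * gen j) ⊎-dec (+ toℕ r ≈? - (+ 5 * gen j))} tt

  ±5gen : ∀ u → ¬ (u ≈ + 0) → ∃ λ j → (u ≈ + 5 * gen j) ⊎ (- u ≈ + 5 * gen j)
  ±5gen u u≉0 = go (residue-class r (λ p → u≉0 (≈-trans u≈r p)))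
    where
    r : Fin 13
    r = Fin.fromℕ< (n%ℕd<d u 13)
    u≈r : u ≈ + toℕ r
    u≈r = mod13 (u /ℕ 13) (trans (a≡a%ℕn+[a/ℕn]*n u 13)
      (cong₂ _+_ (cong (λ m → + m) (sym (Fin.toℕ-fromℕ< (n%ℕd<d u 13)))) (*-comm (u /ℕ 13) (+ 13))))
    go : (∃ λ j → (+ toℕ r ≈ + 5 * gen j) ⊎ (+ toℕ r ≈ - (+ 5 * gen j))) → _
    go (j , inj₁ p) = j , inj₁ (≈-trans u≈r p)
    go (j , inj₂ p) = j , inj₂ (≈-trans (neg-cong≈ (≈-trans u≈r p)) (≈-reflexive (neg-involutive (+ 5 * gen j))))

  -- One vector from each pair ±z: for a norm 8m + 1 the first coordinate is odd, hence nonzero.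
  Upper : ℤ → ℤ³ → Set
  Upper N z = Pos₃ z × norm₃ z ≡ N

  module _ (M : ℤ) {N : ℤ} (N≡ : N ≡ + 8 * M + + 1) where

    a-odd : ∀ z → norm₃ z ≡ N → par (proj₁ z) ≡ true
    a-odd (a , b , c) e = trans (sym (par-square a)) (par-unique (a * a) (+ 4 * (M - k)) true
      (trans (l (a * a) k) (trans (cong (_- + 8 * k) (trans e N≡)) (l′ M k))))
      where
      k = b * b + c * c + c * c
      l : ∀ u k → u ≡ u + + 8 * k - + 8 * k
      l = solve-∀
      l′ : ∀ M k → + 8 * M + + 1 - + 8 * k ≡ + 2 * (+ 4 * (M - k)) + + 1
      l′ = solve-∀

    a≢0 : ∀ z → norm₃ z ≡ N → proj₁ z ≢ + 0
    a≢0 z e a≡0 = contradiction (trans (sym (a-odd z e)) (trans (cong par a≡0) (par-2* (+ 0)))) λ ()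

    infix 4 _≡±_
    _≡±_ : Fin 6 × ℤ³ → ℤ³ → Set
    (_ , z) ≡± u = z ≡ u ⊎ neg₃ z ≡ u

    -- The residue of `func₃` determines both the label and which of ±z carries it. Forgetting the
    -- label and normalising the sign therefore loses nothing, and every vector with `func₃` nonzero
    -- modulo 13 is reached.
    descended≅upper : Descended N ≅ (λ z → Upper N z × ¬ (func₃ z ≈ + 0)) via _≡±_
    descended≅upper = record { total = λ {p} → tot {p} ; surjective = λ {z} → surj {z} ; functional =
      λ {p} {y} {z} → func {p} {y} {z} ; injective = λ {p} {q} {z} → inj {p} {q} {z} }
      where
      tot : ∀ {p} → Descended N p → ∃ λ z → (Upper N z × ¬ (func₃ z ≈ + 0)) × p ≡± z
      tot {j , z} (f , n) = choose (pos-or-neg (a≢0 z n))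
        where
        choose : Pos₃ z ⊎ Pos₃ (neg₃ z) → ∃ λ u → (Upper N u × ¬ (func₃ u ≈ + 0)) × (j , z) ≡± u
        choose (inj₁ q) = z , ((q , n) , λ f0 → 5gen≉0 j (≈-trans (≈-sym f) f0)) , inj₁ refl
        choose (inj₂ q) = neg₃ z , ((q , trans (norm-neg₃ z) n) ,
          λ f0 → 5gen≉0 j (≈-trans (≈-sym f) (≈-trans (≈-reflexive (sym (neg-involutive (func₃ z))))
            (neg-cong≈ (≈-respˡ (func-neg₃ z) f0))))) , inj₂ refl
      surj : ∀ {z} → Upper N z × ¬ (func₃ z ≈ + 0) → ∃ λ p → Descended N p × p ≡± z
      surj {z} ((q , n) , f≉0) with ±5gen (func₃ z) f≉0
      ... | j , inj₁ f = (j , z) , (f , n) , inj₁ refl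
      ... | j , inj₂ f = (j , neg₃ z) , (≈-respˡ (sym (func-neg₃ z)) f , trans (norm-neg₃ z) n) , inj₂
        (neg₃-involutive z)
      func : ∀ {p y z} → Descended N p → Upper N y × ¬ (func₃ y ≈ + 0) → Upper N z × ¬ (func₃ z ≈ + 0) →
        p ≡± y → p ≡± z → y ≡ z
      func _ _ _ (inj₁ r) (inj₁ s) = trans (sym r) s
      func _ _ _ (inj₂ r) (inj₂ s) = trans (sym r) s
      func _ ((q , _) , _) ((q′ , _) , _) (inj₁ refl) (inj₂ refl) = contradiction q′ (not-both-pos q)
      func _ ((q , _) , _) ((q′ , _) , _) (inj₂ refl) (inj₁ refl) = contradiction q (not-both-pos q′)
      neg-func : ∀ j k z w → Descended N (j , z) → Descended N (k , w) → z ≢ neg₃ w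
      neg-func j k z w (f , _) (g , _) refl =
        5gen≉-5gen j k (≈-trans (≈-sym f) (≈-respˡ (sym (func-neg₃ w)) (neg-cong≈ g)))
      inj : ∀ {p q z} → Descended N p → Descended N q → Upper N z × ¬ (func₃ z ≈ + 0) → p ≡± z → q ≡± z → p ≡ q
      inj {j , z} {k , w} v w′ _ r s = go r s
        where
        same : z ≡ w → (j , z) ≡ (k , w)
        same refl = cong (_, z) (5gen-injective j k (≈-trans (≈-sym (proj₁ v)) (proj₁ w′)))
        go : ∀ {u} → z ≡ u ⊎ neg₃ z ≡ u → w ≡ u ⊎ neg₃ w ≡ u → (j , z) ≡ (k , w)
        go (inj₁ refl) (inj₁ refl) = same refl
        go (inj₁ refl) (inj₂ s) = contradiction (sym s) (neg-func j k z w v w′)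
        go (inj₂ refl) (inj₁ s) = contradiction s (neg-func k j w z w′ v)
        go (inj₂ r) (inj₂ s) = same (trans (sym (neg₃-involutive z))
          (trans (cong neg₃ (trans r (sym s))) (neg₃-involutive w)))

  -- Counting the vectors of a given norm

  ints : ℕ → List ℤ
  ints n = map (λ m → + m) (upTo (suc n)) ++ map -[1+_] (upTo n)

  ints-unique : ∀ n → Unique (ints n)
  ints-unique n = Unique.++⁺ (Unique.map⁺ +-injective (Unique.upTo⁺ (suc n)))
    (Unique.map⁺ (λ { refl → refl }) (Unique.upTo⁺ n)) disjoint
    where
    disjoint : ∀ {x} → ¬ (x ∈ map (λ m → + m) (upTo (suc n)) × x ∈ map -[1+_] (upTo n))
    disjoint (p , q) with ∈-map⁻ (λ m → + m) p | ∈-map⁻ -[1+_] q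
    ... | _ , _ , refl | _ , _ , ()

  ∈-ints : ∀ {n} x → ∣ x ∣ ℕ.≤ n → x ∈ ints n
  ∈-ints {n} (+ m) m≤n = ∈-++⁺ˡ (∈-map⁺ (λ m → + m) (∈-upTo⁺ (ℕ.s≤s m≤n)))
  ∈-ints {n} -[1+ m ] m<n = ∈-++⁺ʳ (map (λ m → + m) (upTo (suc n))) (∈-map⁺ -[1+_] (∈-upTo⁺ m<n))

  square-abs : ∀ x → x * x ≡ + (∣ x ∣ ℕ.* ∣ x ∣)
  square-abs (+ n) = sym (pos-* n n)
  square-abs -[1+ n ] = refl

  norm-abs : ∀ a b c → norm₃ (a , b , c) ≡ +
    (∣ a ∣ ℕ.* ∣ a ∣ ℕ.+ 8 ℕ.* (∣ b ∣ ℕ.* ∣ b ∣ ℕ.+ ∣ c ∣ ℕ.* ∣ c ∣ ℕ.+ ∣ c ∣ ℕ.* ∣ c ∣))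
  norm-abs a b c = trans (cong₂ _+_ (square-abs a)
    (cong (+ 8 *_) (cong₂ _+_ (cong₂ _+_ (square-abs b) (square-abs c)) (square-abs c))))
    (cong (λ u → + (∣ a ∣ ℕ.* ∣ a ∣) + u) (sym (pos-* 8 (∣ b ∣ ℕ.* ∣ b ∣ ℕ.+ ∣ c ∣ ℕ.* ∣ c ∣ ℕ.+ ∣ c ∣ ℕ.* ∣ c ∣))))

  m≤m*m : ∀ m → m ℕ.≤ m ℕ.* m
  m≤m*m zero = ℕ.z≤n
  m≤m*m (suc m) = ℕ.m≤m+n (suc m) (m ℕ.* suc m)

  coords-bound : ∀ {n} a b c → norm₃ (a , b , c) ≡ + n → ∣ a ∣ ℕ.≤ n × ∣ b ∣ ℕ.≤ n × ∣ c ∣ ℕ.≤ n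
  coords-bound a b c e with +-injective (trans (sym (norm-abs a b c)) e)
  ... | refl = ℕ.≤-trans (m≤m*m A) (ℕ.m≤m+n (A ℕ.* A) _) ,
    ℕ.≤-trans (m≤m*m B) (ℕ.≤-trans (ℕ.≤-trans (ℕ.m≤m+n (B ℕ.* B) (C ℕ.* C)) (ℕ.m≤m+n _ (C ℕ.* C))) le) ,
    ℕ.≤-trans (m≤m*m C) (ℕ.≤-trans (ℕ.m≤n+m (C ℕ.* C) (B ℕ.* B ℕ.+ C ℕ.* C)) le)
    where
    A = ∣ a ∣
    B = ∣ b ∣
    C = ∣ c ∣
    K = B ℕ.* B ℕ.+ C ℕ.* C ℕ.+ C ℕ.* C
    le : K ℕ.≤ A ℕ.* A ℕ.+ 8 ℕ.* K
    le = ℕ.≤-trans (ℕ.m≤m+n K (7 ℕ.* K)) (ℕ.m≤n+m (8 ℕ.* K) (A ℕ.* A))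

  -- The descent does not reach the vectors orthogonal modulo 13, so the full set needs an
  -- enumeration of its own. Every coordinate is bounded by its square, hence by the norm.
  upper-finite : ∀ n → ∃ λ b → HasParity (Upper (+ n)) b
  upper-finite n = _ , hasParity (filter norm? box) (Unique.filter⁺ norm? box-unique)
    (λ z∈ → let (p , q) = ∈-filter⁻ norm? z∈ in box-pos p , q)
    (λ { {a , b , c} ((m , refl) , e) → let (la , lb , lc) = coords-bound a b c e in
      ∈-filter⁺ norm? (∈-cartesianProduct⁺ (∈-map⁺ +[1+_] (∈-upTo⁺ la))
        (∈-cartesianProduct⁺ (∈-ints b lb) (∈-ints c lc))) e })
    refl
    where
    norm? : ∀ z → Dec (norm₃ z ≡ + n)
    norm? z = norm₃ z ≟ + n
    box : List ℤ³
    box = cartesianProduct (map +[1+_] (upTo n)) (cartesianProduct (ints n) (ints n))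
    box-unique : Unique box
    box-unique = Unique.cartesianProduct⁺ (Unique.map⁺ (λ { refl → refl }) (Unique.upTo⁺ n))
      (Unique.cartesianProduct⁺ (ints-unique n) (ints-unique n))
    box-pos : ∀ {z} → z ∈ box → Pos₃ z
    box-pos {z} z∈ with ∈-map⁻ +[1+_]
      (proj₁ (∈-cartesianProduct⁻ (map +[1+_] (upTo n)) (cartesianProduct (ints n) (ints n)) z∈))
    ... | m , _ , e = m , e

  square-injective : ∀ {m n} → m ℕ.* m ≡ n ℕ.* n → m ≡ n
  square-injective {m} {n} e with ℕ.<-cmp m n
  ... | tri< m<n _ _ = contradiction e (ℕ.<⇒≢ (ℕ.*-mono-< m<n m<n))
  ... | tri≈ _ m≡n _ = m≡n
  ... | tri> _ _ m>n = contradiction (sym e) (ℕ.<⇒≢ (ℕ.*-mono-< m>n m>n))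

  self-neg : ∀ {x} → - x ≡ x → x ≡ + 0
  self-neg { +0 } _ = refl
  self-neg { +[1+ n ] } ()
  self-neg { -[1+ n ] } ()

  -- At most one vector survives both sign changes: (a, 0, 0) with a the positive root of n.
  upper-parity : ∀ {n b} → HasParity (Upper (+ n)) b → (b ≡ true → ∃ λ s → s ℕ.* s ≡ n) ×
    (∃ (λ s → s ℕ.* s ≡ n) → 1 ℕ.≤ n → b ≡ true)
  upper-parity {n} {b} h = (λ e → root (proj₁ par-S e)) , λ { (suc s , e) _ → proj₂ par-S (witness s e) ;
    (zero , refl) () }
    where
    flip-b flip-c : ℤ³ → ℤ³
    flip-b (a , b , c) = a , - b , c
    flip-c (a , b , c) = a , b , - c
    S : ℤ³ → Set
    S z = (Upper (+ n) z × flip-b z ≡ z) × flip-c z ≡ z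
    norm-flip-b : ∀ z → norm₃ (flip-b z) ≡ norm₃ z
    norm-flip-b (a , b , c) = l a b c
      where
      l : ∀ a b c → a * a + + 8 * (- b * - b + c * c + c * c) ≡ a * a + + 8 * (b * b + c * c + c * c)
      l = solve-∀
    norm-flip-c : ∀ z → norm₃ (flip-c z) ≡ norm₃ z
    norm-flip-c (a , b , c) = l a b c
      where
      l : ∀ a b c → a * a + + 8 * (b * b + - c * - c + - c * - c) ≡ a * a + + 8 * (b * b + c * c + c * c)
      l = solve-∀
    h-S : HasParity S b
    h-S = involution _≟₃_ flip-c
      (λ { {z@(a , b , c)} ((p , e) , q) → (p , trans (norm-flip-c z) e) , cong flip-c q })
      (λ { {a , b , c} _ → cong (λ u → a , b , u) (neg-involutive c) })
      (involution _≟₃_ flip-b (λ { {z} (p , e) → p , trans (norm-flip-b z) e })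
        (λ { {a , b , c} _ → cong (λ u → a , u , c) (neg-involutive b) }) h)
    shape : ∀ z → S z → ∃ λ s → z ≡ (+[1+ s ] , + 0 , + 0) × suc s ℕ.* suc s ≡ n
    shape (a , b , c) ((((s , refl) , e) , p) , q) with self-neg (cong (λ z → proj₁ (proj₂ z)) p) | self-neg
      (cong (λ z → proj₂ (proj₂ z)) q)
    ... | refl | refl = s , refl , trans (sym (ℕ.+-identityʳ _))
      (+-injective (trans (sym (norm-abs (+[1+ s ]) (+ 0) (+ 0))) e))
    par-S : (b ≡ true → ∃ S) × (∃ S → b ≡ true)
    par-S = subsingleton-parity (λ {x} {y} p q → uniq (shape x p) (shape y q)) h-S
      where
      uniq : ∀ {x y} → (∃ λ s → x ≡ (+[1+ s ] , + 0 , + 0) × suc s ℕ.* suc s ≡ n) →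
        (∃ λ s → y ≡ (+[1+ s ] , + 0 , + 0) × suc s ℕ.* suc s ≡ n) → x ≡ y
      uniq (s , refl , e) (t , refl , f) = cong (λ u → + u , + 0 , + 0) (square-injective (trans e (sym f)))
    root : ∃ S → ∃ λ s → s ℕ.* s ≡ n
    root (z , p) with shape z p
    ... | s , _ , e = suc s , e
    witness : ∀ s → suc s ℕ.* suc s ≡ n → ∃ S
    witness s e = (+[1+ s ] , + 0 , + 0) ,
      (((s , refl) , trans (norm-abs +[1+ s ] (+ 0) (+ 0)) (cong (λ m → + m) (trans (ℕ.+-identityʳ _) e))) ,
        refl) , refl

  -- The free involution on vectors orthogonal modulo 13

  div13-unique : ∀ k q r → r ℕ.< 13 → + 13 * k ≡ + r + q * + 13 → q ≡ k
  div13-unique k q r r<13 e = sym (trans (l k q) (trans (cong (_+_ q) (small (k - q) r r<13 13d≡r)) (+-identityʳ q)))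
    where
    l : ∀ k q → k ≡ q + (k - q)
    l = solve-∀
    l′ : ∀ k q → + 13 * (k - q) ≡ + 13 * k - q * + 13
    l′ = solve-∀
    l″ : ∀ r q → r + q * + 13 - q * + 13 ≡ r
    l″ = solve-∀
    13d≡r : + 13 * (k - q) ≡ + r
    13d≡r = trans (l′ k q) (trans (cong (_- q * + 13) e) (l″ (+ r) q))
    small : ∀ d r → r ℕ.< 13 → + 13 * d ≡ + r → d ≡ + 0
    small +0 r _ _ = refl
    small +[1+ m ] r r<13 e = contradiction
      (ℕ.≤-trans r<13 (ℕ.≤-trans (ℕ.m≤m*n 13 (suc m))
        (ℕ.≤-reflexive (+-injective (trans (pos-* 13 (suc m)) e))))) (ℕ.<-irrefl refl)
    small -[1+ m ] r _ ()

  abstract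

    -- Defined on all integers, so that `τ` is a plain function, as `involution` requires; it is
    -- applied in earnest only to multiples of 13.
    thirteenth : ℤ → ℤ
    thirteenth u = u /ℕ 13

    thirteenth-eq : ∀ k → thirteenth (+ 13 * k) ≡ k
    thirteenth-eq k = div13-unique k ((+ 13 * k) /ℕ 13) ((+ 13 * k) %ℕ 13) (n%ℕd<d (+ 13 * k) 13)
      (a≡a%ℕn+[a/ℕn]*n (+ 13 * k) 13)

  orient : ℤ³ → ℤ³
  orient z@(+ _ , _) = z
  orient z@(-[1+ _ ] , _) = neg₃ z

  orient-pos : ∀ {z} → Pos₃ z → orient z ≡ z
  orient-pos {_ , _} (_ , refl) = refl

  orient-neg : ∀ {z} → Pos₃ z → orient (neg₃ z) ≡ z
  orient-neg {_ , b , c} (_ , refl) = tuple₃ refl (neg-involutive b) (neg-involutive c)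

  -- Subtracts `k` times (4, 3, -1). This is the reflection as soon as `func₃ z` is 13 `k`.
  shear : ℤ → ℤ³ → ℤ³
  shear k (a , b , c) = a - + 4 * k , b - + 3 * k , c + k

  -- The reflection in (4, 3, −1), made projective by the choice of a sign.
  τ : ℤ³ → ℤ³
  τ z = orient (shear (thirteenth (func₃ z)) z)

  norm-shear : ∀ k z → func₃ z ≡ + 13 * k → norm₃ (shear k z) ≡ norm₃ z
  norm-shear k (a , b , c) e = trans (l a b c k)
    (trans (cong (λ u → a * a + + 8 * (b * b + c * c + c * c) + + 8 * k * (+ 13 * k - u)) e)
      (l′ (a * a + + 8 * (b * b + c * c + c * c)) k (+ 13 * k)))
    where
    l : ∀ a b c k → (a - + 4 * k) * (a - + 4 * k) + + 8 * ((b - + 3 * k) * (b - + 3 * k) + (c + k) * (c + k) +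
      (c + k) * (c + k)) ≡
      a * a + + 8 * (b * b + c * c + c * c) + + 8 * k * (+ 13 * k - (a + + 6 * b - + 4 * c))
    l = solve-∀
    l′ : ∀ n k u → n + + 8 * k * (u - u) ≡ n
    l′ = solve-∀

  func-shear : ∀ k z → func₃ z ≡ + 13 * k → func₃ (shear k z) ≡ + 13 * - k
  func-shear k (a , b , c) e = trans (l a b c k) (trans (cong (_- + 26 * k) e) (l′ k))
    where
    l : ∀ a b c k → (a - + 4 * k) + + 6 * (b - + 3 * k) - + 4 * (c + k) ≡ (a + + 6 * b - + 4 * c) - + 26 * k
    l = solve-∀
    l′ : ∀ k → + 13 * k - + 26 * k ≡ + 13 * - k
    l′ = solve-∀

  shear-shear : ∀ k z → shear (- k) (shear k z) ≡ z
  shear-shear k (a , b , c) = tuple₃ (l (+ 4) a k) (l (+ 3) b k) (l′ c k)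
    where
    l : ∀ m a k → a - m * k - m * - k ≡ a
    l = solve-∀
    l′ : ∀ c k → c + k + - k ≡ c
    l′ = solve-∀

  shear-neg : ∀ k z → shear k (neg₃ (shear k z)) ≡ neg₃ z
  shear-neg k (a , b , c) = tuple₃ (l (+ 4) a k) (l (+ 3) b k) (l′ c k)
    where
    l : ∀ m a k → - (a - m * k) - m * k ≡ - a
    l = solve-∀
    l′ : ∀ c k → - (c + k) + k ≡ - c
    l′ = solve-∀

  τ-at : ∀ k z → func₃ z ≡ + 13 * k → τ z ≡ orient (shear k z)
  τ-at k z e = cong (λ u → orient (shear u z)) (trans (cong thirteenth e) (thirteenth-eq k))

  Upper₀ : ℤ → ℤ³ → Set
  Upper₀ N z = Upper N z × func₃ z ≈ + 0

  module _ (M : ℤ) {N : ℤ} (N≡ : N ≡ + 8 * M + + 1) where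

    τ-image : ∀ {z} → Upper₀ N z → ∃ λ k → func₃ z ≡ + 13 * k ×
      ((Pos₃ (shear k z) × τ z ≡ shear k z) ⊎ (Pos₃ (neg₃ (shear k z)) × τ z ≡ neg₃ (shear k z)))
    τ-image {z} ((_ , n) , mod13 k e) = k , e′ , choose
      (pos-or-neg (a≢0 M N≡ (shear k z) (trans (norm-shear k z e′) n)))
      where
      e′ : func₃ z ≡ + 13 * k
      e′ = trans e (+-identityˡ (+ 13 * k))
      choose : _ → _
      choose (inj₁ p) = inj₁ (p , trans (τ-at k z e′) (orient-pos p))
      choose (inj₂ p) = inj₂ (p , trans (τ-at k z e′) (trans (cong orient (sym (neg₃-involutive (shear k z))))
        (orient-neg p)))

    τ-preserves : ∀ {z} → Upper₀ N z → Upper₀ N (τ z)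
    τ-preserves {z} u@((_ , n) , _) = go (τ-image u)
      where
      go : _ → Upper₀ N (τ z)
      go (k , e , inj₁ (p , q)) = subst (Upper₀ N) (sym q) ((p , trans (norm-shear k z e) n) ,
        mod13 (- k) (trans (func-shear k z e) (sym (+-identityˡ (+ 13 * - k)))))
      go (k , e , inj₂ (p , q)) = subst (Upper₀ N) (sym q)
        ((p , trans (norm-neg₃ (shear k z)) (trans (norm-shear k z e) n)) ,
        mod13 k (trans (func-neg₃ (shear k z)) (trans (cong -_ (func-shear k z e)) (l k))))
        where
        l : ∀ k → - (+ 13 * - k) ≡ + 0 + + 13 * k
        l = solve-∀

    -- The reflection negates `func₃`, and `neg₃` negates it again. So the second application shears
    -- by -`k` or by `k`, and in the latter case returns to -z, which `orient` corrects.
    τ-involutive : ∀ {z} → Upper₀ N z → τ (τ z) ≡ z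
    τ-involutive {z} u@((p₀ , n) , _) = go (τ-image u)
      where
      go : _ → τ (τ z) ≡ z
      go (k , e , inj₁ (p , q)) = trans (cong τ q) (trans (τ-at (- k) (shear k z) (func-shear k z e))
        (trans (cong orient (shear-shear k z)) (orient-pos p₀)))
      go (k , e , inj₂ (p , q)) = trans (cong τ q)
        (trans (τ-at k (neg₃ (shear k z)) (trans (func-neg₃ (shear k z)) (trans (cong -_ (func-shear k z e)) (l k))))
        (trans (cong orient (shear-neg k z)) (orient-neg p₀)))
        where
        l : ∀ k → - (+ 13 * - k) ≡ + 13 * k
        l = solve-∀

    -- A fixed point would have an even first coordinate.
    τ-free : ∀ {z} → Upper₀ N z × τ z ≡ z → ⊥
    τ-free {z@(a , b , c)} (u@((p₀ , n) , _) , fixed) = go (τ-image u)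
      where
      contra : ∀ h → a ≡ + 2 * h → ⊥
      contra h e = contradiction (trans (sym (a-odd M N≡ z n)) (trans (cong par e) (par-2* h))) λ ()
      go : _ → ⊥
      go (k , e , inj₁ (p , q)) = contra (+ 2 * c - + 3 * b)
        (trans (l a b c) (trans (cong (_- (+ 6 * b - + 4 * c)) (trans e (cong (+ 13 *_) k≡0))) (l′ b c)))
        where
        l₀ : ∀ c k → k ≡ (c + k) - c
        l₀ = solve-∀
        k≡0 : k ≡ + 0
        k≡0 = trans (l₀ c k) (trans (cong (λ z → proj₂ (proj₂ z) - c) (trans (sym q) fixed)) (+-inverseʳ c))
        l : ∀ a b c → a ≡ (a + + 6 * b - + 4 * c) - (+ 6 * b - + 4 * c)
        l = solve-∀
        l′ : ∀ b c → + 13 * + 0 - (+ 6 * b - + 4 * c) ≡ + 2 * (+ 2 * c - + 3 * b)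
        l′ = solve-∀
      go (k , e , inj₂ (p , q)) = contra k
        (*-cancelˡ-≡ (+ 2) a (+ 2 * k)
          (trans (l a k) (trans (cong (λ z → a - proj₁ z + + 4 * k) (trans (sym q) fixed)) (l′ a k))))
        where
        l : ∀ a k → + 2 * a ≡ a - - (a - + 4 * k) + + 4 * k
        l = solve-∀
        l′ : ∀ a k → a - a + + 4 * k ≡ + 2 * (+ 2 * k)
        l′ = solve-∀

    upper₀-even : ∀ {b} → HasParity (Upper₀ N) b → b ≡ false
    upper₀-even h = empty-even τ-free (involution _≟₃_ τ τ-preserves τ-involutive h)

  -- The chain from the sextuples and the count from the sign changes meet at `Upper`: they differ
  -- by the vectors orthogonal modulo 13, of which there is an even number.
  lattice-parity : ∀ m n {T b} → + n ≡ + 8 * + m + + 1 → T ≡ + 169 * (+ 8 * + m + + 1) → HasParity (Sextuple T) b →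
    (b ≡ true → ∃ λ s → s ℕ.* s ≡ n) × (∃ (λ s → s ℕ.* s ≡ n) → 1 ℕ.≤ n → b ≡ true)
  lattice-parity m n {T} {b} N≡ T≡ h = finish (upper-finite n)
    where
    h-V : HasParity (Triple T) b
    h-V = fixed-swap {T} (transfer (slice₂≅quadruples (+ m) {T} T≡)
      (fixed₂ {T} (fixed₁ {T} (transfer (sextuples≅rotated (+ m) {T} T≡) h))))
    h-descended : HasParity (Descended (+ n)) b
    h-descended = transfer (triples≅descended (+ n) {T} (trans T≡ (cong (+ 169 *_) (sym N≡)))) h-V
    h-upper : HasParity (λ z → Upper (+ n) z × ¬ (func₃ z ≈ + 0)) b
    h-upper = transfer (descended≅upper (+ m) {+ n} N≡) h-descended
    finish : (∃ λ b → HasParity (Upper (+ n)) b) → (b ≡ true → ∃ λ s → s ℕ.* s ≡ n) ×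
      (∃ (λ s → s ℕ.* s ≡ n) → 1 ℕ.≤ n → b ≡ true)
    finish (b′ , k) = (λ e → proj₁ (upper-parity k) (trans b′≡b e)) , λ r 1≤n → trans (sym b′≡b)
      (proj₂ (upper-parity k) r 1≤n)
      where
      combine : (∃ λ c → ∃ λ d → HasParity (λ z → Upper (+ n) z × func₃ z ≈ + 0) c × HasParity
        (λ z → Upper (+ n) z × ¬ (func₃ z ≈ + 0)) d × b′ ≡ c xor d) → b′ ≡ b
      combine (c , d , h₀ , h₁ , e) = trans e (cong₂ _xor_ (upper₀-even (+ m) {+ n} N≡ h₀) (parity-unique h₁ h-upper))
      b′≡b : b′ ≡ b
      b′≡b = combine (split (λ z → func₃ z ≈? + 0) k)

open Lattice using (Sextuple; square-injective; lattice-parity)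

-- Enumeration of partitions

module Cores where

  open import Defs
  open import Data.List using (List; []; _∷_; _++_; map; length; filter; applyUpTo; downFrom)
  open import Data.List.Membership.Propositional using (_∈_; _∉_)
  open import Data.List.Membership.Propositional.Properties
  open import Data.List.Properties using (filter-accept; filter-reject; length-filter; ∷-injectiveˡ)
  open import Data.List.Relation.Binary.Permutation.Propositional using (_↭_; ↭-sym; ↭-trans)
  open import Data.List.Relation.Binary.Permutation.Propositional.Properties using (↭-length; ∈-resp-↭)
  open import Data.List.Relation.Unary.All as All using (All; []; _∷_)
  import Data.List.Relation.Unary.All.Properties as All
  open import Data.List.Relation.Unary.AllPairs as AllPairs using (AllPairs; []; _∷_)
  import Data.List.Relation.Unary.AllPairs.Properties as AllPairs
  open import Data.List.Relation.Unary.Any using (here; there)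
  open import Data.List.Relation.Unary.Unique.Propositional using (Unique)
  import Data.List.Relation.Unary.Unique.Propositional.Properties as Unique
  open import Data.Nat
  open import Data.List.Membership.DecPropositional _≟_ using (_∈?_)
  open import Data.Nat.Divisibility
  open import Data.Nat.DivMod using ([m+kn]%n≡m%n; m<n⇒m%n≡m; m≡m%n+[m/n]*n; m%n<n)
  open import Data.Nat.ListAction using (sum)
  open import Data.Nat.ListAction.Properties using (sum-↭)
  open import Data.Nat.Properties
  open import Data.Nat.Tactic.RingSolver using (solve-∀)
  open import Data.Vec using (Vec; []; _∷_)

  data Part : ℕ → List ℕ → Set where
    []  : ∀ {m} → Part m []
    _∷_ : ∀ {m k ks} → 1 ≤ k × k ≤ m → Part k ks → Part m (k ∷ ks)

  Part-sum : ∀ {m ks} → Part m ks → Part (sum ks) ks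
  Part-sum [] = []
  Part-sum (_∷_ {k = k} {ks} (1≤k , _) p) = (1≤k , m≤m+n k (sum ks)) ∷ p

  partsBounded-sound : ∀ f m n {ks} → ks ∈ partsBounded f m n → Part m ks × sum ks ≡ n
  partsBounded-sound f m zero (here refl) = [] , refl
  partsBounded-sound (suc f) m (suc n) ks∈ with ∈-concat⁻′
    (map (λ k → map (k ∷_) (partsBounded f k (suc n ∸ k))) (applyUpTo suc (m ⊓ suc n))) ks∈
  ... | xs , ks∈xs , xs∈ with ∈-map⁻ (λ k → map (k ∷_) (partsBounded f k (suc n ∸ k))) xs∈
  ...   | k , k∈ , refl with ∈-applyUpTo⁻ suc {n = m ⊓ suc n} k∈ | ∈-map⁻ (k ∷_) ks∈xs
  ...     | i , i< , refl | js , js∈ , refl with partsBounded-sound f (suc i) (n ∸ i) js∈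
  ...       | p , e = (s≤s z≤n , ≤-trans i< (m⊓n≤m m (suc n))) ∷ p ,
    trans (cong (suc i +_) e) (m+[n∸m]≡n (≤-trans i< (m⊓n≤n m (suc n))))

  partsBounded-complete : ∀ f m n {ks} → n ≤ f → Part m ks → sum ks ≡ n → ks ∈ partsBounded f m n
  partsBounded-complete f m zero _ [] refl = here refl
  partsBounded-complete f m zero _ (_∷_ {k = suc k} _ _) ()
  partsBounded-complete (suc f) m (suc n) (s≤s n≤f) (_∷_ {k = suc i} {ks} (_ , k≤m) p) e =
    ∈-concat⁺′ (∈-map⁺ (suc i ∷_) (partsBounded-complete f (suc i) (n ∸ i) (≤-trans (m∸n≤m n i) n≤f) p rest))
      (∈-map⁺ (λ k → map (k ∷_) (partsBounded f k (suc n ∸ k))) (∈-applyUpTo⁺ suc (⊓-glb k≤m k≤n)))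
    where
    k≤n : suc i ≤ suc n
    k≤n = ≤-trans (m≤m+n (suc i) (sum ks)) (≤-reflexive e)
    rest : sum ks ≡ n ∸ i
    rest = trans (sym (m+n∸m≡n i (sum ks))) (cong (_∸ i) (suc-injective e))

  partsBounded-unique : ∀ f m n → Unique (partsBounded f m n)
  partsBounded-unique f m zero = [] ∷ []
  partsBounded-unique zero m (suc n) = []
  partsBounded-unique (suc f) m (suc n) = Unique.concat⁺
    (All.map⁺ (All.universal (λ k → Unique.map⁺ (λ { refl → refl }) (partsBounded-unique f k (suc n ∸ k))) _))
    (AllPairs.map⁺ (AllPairs.map (λ k≢l → λ { (p , q) → k≢l (heads (∈-map⁻ _ p) (∈-map⁻ _ q)) })
      (Unique.applyUpTo⁺₁ suc (m ⊓ suc n) λ i<j _ e → <⇒≢ i<j (suc-injective e))))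
    where
    heads : ∀ {k l : ℕ} {xs ys : List (List ℕ)} {v} → (∃ λ x → x ∈ xs × v ≡ k ∷ x) →
      (∃ λ y → y ∈ ys × v ≡ l ∷ y) → k ≡ l
    heads (_ , _ , refl) (_ , _ , refl) = refl

  ++-like : (_⊕_ : List ℕ → List ℕ → List ℕ) → (∀ ys → [] ⊕ ys ≡ ys) → (∀ x xs ys → (x ∷ xs) ⊕ ys ≡ x ∷ (xs ⊕ ys)) →
    ∀ xs ys → xs ⊕ ys ≡ xs ++ ys
  ++-like _⊕_ nil cons [] ys = nil ys
  ++-like _⊕_ nil cons (x ∷ xs) ys = trans (cons x xs ys) (cong (x ∷_) (++-like _⊕_ nil cons xs ys))

  -- Hook lengths and beta sets

  hook : List ℕ → ℕ → ℕ → ℕ → ℕ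
  hook ks i l j = (l ∸ j) + (conj ks j ∸ i) ∸ 1

  -- The append local to hooksFrom cannot be named, but unification finds it.
  hooksFrom-∷ : ∀ ks i l rows → hooksFrom ks i (l ∷ rows) ≡ applyUpTo (hook ks i l) l ++ hooksFrom ks (suc i) rows
  hooksFrom-∷ ks i l rows with ++-like _ (λ _ → refl) (λ _ _ _ → refl) | applyUpTo (hook ks i l) l | hooksFrom
    ks (suc i) rows
  ... | f | xs | ys = f xs ys

  -- The hook lengths of the first column, in decreasing order.
  beta : List ℕ → List ℕ
  beta []         = []
  beta (l ∷ rows) = (l + length rows) ∷ beta rows

  conj-< : ∀ {l j} rows → j < l → conj (l ∷ rows) j ≡ suc (conj rows j)
  conj-< {l} {j} rows j<l = cong length (filter-accept (j <?_) {xs = rows} j<l)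

  conj-≥ : ∀ {m j rows} → Part m rows → m ≤ j → conj rows j ≡ 0
  conj-≥ [] _ = refl
  conj-≥ {j = j} (_∷_ {k = k} {ks} (_ , k≤m) p) m≤j =
    trans (cong length (filter-reject (j <?_) {xs = ks} (≤⇒≯ (≤-trans k≤m m≤j)))) (conj-≥ p (≤-trans k≤m m≤j))

  -- The leg of a cell is counted among the rows below it only, so that the condition is structural
  -- in the rows.
  HookFree : ℕ → List ℕ → Set
  HookFree t []         = ⊤
  HookFree t (l ∷ rows) = (∀ j → j < l → ¬ t ∣ (l ∸ j) + conj rows j) × HookFree t rows

  -- The invariant says that the `i` rows already passed all reach beyond column `j`. Subtracting
  -- `i` from the full column length then leaves the count over the remaining rows.
  hooksFrom-free : ∀ {t m} ks i rows → Part m rows → (∀ j → j < m → conj ks j ≡ i + conj rows j) →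
    All (λ h → ¬ (t ∣ h)) (hooksFrom ks i rows) ⇔ HookFree t rows
  hooksFrom-free ks i [] p inv = mk⇔ _ λ _ → []
  hooksFrom-free {t} {m} ks i (l ∷ rows) ((_ , l≤m) ∷ p) inv = mk⇔ to from
    where
    inv′ : ∀ j → j < l → conj ks j ≡ suc i + conj rows j
    inv′ j j<l = trans (inv j (<-≤-trans j<l l≤m)) (trans (cong (i +_) (conj-< rows j<l)) (+-suc i (conj rows j)))
    hook≡ : ∀ j → j < l → hook ks i l j ≡ (l ∸ j) + conj rows j
    hook≡ j j<l = trans (cong (λ c → (l ∸ j) + (c ∸ i) ∸ 1) (inv′ j j<l))
      (trans (cong (λ c → (l ∸ j) + c ∸ 1) (trans (cong (_∸ i) (sym (+-suc i (conj rows j))))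
        (m+n∸m≡n i (suc (conj rows j)))))
        (cong (_∸ 1) (+-suc (l ∸ j) (conj rows j))))
    IH : All (λ h → ¬ (t ∣ h)) (hooksFrom ks (suc i) rows) ⇔ HookFree t rows
    IH = hooksFrom-free ks (suc i) rows p inv′
    to : All (λ h → ¬ (t ∣ h)) (hooksFrom ks i (l ∷ rows)) → HookFree t (l ∷ rows)
    to h with subst (All _) (hooksFrom-∷ ks i l rows) h
    ... | h′ = (λ j j<l → subst (λ x → ¬ t ∣ x) (hook≡ j j<l) (All.applyUpTo⁻ (hook ks i l) l (All.++⁻ˡ _ h′) j<l)) ,
      Equivalence.to IH (All.++⁻ʳ (applyUpTo (hook ks i l) l) h′)
    from : HookFree t (l ∷ rows) → All (λ h → ¬ (t ∣ h)) (hooksFrom ks i (l ∷ rows))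
    from (f , g) = subst (All _) (sym (hooksFrom-∷ ks i l rows))
      (All.++⁺ (All.applyUpTo⁺₁ (hook ks i l) l λ {j} j<l → subst (λ x → ¬ t ∣ x) (sym (hook≡ j j<l))
        (f j j<l)) (Equivalence.from IH g))

  -- The complement of the beta set consists of the numbers j + #{rows ≤ j}.
  gap-index : ∀ {m rows} → Part m rows → ∀ g → g ∉ beta rows → ∃ λ j → g + conj rows j ≡ j + length rows
  gap-index [] g _ = g , refl
  gap-index {rows = l ∷ rows} ((1≤l , _) ∷ p) g g∉ with gap-index p g (g∉ ∘ there)
  ... | j , e with j <? l
  ...   | yes j<l = j , trans (cong (g +_) (conj-< rows j<l))
    (trans (+-suc g _) (trans (cong suc e) (sym (+-suc j _))))
  ...   | no j≮l = go j e (m≤n⇒m<n∨m≡n (≮⇒≥ j≮l))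
    where
    go : ∀ j → g + conj rows j ≡ j + length rows → l < j ⊎ l ≡ j → ∃ λ j → g + conj (l ∷ rows) j ≡ j + suc
      (length rows)
    go j e (inj₂ refl) = contradiction
      (here (trans (sym (trans (cong (g +_) (conj-≥ p ≤-refl)) (+-identityʳ g))) e)) g∉
    go (suc j) e (inj₁ (s≤s l≤j)) = j ,
      trans (cong (g +_) (conj-≥ {rows = l ∷ rows} ((1≤l , ≤-refl) ∷ p) l≤j))
        (trans (sym (cong (g +_) (conj-≥ p (≤-trans l≤j (n≤1+n j))))) (trans e (sym (+-suc j (length rows)))))

  gap-∉ : ∀ {m rows} → Part m rows → ∀ g j → g + conj rows j ≡ j + length rows → g ∉ beta rows
  gap-∉ {rows = l ∷ rows} ((1≤l , l≤m) ∷ p) g j e = by (j <? l)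
    where
    by : Dec (j < l) → g ∉ beta (l ∷ rows)
    by (yes j<l) (there g∈) = gap-∉ p g j
      (suc-injective (trans (sym (trans (cong (g +_) (conj-< rows j<l)) (+-suc g _))) (trans e (+-suc j _)))) g∈
    by (yes j<l) (here refl) = contradiction
      (+-cancelʳ-≤ (suc (length rows)) l j
        (≤-trans (≤-trans (≤-reflexive (+-suc l (length rows))) (≤-trans (s≤s (m≤m+n (l + length rows) (conj rows j)))
        (≤-reflexive (sym (trans (cong (l + length rows +_) (conj-< rows j<l))
          (+-suc (l + length rows) (conj rows j))))))) (≤-reflexive e))) (<⇒≱ j<l)
    by (no j≮l) g∈ with trans (sym
      (trans (cong (g +_) (conj-≥ {rows = l ∷ rows} ((1≤l , ≤-refl) ∷ p) (≮⇒≥ j≮l))) (+-identityʳ g)))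
        (trans e (+-suc j (length rows)))
    by (no j≮l) (here refl) | g≡ = <⇒≢ (s≤s (+-monoˡ-≤ (length rows) (≮⇒≥ j≮l))) g≡
    by (no j≮l) (there g∈) | g≡ = gap-∉ p g (suc j)
      (trans (trans (cong (g +_) (conj-≥ p (≤-trans (≮⇒≥ j≮l) (n≤1+n j)))) (+-identityʳ g)) g≡) g∈

  beta-< : ∀ {m rows} → Part m rows → ∀ {b} → b ∈ beta rows → b < m + length rows
  beta-< {m} (_∷_ {k = k} {ks} (_ , k≤m) p) (here refl) = subst (k + length ks <_) (sym (+-suc m (length ks)))
    (s≤s (+-monoˡ-≤ (length ks) k≤m))
  beta-< {m} (_∷_ {k = k} {ks} (_ , k≤m) p) (there b∈) =
    <-≤-trans (beta-< p b∈) (+-mono-≤ k≤m (n≤1+n (length ks)))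

  beta-positive : ∀ {m rows} → Part m rows → All (1 ≤_) (beta rows)
  beta-positive [] = []
  beta-positive (_∷_ {k = k} {ks} (1≤k , _) p) = ≤-trans 1≤k (m≤m+n k (length ks)) ∷ beta-positive p

  beta-decreasing : ∀ {m rows} → Part m rows → AllPairs _>_ (beta rows)
  beta-decreasing [] = []
  beta-decreasing (_ ∷ p) = All.tabulate (beta-< p) ∷ beta-decreasing p

  -- All multiples of `t` are treated at once, as a hook length may be any of them. The case of g =
  -- 0 matters: it forbids multiples of `t` in a set of positive numbers.
  Closed : ℕ → List ℕ → Set
  Closed t B = ∀ {b g} → b ∈ B → g < b → t ∣ b ∸ g → g ∈ B

  -- In the first row, the hook in column j has length b - g, where b is the beta number of that row
  -- and g the gap with index j. A multiple of `t` below b that is missing would thus be a forbidden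
  -- hook.
  hookFree⇒closed : ∀ {t m rows} → Part m rows → HookFree t rows → Closed t (beta rows)
  hookFree⇒closed (_ ∷ p) (_ , h) (there b∈) g<b t∣ = there (hookFree⇒closed p h b∈ g<b t∣)
  hookFree⇒closed {t} {rows = l ∷ rows} (_ ∷ p) (f , _) {g = g} (here refl) g<b t∣ = there
    (decidable-stable (g ∈? beta rows) λ g∉ → by (gap-index p g g∉))
    where
    by : ¬ (∃ λ j → g + conj rows j ≡ j + length rows)
    by (j , e) with j <? l
    ... | no j≮l = <⇒≱ g<b (≤-trans (+-monoˡ-≤ (length rows) (≮⇒≥ j≮l))
      (≤-reflexive (trans (sym e) (trans (cong (g +_) (conj-≥ p (≮⇒≥ j≮l))) (+-identityʳ g)))))
    ... | yes j<l = f j j<l (subst (t ∣_) (sym hook≡) t∣)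
      where
      hook≡ : (l ∸ j) + conj rows j ≡ l + length rows ∸ g
      hook≡ = sym (trans (cong (_∸ g) (sym total)) (m+n∸n≡m _ g))
        where
        total : (l ∸ j) + conj rows j + g ≡ l + length rows
        total = trans (+-assoc (l ∸ j) (conj rows j) g) (trans (cong (l ∸ j +_) (trans (+-comm (conj rows j) g) e))
          (trans (sym (+-assoc (l ∸ j) j (length rows))) (cong (_+ length rows) (m∸n+n≡m (<⇒≤ j<l)))))

  conj-≤-length : ∀ rows j → conj rows j ≤ length rows
  conj-≤-length rows j = length-filter (j <?_) rows

  closed⇒hookFree : ∀ {t m rows} → Part m rows → Closed t (beta rows) → HookFree t rows
  closed⇒hookFree [] c = tt
  closed⇒hookFree {t} {rows = l ∷ rows} (_ ∷ p) c = f , closed⇒hookFree p tail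
    where
    below : ∀ {g} → g < l + length rows → g ∈ beta (l ∷ rows) → g ∈ beta rows
    below g< (here refl) = contradiction g< (<-irrefl refl)
    below g< (there g∈) = g∈
    tail : Closed t (beta rows)
    tail b∈ g<b t∣ = below (<-trans g<b (beta-< p b∈)) (c (there b∈) g<b t∣)
    f : ∀ j → j < l → ¬ t ∣ (l ∸ j) + conj rows j
    f j j<l t∣ = gap-∉ p g j (trans (m∸n+n≡m (≤-trans (conj-≤-length rows j) (m≤n+m _ j))) refl)
        (below g< (c (here refl) g< (subst (t ∣_) (sym hook≡) t∣)))
      where
      -- The gap that belongs to column `j`.
      g = j + length rows ∸ conj rows j
      total : (l ∸ j) + conj rows j + g ≡ l + length rows
      total = trans (+-assoc (l ∸ j) (conj rows j) g)
        (trans (cong (l ∸ j +_) (m+[n∸m]≡n (≤-trans (conj-≤-length rows j) (m≤n+m _ j))))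
        (trans (sym (+-assoc (l ∸ j) j (length rows))) (cong (_+ length rows) (m∸n+n≡m (<⇒≤ j<l)))))
      hook≡ : l + length rows ∸ g ≡ (l ∸ j) + conj rows j
      hook≡ = trans (cong (_∸ g) (sym total)) (m+n∸n≡m _ g)
      g< : g < l + length rows
      g< = subst (g <_) total (m<n+m g (≤-trans (m<n⇒0<n∸m j<l) (m≤m+n (l ∸ j) (conj rows j))))

  core⇔closed : ∀ {t m ks} → Part m ks → IsCore t ks ⇔ Closed t (beta ks)
  core⇔closed {t} {ks = ks} p = mk⇔ (λ h {b} {g} → hookFree⇒closed {t} p (Equivalence.to e h) {b} {g})
    (λ c → Equivalence.from e (closed⇒hookFree {t} p (λ {b} {g} → c {b} {g})))
    where
    e = hooksFrom-free ks 0 ks p (λ _ _ → refl)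

  -- For r parts the beta numbers exceed the parts by 0, ..., r - 1, in all r (r - 1) / 2; doubling
  -- and moving r to the left avoids division and subtraction.
  sum-beta : ∀ ks → 2 * sum (beta ks) + length ks ≡ 2 * sum ks + length ks * length ks
  sum-beta [] = refl
  sum-beta (k ∷ ks) = trans (l₁ k (length ks) (sum (beta ks)))
    (trans (cong (2 * k + 2 * length ks + 1 +_) (sum-beta ks)) (l₂ k (length ks) (sum ks)))
    where
    l₁ : ∀ k n s → 2 * (k + n + s) + suc n ≡ 2 * k + 2 * n + 1 + (2 * s + n)
    l₁ = solve-∀
    l₂ : ∀ k n s → 2 * k + 2 * n + 1 + (2 * s + n * n) ≡ 2 * (k + s) + suc n * suc n
    l₂ = solve-∀

  length-beta : ∀ ks → length (beta ks) ≡ length ks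
  length-beta [] = refl
  length-beta (k ∷ ks) = cong suc (length-beta ks)

  beta-injective : ∀ ks js → beta ks ≡ beta js → ks ≡ js
  beta-injective [] [] _ = refl
  beta-injective (k ∷ ks) (j ∷ js) e with beta-injective ks js (cong tail e)
    where
    tail : List ℕ → List ℕ
    tail [] = []
    tail (_ ∷ xs) = xs
  ... | refl = cong (_∷ ks) (+-cancelʳ-≡ (length ks) k j (∷-injectiveˡ e))

  decreasing-length : ∀ {b bs} → All (1 ≤_) (b ∷ bs) → AllPairs _>_ (b ∷ bs) → suc (length bs) ≤ b
  decreasing-length {b} {[]} (1≤b ∷ _) _ = 1≤b
  decreasing-length {b} {c ∷ bs} (_ ∷ pos) ((b>c ∷ _) ∷ dec) = <-≤-trans (s≤s (decreasing-length pos dec)) b>c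

  -- The bound `m` stays free because the recursion needs it to be the part just above, which is
  -- known only one step later.
  beta-surjective : ∀ bs → All (1 ≤_) bs → AllPairs _>_ bs → ∃ λ ks → beta ks ≡ bs ×
    (∀ m → All (_< m + length bs) bs → Part m ks)
  beta-surjective [] _ _ = [] , refl , λ _ _ → []
  beta-surjective (b ∷ bs) pos@(_ ∷ pos′) dec@(b> ∷ dec′) with beta-surjective bs pos′ dec′
  ... | ks , refl , part = l ∷ ks , cong (_∷ beta ks) (trans (cong (l +_) (sym (length-beta ks))) l+) ,
    λ { m (b< ∷ _) → (m<n⇒0<n∸m len< , +-cancelʳ-≤ (suc (length bs)) l m
      (≤-trans (≤-reflexive (trans (+-suc l _) (cong suc l+))) b<)) ∷ part l
        (All.map (λ c< → subst (_ <_) (sym l+) c<) b>) }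
    where
    l = b ∸ length bs
    len< : length bs < b
    len< = decreasing-length pos dec
    l+ : l + length bs ≡ b
    l+ = m∸n+n≡m (<⇒≤ len<)

  decreasing-unique : ∀ {bs} → AllPairs _>_ bs → Unique bs
  decreasing-unique = AllPairs.map λ b>c → <⇒≢ b>c ∘ sym

  decreasing-≡ : ∀ {xs ys} → AllPairs _>_ xs → AllPairs _>_ ys → (∀ {x} → x ∈ xs → x ∈ ys) →
    (∀ {x} → x ∈ ys → x ∈ xs) → xs ≡ ys
  decreasing-≡ {[]} {[]} _ _ _ _ = refl
  decreasing-≡ {[]} {y ∷ ys} _ _ _ g with g (here refl)
  ... | ()
  decreasing-≡ {x ∷ xs} {[]} _ _ f _ with f (here refl)
  ... | ()
  decreasing-≡ {x ∷ xs} {y ∷ ys} (x> ∷ dx) (y> ∷ dy) f g = cong₂ _∷_ x≡y (decreasing-≡ dx dy f′ g′)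
    where
    x≡y : x ≡ y
    x≡y with f (here refl) | g (here refl)
    ... | here e | _ = e
    ... | _ | here e = sym e
    ... | there x∈ | there y∈ = contradiction (<-trans (All.lookup y> x∈) (All.lookup x> y∈)) (<-irrefl refl)
    f′ : ∀ {z} → z ∈ xs → z ∈ ys
    f′ z∈ with f (there z∈)
    ... | there p = p
    ... | here refl = contradiction (subst (_< x) (sym x≡y) (All.lookup x> z∈)) (<-irrefl refl)
    g′ : ∀ {z} → z ∈ ys → z ∈ xs
    g′ z∈ with g (there z∈)
    ... | there p = p
    ... | here refl = contradiction (subst (_< y) x≡y (All.lookup y> z∈)) (<-irrefl refl)

  -- Abaci

  runner : ℕ → ℕ → ℕ → List ℕ
  runner t o c = applyUpTo (λ k → o + k * t) c

  -- The abacus with cᵢ beads on the runner of residue o + i modulo t.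
  beads : ∀ {m} → ℕ → ℕ → Vec ℕ m → List ℕ
  beads t o []       = []
  beads t o (c ∷ cs) = runner t o c ++ beads t (suc o) cs

  module _ {t′ : ℕ} where

    private
      t = suc t′

    runner-% : ∀ {o c x} → o < t → x ∈ runner t o c → x % t ≡ o
    runner-% {o} {c} o<t x∈ with ∈-applyUpTo⁻ (λ k → o + k * t) {n = c} x∈
    ... | k , _ , refl = trans ([m+kn]%n≡m%n o k t) (m<n⇒m%n≡m o<t)

    beads-% : ∀ {m o x} (cs : Vec ℕ m) → o + m ≤ t → x ∈ beads t o cs → o ≤ x % t
    beads-% {suc m} {o} (c ∷ cs) le x∈ with ∈-++⁻ (runner t o c) x∈
    ... | inj₁ p = ≤-reflexive (sym (runner-% (<-≤-trans (m<m+n o (s≤s z≤n)) le) p))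
    ... | inj₂ p = ≤-trans (n≤1+n o) (beads-% cs (≤-trans (≤-reflexive (sym (+-suc o m))) le) p)

    runner-unique : ∀ o c → Unique (runner t o c)
    runner-unique o c = Unique.applyUpTo⁺₁ _ c λ {i} {j} i<j _ e → <⇒≢ i<j
      (*-cancelʳ-≡ i j t (+-cancelˡ-≡ o (i * t) (j * t) e))

    beads-unique : ∀ {m o} (cs : Vec ℕ m) → o + m ≤ t → Unique (beads t o cs)
    beads-unique [] _ = []
    beads-unique {suc m} {o} (c ∷ cs) le = Unique.++⁺ (runner-unique o c) (beads-unique cs le′)
      λ { (p , q) → <⇒≱ (≤-reflexive refl)
        (≤-trans (beads-% cs le′ q) (≤-reflexive (runner-% (<-≤-trans (m<m+n o (s≤s z≤n)) le) p))) }
      where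
      le′ : suc o + m ≤ t
      le′ = ≤-trans (≤-reflexive (sym (+-suc o m))) le

    beads-≥ : ∀ {m o x} (cs : Vec ℕ m) → x ∈ beads t o cs → o ≤ x
    beads-≥ {o = o} (c ∷ cs) x∈ with ∈-++⁻ (runner t o c) x∈
    ... | inj₂ p = ≤-trans (n≤1+n o) (beads-≥ cs p)
    ... | inj₁ p with ∈-applyUpTo⁻ (λ k → o + k * t) {n = c} p
    ...   | k , _ , refl = m≤m+n o (k * t)

    runner-closed : ∀ {o c} → o < t → Closed t (runner t o c)
    runner-closed {o} {c} o<t {b} {g} b∈ g<b (divides q e) with ∈-applyUpTo⁻ (λ k → o + k * t) {n = c} b∈
    ... | k , k<c , refl = subst (_∈ runner t o c) (sym g≡)
      (∈-applyUpTo⁺ (λ k → o + k * t) (≤-<-trans (m∸n≤m k q) k<c))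
      where
      split-b : g + q * t ≡ o + k * t
      split-b = trans (cong (g +_) (sym e)) (m+[n∸m]≡n (<⇒≤ g<b))
      q≤k : q ≤ k
      q≤k = ≮⇒≥ λ k<q → <⇒≱ (+-monoˡ-< (k * t) o<t)
        (≤-trans (*-monoˡ-≤ t k<q) (≤-trans (m≤n+m (q * t) g) (≤-reflexive split-b)))
      g≡ : g ≡ o + (k ∸ q) * t
      g≡ = +-cancelʳ-≡ (q * t) g _ (trans split-b
        (sym (trans (+-assoc o _ _) (cong (o +_)
          (trans (sym (*-distribʳ-+ t (k ∸ q) q)) (cong (_* t) (m∸n+n≡m q≤k)))))))

    beads-closed : ∀ {m o} (cs : Vec ℕ m) → o + m ≤ t → Closed t (beads t o cs)
    beads-closed {suc m} {o} (c ∷ cs) le {b} {g} b∈ g<b t∣ with ∈-++⁻ (runner t o c) b∈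
    ... | inj₁ p = ∈-++⁺ˡ (runner-closed {c = c} (<-≤-trans (m<m+n o (s≤s z≤n)) le) p g<b t∣)
    ... | inj₂ p = ∈-++⁺ʳ (runner t o c) (beads-closed cs (≤-trans (≤-reflexive (sym (+-suc o m))) le) p g<b t∣)

    -- Otherwise the position at height `d` on the first runner would be occupied on one abacus
    -- only, as the later runners have other residues.
    head-≤ : ∀ {m o c d} {cs ds : Vec ℕ m} → o + suc m ≤ t → (∀ {x} → x ∈ beads t o (c ∷ cs) → x ∈ beads t o
      (d ∷ ds)) → c ≤ d
    head-≤ {m} {o} {c} {d} {cs} {ds} le f = ≮⇒≥ λ d<c → by d<c
      (∈-++⁻ (runner t o d) (f (∈-++⁺ˡ (∈-applyUpTo⁺ (λ k → o + k * t) d<c))))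
      where
      o<t : o < t
      o<t = <-≤-trans (m<m+n o (s≤s z≤n)) le
      by : d < c → o + d * t ∈ runner t o d ⊎ o + d * t ∈ beads t (suc o) ds → ⊥
      by d<c (inj₂ p) = <⇒≱ (≤-reflexive refl)
        (≤-trans (beads-% ds (≤-trans (≤-reflexive (sym (+-suc o m))) le) p)
          (≤-reflexive (trans ([m+kn]%n≡m%n o d t) (m<n⇒m%n≡m o<t))))
      by d<c (inj₁ p) with ∈-applyUpTo⁻ (λ k → o + k * t) {n = d} p
      ... | k , k<d , e = <⇒≢ k<d (sym (*-cancelʳ-≡ d k t (+-cancelˡ-≡ o _ _ e)))

    tail-⊆ : ∀ {m o c d} {cs ds : Vec ℕ m} → o + suc m ≤ t → (∀ {x} → x ∈ beads t o (c ∷ cs) → x ∈ beads t o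
      (d ∷ ds)) →
      ∀ {x} → x ∈ beads t (suc o) cs → x ∈ beads t (suc o) ds
    tail-⊆ {m} {o} {c} {d} {cs} {ds} le f x∈ with ∈-++⁻ (runner t o d) (f (∈-++⁺ʳ (runner t o c) x∈))
    ... | inj₂ p = p
    ... | inj₁ p = contradiction (≤-trans (beads-% cs (≤-trans (≤-reflexive (sym (+-suc o m))) le) x∈)
        (≤-reflexive (runner-% (<-≤-trans (m<m+n o (s≤s z≤n)) le) p))) (<⇒≱ (≤-reflexive refl))

    beads-injective : ∀ {m o} (cs ds : Vec ℕ m) → o + m ≤ t → (∀ {x} → x ∈ beads t o cs → x ∈ beads t o ds) →
      (∀ {x} → x ∈ beads t o ds → x ∈ beads t o cs) → cs ≡ ds
    beads-injective [] [] _ _ _ = refl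
    beads-injective {suc m} {o} (c ∷ cs) (d ∷ ds) le f g = cong₂ _∷_
      (≤-antisym (head-≤ {cs = cs} {ds} le f) (head-≤ {cs = ds} {cs} le g))
      (beads-injective cs ds (≤-trans (≤-reflexive (sym (+-suc o m))) le) (tail-⊆ {c = c} {d} {cs} {ds} le f)
        (tail-⊆ {c = d} {c} {ds} {cs} le g))

    initial-segment : ∀ {D : ℕ → Set} → (∀ k → Dec (D k)) → (∀ {j k} → j < k → D k → D j) → ∀ n → ¬ D n →
      ∃ λ c → (∀ {k} → k < c → D k) × (∀ {k} → D k → k < c)
    initial-segment D? down zero ¬D = 0 , (λ ()) , λ {k} Dk → contradiction Dk (none k)
      where
      none : ∀ k → ¬ _
      none zero = ¬D
      none (suc k) d = ¬D (down (s≤s z≤n) d)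
    initial-segment D? down (suc n) ¬D with D? n
    ... | no ¬Dn = initial-segment D? down n ¬Dn
    ... | yes Dn = suc n , (λ { {k} (s≤s k≤n) → below (m≤n⇒m<n∨m≡n k≤n) }) , λ {k} Dk → ≰⇒> λ n<k → above Dk
      (m≤n⇒m<n∨m≡n n<k)
      where
      below : ∀ {k} → k < n ⊎ k ≡ n → _
      below (inj₁ k<n) = down k<n Dn
      below (inj₂ refl) = Dn
      above : ∀ {k} → _ → suc n < k ⊎ suc n ≡ k → ⊥
      above Dk (inj₁ n<k) = ¬D (down n<k Dk)
      above Dk (inj₂ refl) = ¬D Dk

    ∈-≤-sum : ∀ {x xs} → x ∈ xs → x ≤ sum xs
    ∈-≤-sum {xs = y ∷ xs} (here refl) = m≤m+n y (sum xs)
    ∈-≤-sum {xs = y ∷ xs} (there x∈) = ≤-trans (∈-≤-sum x∈) (m≤n+m (sum xs) y)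

    runner-of : ∀ {B} → Closed t B → ∀ o → o < t → ∃ λ c → (∀ {x} → x ∈ runner t o c → x ∈ B) ×
      (∀ {x} → x ∈ B → x % t ≡ o → x ∈ runner t o c)
    runner-of {B} closed o o<t with initial-segment {λ k → o + k * t ∈ B} (λ k → (o + k * t) ∈? B) down
      (suc (sum B)) bound
      where
      down : ∀ {j k} → j < k → o + k * t ∈ B → o + j * t ∈ B
      down {j} {k} j<k p = closed p (+-monoʳ-< o (*-monoˡ-< t j<k))
        (subst (t ∣_) (sym (trans ([m+n]∸[m+o]≡n∸o o (k * t) (j * t)) (sym (*-distribʳ-∸ t k j)))) (n∣m*n (k ∸ j)))
      -- No bead exceeds the sum of all of them, so this position is empty.
      bound : ¬ o + suc (sum B) * t ∈ B
      bound p = <⇒≱ (≤-trans (m≤m*n (suc (sum B)) t) (m≤n+m _ o)) (∈-≤-sum p)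
    ... | c , f , g = c , back , λ {x} x∈ e → let e′ = trans (m≡m%n+[m/n]*n x t) (cong (_+ x / t * t) e) in
        subst (_∈ runner t o c) (sym e′) (∈-applyUpTo⁺ (λ k → o + k * t) {i = x / t}
          (g {k = x / t} (subst (_∈ B) e′ x∈)))
      where
      back : ∀ {x} → x ∈ runner t o c → x ∈ B
      back x∈ with ∈-applyUpTo⁻ (λ k → o + k * t) {n = c} x∈
      ... | k , k<c , refl = f k<c

    beads-of : ∀ {B} → Closed t B → ∀ m o → o + m ≤ t → ∃ λ (cs : Vec ℕ m) →
      (∀ {x} → x ∈ beads t o cs → x ∈ B) × (∀ {x} → x ∈ B → o ≤ x % t → x % t < o + m → x ∈ beads t o cs)
    beads-of closed zero o _ = [] , (λ ()) , λ {x} _ le lt → contradiction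
      (subst (x % t <_) (+-identityʳ o) lt) (≤⇒≯ le)
    beads-of {B} closed (suc m) o le with runner-of closed o (<-≤-trans (m<m+n o (s≤s z≤n)) le) | beads-of
      closed m (suc o) (≤-trans (≤-reflexive (sym (+-suc o m))) le)
    ... | c , f , g | cs , f′ , g′ = c ∷ cs , (λ x∈ → join (∈-++⁻ (runner t o c) x∈)) , λ x∈ lo hi →
      choose x∈ hi (m≤n⇒m<n∨m≡n lo)
      where
      join : ∀ {x} → x ∈ runner t o c ⊎ x ∈ beads t (suc o) cs → x ∈ B
      join (inj₁ p) = f p
      join (inj₂ p) = f′ p
      choose : ∀ {x} → x ∈ B → x % t < o + suc m → o < x % t ⊎ o ≡ x % t → x ∈ beads t o (c ∷ cs)
      choose {x} x∈ hi (inj₁ lt) = ∈-++⁺ʳ (runner t o c) (g′ x∈ lt (subst (x % t <_) (+-suc o m) hi))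
      choose x∈ hi (inj₂ eq) = ∈-++⁺ˡ (g x∈ (sym eq))

    Core : ℕ → List ℕ → Set
    Core n ks = (Part n ks × sum ks ≡ n) × IsCore t ks

    -- The identity `sum-beta` with `n` as the size of the partition. The runner of residue 0 is
    -- left out, because closure would push its beads down to 0, which is not a beta number.
    Abacus : ℕ → Vec ℕ t′ → Set
    Abacus n cs = let B = beads t 1 cs in 2 * sum B + length B ≡ 2 * n + length B * length B

    core-enumeration : ∀ n → HasParity (Core n) (odd? (a t n))
    core-enumeration n = hasParity (filter (isCore? t) (partitions n))
      (Unique.filter⁺ (isCore? t) (partsBounded-unique n n n))
      (λ p → let (q , r) = ∈-filter⁻ (isCore? t) p in partsBounded-sound n n n q , r)
      (λ { ((p , e) , c) → ∈-filter⁺ (isCore? t) (partsBounded-complete n n n ≤-refl p e) c }) refl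

    -- Equality holds only up to order: `beta` lists the beads decreasingly, `beads` runner by
    -- runner.
    core≅abacus : ∀ n → Core n ≅ Abacus n via λ ks cs → beta ks ↭ beads t 1 cs
    core≅abacus n = record
      { total = λ { {ks} ((p , e) , c) → tot ks p e (λ {b} {g} → Equivalence.to (core⇔closed p) c {b} {g}) }
      ; surjective = λ {cs} → surj cs
      ; functional = λ {x} {cs} {ds} _ _ _ r s → let rs = ↭-trans (↭-sym r) s in
          beads-injective cs ds ≤-refl (∈-resp-↭ rs) (∈-resp-↭ (↭-sym rs))
      ; injective = λ { {ks} {js} ((p , _) , _) ((q , _) , _) _ r s → let rs = ↭-trans r (↭-sym s) in
          beta-injective ks js (decreasing-≡ (beta-decreasing p) (beta-decreasing q) (∈-resp-↭ rs)
            (∈-resp-↭ (↭-sym rs))) }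
      }
      where
      size : ∀ ks (cs : Vec ℕ t′) → beta ks ↭ beads t 1 cs →
        let B = beads t 1 cs in 2 * sum B + length B ≡ 2 * sum ks + length B * length B
      size ks cs r = trans (cong₂ (λ u v → 2 * u + v) (sym (sum-↭ r)) (sym len))
        (trans (sum-beta ks) (cong (λ u → 2 * sum ks + u * u) len))
        where
        len : length ks ≡ length (beads t 1 cs)
        len = trans (sym (length-beta ks)) (↭-length r)
      tot : ∀ ks → Part n ks → sum ks ≡ n → Closed t (beta ks) → ∃ λ cs → Abacus n cs × beta ks ↭ beads t 1 cs
      tot ks p refl c with beads-of (λ {b} {g} → c {b} {g}) t′ 1 ≤-refl
      ... | cs , f , g = cs , size ks cs r , r
        where
        nonzero : ∀ {x} → x ∈ beta ks → 1 ≤ x % t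
        nonzero {x} x∈ = n≢0⇒n>0 λ e → <⇒≱ (All.lookup (beta-positive p)
          (c x∈ (All.lookup (beta-positive p) x∈) (m%n≡0⇒n∣m x t e))) z≤n
        r : beta ks ↭ beads t 1 cs
        r = unique∧set⇒↭ (decreasing-unique (beta-decreasing p)) (beads-unique cs ≤-refl)
          (λ {x} x∈ → g x∈ (nonzero x∈) (m%n<n x t)) f
      surj : ∀ cs → Abacus n cs → ∃ λ ks → Core n ks × beta ks ↭ beads t 1 cs
      surj cs e with beta-surjective bs positive decreasing
        where
        B = beads t 1 cs
        -- Filtering a descending range sorts `B` without a sorting algorithm.
        bs = filter (_∈? B) (downFrom (suc (sum B)))
        decreasing : AllPairs _>_ bs
        decreasing = AllPairs.filter⁺ (_∈? B) (AllPairs.applyDownFrom⁺₁ _ (suc (sum B)) λ j<i _ → j<i)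
        positive : All (1 ≤_) bs
        positive = All.tabulate λ x∈ → beads-≥ cs (proj₂ (∈-filter⁻ (_∈? B) {xs = downFrom (suc (sum B))} x∈))
      ... | ks , β≡ , part = ks , ((p , sum≡) , core) , r
        where
        B = beads t 1 cs
        bs = filter (_∈? B) (downFrom (suc (sum B)))
        r : beta ks ↭ B
        r = subst (_↭ B) (sym β≡) (unique∧set⇒↭ (Unique.filter⁺ (_∈? B) (Unique.downFrom⁺ (suc (sum B))))
          (beads-unique cs ≤-refl)
          (λ x∈ → proj₂ (∈-filter⁻ (_∈? B) {xs = downFrom (suc (sum B))} x∈))
          (λ x∈ → ∈-filter⁺ (_∈? B) (∈-downFrom⁺ (s≤s (∈-≤-sum x∈))) x∈))
        sum≡ : sum ks ≡ n
        sum≡ = *-cancelˡ-≡ (sum ks) n 2 (+-cancelʳ-≡ (length B * length B) _ _ (trans (sym (size ks cs r)) e))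
        p : Part n ks
        -- A crude bound on the parts suffices here, since `Part-sum` replaces it by the size.
        p = subst (λ m → Part m ks) sum≡
          (Part-sum (part (suc (sum bs))
            (All.tabulate λ x∈ → s≤s (≤-trans (∈-≤-sum x∈) (m≤m+n (sum bs) (length bs))))))
        core : IsCore t ks
        core = Equivalence.from (core⇔closed p) λ b∈ g<b t∣ → ∈-resp-↭ (↭-sym r)
          (beads-closed cs ≤-refl (∈-resp-↭ r b∈) g<b t∣)

    abacus-parity : ∀ n → HasParity (Abacus n) (odd? (a t n))
    abacus-parity n = transfer (core≅abacus n) (core-enumeration n)

open Cores

-- Charges of 13-cores

module Charge where

  open import Data.Fin using (Fin; #_)
  open import Data.Integer hiding (suc; pred)
  open import Data.Integer.Properties
  open import Data.Integer.Tactic.RingSolver using (solve-∀)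
  import Data.List as List
  import Data.List.Properties as List
  open import Data.Nat as ℕ using (ℕ; zero; suc)
  open import Data.Nat.ListAction using (sum)
  open import Data.Nat.ListAction.Properties using (sum-++)
  import Data.Nat.Properties as ℕ
  import Data.Nat.Tactic.RingSolver as ℕSolver
  open import Data.Vec using (Vec; []; _∷_; _∷ʳ_; map; replicate; reverse; lookup; init; last; initLast; head)
  import Data.Vec.Properties as Vec
  open import Data.Vec.Properties using (init-∷ʳ; last-∷ʳ; ∷-injectiveˡ; ∷-injectiveʳ; map-cong; map-id; map-∘;
    map-reverse; reverse-involutive; reverse-∷)
  open import Data.Vec.Relation.Unary.All using (All; []; _∷_; all?)
  open Lattice using (mod13; ℤ⁶; norm₆; Class; tuple₆; Sextuple; self-neg)

  total : ∀ {m} → Vec ℤ m → ℤ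
  total []       = + 0
  total (z ∷ zs) = z + total zs

  sumsq : ∀ {m} → Vec ℤ m → ℤ
  sumsq []       = + 0
  sumsq (z ∷ zs) = z * z + sumsq zs

  -- The first empty position on each runner, when runner o + i carries zᵢ beads.
  ends : ∀ {m} → ℕ → Vec ℤ m → Vec ℤ m
  ends o []       = []
  ends o (z ∷ zs) = (+ o + + 13 * z) ∷ ends (suc o) zs

  -- 13² times the variance, hence invariant under translation.
  spread : Vec ℤ 13 → ℤ
  spread e = + 13 * sumsq e - total e * total e

  shift : ∀ {m} → Vec ℤ m → Vec ℤ m
  shift = map (_- + 1)

  total-∷ʳ : ∀ {m} (zs : Vec ℤ m) w → total (zs ∷ʳ w) ≡ w + total zs
  total-∷ʳ [] w = refl
  total-∷ʳ (z ∷ zs) w = trans (cong (_+_ z) (total-∷ʳ zs w)) (l z w (total zs))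
    where
    l : ∀ z w t → z + (w + t) ≡ w + (z + t)
    l = solve-∀

  sumsq-∷ʳ : ∀ {m} (zs : Vec ℤ m) w → sumsq (zs ∷ʳ w) ≡ w * w + sumsq zs
  sumsq-∷ʳ [] w = refl
  sumsq-∷ʳ (z ∷ zs) w = trans (cong (_+_ (z * z)) (sumsq-∷ʳ zs w)) (l (z * z) (w * w) (sumsq zs))
    where
    l : ∀ z w t → z + (w + t) ≡ w + (z + t)
    l = solve-∀

  total-shift : ∀ {m} (zs : Vec ℤ m) → total (shift zs) ≡ total zs - + m
  total-shift [] = refl
  total-shift {suc m} (z ∷ zs) = trans (cong (_+_ (z - + 1)) (total-shift zs)) (l z (total zs) (+ m))
    where
    l : ∀ z t m → z - + 1 + (t - m) ≡ z + t - (+ 1 + m)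
    l = solve-∀

  sumsq-shift : ∀ {m} (zs : Vec ℤ m) → sumsq (shift zs) ≡ sumsq zs - + 2 * total zs + + m
  sumsq-shift [] = refl
  sumsq-shift {suc m} (z ∷ zs) = trans (cong (_+_ ((z - + 1) * (z - + 1))) (sumsq-shift zs))
    (l z (sumsq zs) (total zs) (+ m))
    where
    l : ∀ z s t m → (z - + 1) * (z - + 1) + (s - + 2 * t + m) ≡ z * z + s - + 2 * (z + t) + (+ 1 + m)
    l = solve-∀

  spread-shift : ∀ e → spread (shift e) ≡ spread e
  spread-shift e = trans (cong₂ (λ s t → + 13 * s - t * t) (sumsq-shift e) (total-shift e)) (l (sumsq e) (total e))
    where
    l : ∀ s t → + 13 * (s - + 2 * t + + 13) - (t - + 13) * (t - + 13) ≡ + 13 * s - t * t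
    l = solve-∀

  -- Moving every bead one position down.
  down : ∀ {m} → Vec ℤ (suc m) → Vec ℤ (suc m)
  down (z ∷ zs) = zs ∷ʳ (z - + 1)

  up : ∀ {m} → Vec ℤ (suc m) → Vec ℤ (suc m)
  up zs = (last zs + + 1) ∷ init zs

  down-up : ∀ {m} (zs : Vec ℤ (suc m)) → down (up zs) ≡ zs
  down-up zs with initLast zs
  ... | ys , y , refl = cong (ys ∷ʳ_) (l y)
    where
    l : ∀ y → y + + 1 - + 1 ≡ y
    l = solve-∀

  up-down : ∀ {m} (zs : Vec ℤ (suc m)) → up (down zs) ≡ zs
  up-down (z ∷ zs) = cong₂ _∷_ (trans (cong (_+ + 1) (last-∷ʳ (z - + 1) zs)) (l z)) (init-∷ʳ (z - + 1) zs)
    where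
    l : ∀ y → y - + 1 + + 1 ≡ y
    l = solve-∀

  total-down : ∀ {m} (zs : Vec ℤ (suc m)) → total (down zs) ≡ total zs - + 1
  total-down (z ∷ zs) = trans (total-∷ʳ zs (z - + 1)) (l z (total zs))
    where
    l : ∀ z t → z - + 1 + t ≡ z + t - + 1
    l = solve-∀

  ends-∷ʳ : ∀ {m} o (zs : Vec ℤ m) w → ends o (zs ∷ʳ w) ≡ ends o zs ∷ʳ (+ (o ℕ.+ m) + + 13 * w)
  ends-∷ʳ o [] w = cong (λ u → (+ u + + 13 * w) ∷ []) (sym (ℕ.+-identityʳ o))
  ends-∷ʳ {suc m} o (z ∷ zs) w = cong ((+ o + + 13 * z) ∷_)
    (trans (ends-∷ʳ (suc o) zs w) (cong (λ u → ends (suc o) zs ∷ʳ (+ u + + 13 * w)) (sym (ℕ.+-suc o m))))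

  ends-shift : ∀ {m} o (zs : Vec ℤ m) → ends o zs ≡ shift (ends (suc o) zs)
  ends-shift o [] = refl
  ends-shift o (z ∷ zs) = cong₂ _∷_ (l (+ o) (+ 13 * z)) (ends-shift (suc o) zs)
    where
    l : ∀ o u → o + u ≡ + 1 + o + u - + 1
    l = solve-∀

  spread-∷ʳ : ∀ w (e : Vec ℤ 12) → spread (e ∷ʳ w) ≡ spread (w ∷ e)
  spread-∷ʳ w e = cong₂ (λ s t → + 13 * s - t * t) (sumsq-∷ʳ e w) (total-∷ʳ e w)

  -- Up to order, the first empty positions are all translated by -1; the runner that wraps around
  -- only changes its place in the list.
  spread-down : ∀ zs → spread (ends 0 (down zs)) ≡ spread (ends 0 zs)
  spread-down (z ∷ zs) = trans (cong spread (ends-∷ʳ 0 zs (z - + 1)))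
    (trans (spread-∷ʳ (+ 12 + + 13 * (z - + 1)) (ends 0 zs))
    (trans (cong spread (cong₂ _∷_ (l z) (ends-shift 0 zs))) (spread-shift ((+ 0 + + 13 * z) ∷ ends 1 zs))))
    where
    l : ∀ z → + 12 + + 13 * (z - + 1) ≡ + 0 + + 13 * z - + 1
    l = solve-∀

  iterate : ∀ {A : Set} → (A → A) → ℕ → A → A
  iterate f zero x    = x
  iterate f (suc k) x = f (iterate f k x)

  iterate-+ : ∀ {A : Set} (f : A → A) j k x → iterate f (j ℕ.+ k) x ≡ iterate f j (iterate f k x)
  iterate-+ f zero k x = refl
  iterate-+ f (suc j) k x = cong f (iterate-+ f j k x)

  iterate-comm : ∀ {A : Set} (f : A → A) k x → iterate f k (f x) ≡ f (iterate f k x)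
  iterate-comm f zero x = refl
  iterate-comm f (suc k) x = cong f (iterate-comm f k x)

  downs-ups : ∀ {m} k (zs : Vec ℤ (suc m)) → iterate down k (iterate up k zs) ≡ zs
  downs-ups zero zs = refl
  downs-ups (suc k) zs = trans (sym (iterate-comm down k _))
    (trans (cong (iterate down k) (down-up (iterate up k zs))) (downs-ups k zs))

  ups-downs : ∀ {m} k (zs : Vec ℤ (suc m)) → iterate up k (iterate down k zs) ≡ zs
  ups-downs zero zs = refl
  ups-downs (suc k) zs = trans (sym (iterate-comm up k _))
    (trans (cong (iterate up k) (up-down (iterate down k zs))) (ups-downs k zs))

  total-downs : ∀ {m} k (zs : Vec ℤ (suc m)) → total (iterate down k zs) ≡ total zs - + k
  total-downs zero zs = sym (+-identityʳ (total zs))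
  total-downs (suc k) zs = trans (total-down (iterate down k zs)) (trans (cong (_- + 1) (total-downs k zs))
    (l (total zs) (+ k)))
    where
    l : ∀ t k → t - k - + 1 ≡ t - (+ 1 + k)
    l = solve-∀

  spread-downs : ∀ k zs → spread (ends 0 (iterate down k zs)) ≡ spread (ends 0 zs)
  spread-downs zero zs = refl
  spread-downs (suc k) zs = trans (spread-down (iterate down k zs)) (spread-downs k zs)

  -- An arbitrary `f` with a pointwise description is used because `applyUpTo` recurses through
  -- `f ∘ suc`, where the offset becomes `o + t`.
  runner-sum : ∀ t f o → (∀ k → f k ≡ o ℕ.+ k ℕ.* t) → ∀ c → 2 ℕ.* sum (List.applyUpTo f c) ℕ.+ t ℕ.* c ≡ 2 ℕ.*
    o ℕ.* c ℕ.+ t ℕ.* (c ℕ.* c)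
  runner-sum t f o f≡ zero = l t o
    where
    l : ∀ t o → t ℕ.* 0 ≡ 2 ℕ.* o ℕ.* 0 ℕ.+ t ℕ.* 0
    l = ℕSolver.solve-∀
  runner-sum t f o f≡ (suc c) = trans (cong (λ u → 2 ℕ.* (u ℕ.+ S) ℕ.+ t ℕ.* suc c) (trans (f≡ 0) (ℕ.+-identityʳ o)))
    (trans (l₁ o S t c) (trans (cong (λ u → 2 ℕ.* o ℕ.+ t ℕ.+ u)
      (runner-sum t (f ∘ suc) (o ℕ.+ t) (λ k → trans (f≡ (suc k)) (sym (ℕ.+-assoc o t _))) c)) (l₂ o t c)))
    where
    S = sum (List.applyUpTo (f ∘ suc) c)
    l₁ : ∀ o S t c → 2 ℕ.* (o ℕ.+ S) ℕ.+ t ℕ.* suc c ≡ 2 ℕ.* o ℕ.+ t ℕ.+ (2 ℕ.* S ℕ.+ t ℕ.* c)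
    l₁ = ℕSolver.solve-∀
    l₂ : ∀ o t c → 2 ℕ.* o ℕ.+ t ℕ.+ (2 ℕ.* (o ℕ.+ t) ℕ.* c ℕ.+ t ℕ.* (c ℕ.* c)) ≡ 2 ℕ.* o ℕ.* suc c ℕ.+ t ℕ.*
      (suc c ℕ.* suc c)
    l₂ = ℕSolver.solve-∀

  fromℕ : ∀ {m} → Vec ℕ m → Vec ℤ m
  fromℕ = map (λ c → + c)

  total-beads : ∀ {m} o (cs : Vec ℕ m) → total (fromℕ cs) ≡ + List.length (beads 13 o cs)
  total-beads o [] = refl
  total-beads o (c ∷ cs) = trans (cong (_+_ (+ c)) (total-beads (suc o) cs)) (cong (λ m → + m)
    (sym (trans (List.length-++ (runner 13 o c)) (cong (ℕ._+ List.length (beads 13 (suc o) cs))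
      (List.length-applyUpTo (λ k → o ℕ.+ k ℕ.* 13) c)))))

  total-ends : ∀ {m} o (zs : Vec ℤ m) → total (ends o zs) ≡ total (ends o (replicate m (+ 0))) + + 13 * total zs
  total-ends o [] = refl
  total-ends {suc m} o (z ∷ zs) = trans (cong (_+_ (+ o + + 13 * z)) (total-ends (suc o) zs))
    (l (+ o) z (total (ends (suc o) (replicate m (+ 0)))) (total zs))
    where
    l : ∀ o z r t → o + + 13 * z + (r + + 13 * t) ≡ o + + 13 * + 0 + r + + 13 * (z + t)
    l = solve-∀

  sumsq-ends : ∀ {m} o (cs : Vec ℕ m) → let B = beads 13 o cs in
    sumsq (ends o (fromℕ cs)) ≡ sumsq (ends o (replicate m (+ 0))) + + 13 * (+ 2 * + sum B + + 13 * + List.length B)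
  sumsq-ends o [] = refl
  sumsq-ends {suc m} o (c ∷ cs) = trans (cong (_+_ ((+ o + + 13 * + c) * (+ o + + 13 * + c))) (sumsq-ends (suc o) cs))
    (trans (l₁ (+ o) (+ c) r (+ sum B) (+ List.length B))
    (trans (cong (λ u → (+ o + + 13 * + 0) * (+ o + + 13 * + 0) + r + + 13 *
      (u + (+ 2 * + sum B + + 13 * + List.length B))) runner-eq)
    (trans (l₂ ((+ o + + 13 * + 0) * (+ o + + 13 * + 0)) r (+ sum A) (+ c) (+ sum B) (+ List.length B))
      (cong₂ (λ u v → (+ o + + 13 * + 0) * (+ o + + 13 * + 0) + r + + 13 * (+ 2 * + u + + 13 * + v))
        (sym (sum-++ A B))
        (sym (trans (List.length-++ A)
          (cong (ℕ._+ List.length B) (List.length-applyUpTo (λ k → o ℕ.+ k ℕ.* 13) c))))))))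
    where
    A = runner 13 o c
    B = beads 13 (suc o) cs
    r = sumsq (ends (suc o) (replicate m (+ 0)))
    l₁ : ∀ o c r s n → (o + + 13 * c) * (o + + 13 * c) + (r + + 13 * (+ 2 * s + + 13 * n)) ≡
      (o + + 13 * + 0) * (o + + 13 * + 0) + r + + 13 * ((+ 2 * o * c + + 13 * (c * c)) + (+ 2 * s + + 13 * n))
    l₁ = solve-∀
    l₂ : ∀ o r a c s n → o + r + + 13 * ((+ 2 * a + + 13 * c) + (+ 2 * s + + 13 * n)) ≡ o + r + + 13 *
      (+ 2 * (a + s) + + 13 * (c + n))
    l₂ = solve-∀
    runner-eq : + 2 * + o * + c + + 13 * (+ c * + c) ≡ + 2 * + sum A + + 13 * + c
    runner-eq = trans (cong₂ _+_ (trans (cong (_* + c) (sym (pos-* 2 o))) (sym (pos-* (2 ℕ.* o) c)))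
      (trans (cong (+ 13 *_) (sym (pos-* c c))) (sym (pos-* 13 (c ℕ.* c)))))
      (trans (cong (λ m → + m) (sym (runner-sum 13 _ o (λ _ → refl) c))) (cong₂ _+_ (pos-* 2 (sum A)) (pos-* 13 c)))

  -- The numbers 0, ..., 12 have sum 78 and sum of squares 650, and 13 · 650 - 78² = 2366. What
  -- remains is 169 times the quantity that `Abacus` equates with 2n.
  spread-beads : ∀ (cs : Vec ℕ 12) → let B = beads 13 1 cs in
    spread (ends 0 (+ 0 ∷ fromℕ cs)) ≡ + 2366 + + 169 *
      ((+ 2 * + sum B + + List.length B) - + List.length B * + List.length B)
  spread-beads cs = trans (cong₂ (λ s t → + 13 * (+ 0 + s) - (+ 0 + t) * (+ 0 + t)) (sumsq-ends 1 cs)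
      (trans (total-ends 1 (fromℕ cs)) (cong (λ u → + 78 + + 13 * u) (total-beads 1 cs))))
    (l (+ sum B) (+ List.length B))
    where
    B = beads 13 1 cs
    l : ∀ s n → + 13 * (+ 0 + (+ 650 + + 13 * (+ 2 * s + + 13 * n))) - (+ 0 + (+ 78 + + 13 * n)) *
      (+ 0 + (+ 78 + + 13 * n)) ≡
      + 2366 + + 169 * ((+ 2 * s + n) - n * n)
    l = solve-∀

  -- The spread 2366 is that of the empty partition, and each cell adds 338 = 2 · 13².
  Charges : ℕ → Vec ℤ 13 → Set
  Charges n z = total z ≡ + 0 × spread (ends 0 z) ≡ + 338 * + n + + 2366

  NonNeg : ∀ {m} → Vec ℤ m → Set
  NonNeg = All (+ 0 ≤_)

  start : Vec ℕ 12 → Vec ℤ 13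
  start cs = + 0 ∷ fromℕ cs

  -- Moving all beads down by as many positions as there are beads brings the total to 0. This frees
  -- runner 0 from its special role, which conjugation would not respect.
  charges : Vec ℕ 12 → Vec ℤ 13
  charges cs = iterate down (List.length (beads 13 1 cs)) (start cs)

  fromℕ-NonNeg : ∀ {m} (cs : Vec ℕ m) → NonNeg (fromℕ cs)
  fromℕ-NonNeg [] = []
  fromℕ-NonNeg (c ∷ cs) = +≤+ ℕ.z≤n ∷ fromℕ-NonNeg cs

  fromℕ-injective : ∀ {m} (cs ds : Vec ℕ m) → fromℕ cs ≡ fromℕ ds → cs ≡ ds
  fromℕ-injective [] [] _ = refl
  fromℕ-injective (c ∷ cs) (d ∷ ds) e = cong₂ _∷_ (+-injective (∷-injectiveˡ e))
    (fromℕ-injective cs ds (∷-injectiveʳ e))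

  toℕ : ∀ {m} (zs : Vec ℤ m) → NonNeg zs → ∃ λ cs → zs ≡ fromℕ cs
  toℕ [] [] = [] , refl
  toℕ ((+ c) ∷ zs) (_ ∷ p) with toℕ zs p
  ... | cs , e = c ∷ cs , cong ((+ c) ∷_) e
  toℕ (-[1+ _ ] ∷ zs) (() ∷ p)

  NonNeg-∷ʳ⁻ : ∀ {m} (zs : Vec ℤ m) w → NonNeg (zs ∷ʳ w) → NonNeg zs × + 0 ≤ w
  NonNeg-∷ʳ⁻ [] w (p ∷ []) = [] , p
  NonNeg-∷ʳ⁻ (z ∷ zs) w (q ∷ p) with NonNeg-∷ʳ⁻ zs w p
  ... | ps , pw = q ∷ ps , pw

  NonNeg-∷ʳ⁺ : ∀ {m} (zs : Vec ℤ m) w → NonNeg zs → + 0 ≤ w → NonNeg (zs ∷ʳ w)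
  NonNeg-∷ʳ⁺ [] w [] p = p ∷ []
  NonNeg-∷ʳ⁺ (z ∷ zs) w (q ∷ ps) p = q ∷ NonNeg-∷ʳ⁺ zs w ps p

  up-NonNeg : ∀ {m} (zs : Vec ℤ (suc m)) → NonNeg zs → NonNeg (up zs) × head (up zs) ≢ + 0
  up-NonNeg zs p with initLast zs
  ... | ys , y , refl with NonNeg-∷ʳ⁻ ys y p
  ...   | ps , +≤+ _ = (+≤+ ℕ.z≤n ∷ ps) , λ e → contradiction (trans (ℕ.+-comm 1 _) (+-injective e)) λ ()

  ups-NonNeg : ∀ {m} k (zs : Vec ℤ (suc m)) → NonNeg zs → NonNeg (iterate up k zs)
  ups-NonNeg zero zs p = p
  ups-NonNeg (suc k) zs p = proj₁ (up-NonNeg (iterate up k zs) (ups-NonNeg k zs p))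

  -- If an upward step makes all charges non-negative, the wrapped one was −1.
  up-minimal : ∀ {m} (zs : Vec ℤ (suc m)) → ¬ NonNeg zs → NonNeg (up zs) → head (up zs) ≡ + 0
  up-minimal zs ¬p q with initLast zs
  up-minimal zs ¬p (_ ∷ q) | ys , + n , refl = contradiction (NonNeg-∷ʳ⁺ ys (+ n) q (+≤+ ℕ.z≤n)) ¬p
  up-minimal zs ¬p q | ys , -[1+ zero ] , refl = refl
  up-minimal zs ¬p (() ∷ q) | ys , -[1+ suc n ] , refl

  up¹³ : ∀ (z : Vec ℤ 13) → iterate up 13 z ≡ map (_+ + 1) z
  up¹³ (z0 ∷ z1 ∷ z2 ∷ z3 ∷ z4 ∷ z5 ∷ z6 ∷ z7 ∷ z8 ∷ z9 ∷ z10 ∷ z11 ∷ z12 ∷ []) = refl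

  ups-13 : ∀ j (z : Vec ℤ 13) → iterate up (j ℕ.* 13) z ≡ map (_+ + j) z
  ups-13 zero z = sym (trans (map-cong +-identityʳ z) (map-id z))
  ups-13 (suc j) z = trans (iterate-+ up 13 (j ℕ.* 13) z) (trans (up¹³ _) (trans (cong (map (_+ + 1)) (ups-13 j z))
    (trans (sym (map-∘ (_+ + 1) (_+ + j) z)) (map-cong (λ x → l x (+ j)) z))))
    where
    l : ∀ x j → x + j + + 1 ≡ x + (+ 1 + j)
    l = solve-∀

  bound : ∀ {m} → Vec ℤ m → ℕ
  bound []       = 0
  bound (z ∷ zs) = ∣ z ∣ ℕ.+ bound zs

  bound-NonNeg : ∀ {m} (zs : Vec ℤ m) j → bound zs ℕ.≤ j → NonNeg (map (_+ + j) zs)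
  bound-NonNeg [] j _ = []
  bound-NonNeg (z ∷ zs) j le = lift z (ℕ.≤-trans (ℕ.m≤m+n ∣ z ∣ (bound zs)) le) ∷ bound-NonNeg zs j
    (ℕ.≤-trans (ℕ.m≤n+m (bound zs) ∣ z ∣) le)
    where
    lift : ∀ z → ∣ z ∣ ℕ.≤ j → + 0 ≤ z + + j
    lift (+ n) _ = +≤+ ℕ.z≤n
    lift -[1+ n ] le = subst (+ 0 ≤_) (sym (⊖-≥ le)) (+≤+ ℕ.z≤n)

  least : ∀ {P : ℕ → Set} → (∀ k → Dec (P k)) → ∀ n → P n → P 0 ⊎ ∃ λ k → ¬ P k × P (suc k)
  least P? zero p = inj₁ p
  least P? (suc n) p with P? n
  ... | yes q = least P? n q
  ... | no ¬q = inj₂ (n , ¬q , p)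

  NonNeg-total-0 : ∀ {m} (zs : Vec ℤ m) → NonNeg zs → + 0 ≤ total zs
  NonNeg-total-0 [] [] = +≤+ ℕ.z≤n
  NonNeg-total-0 (z ∷ zs) (p ∷ ps) = +-mono-≤ p (NonNeg-total-0 zs ps)

  -- Thirteen steps up add 1 to every charge, so all become non-negative eventually. The first time
  -- this happens the head is 0: either a charge -1 was just wrapped, or no step was taken and the
  -- total 0 forces it.
  normalised : ∀ z → total z ≡ + 0 → ∃ λ k → NonNeg (iterate up k z) × head (iterate up k z) ≡ + 0
  normalised z t0 with least {λ k → NonNeg (iterate up k z)} (λ k → all? (+ 0 ≤?_) (iterate up k z)) (bound z ℕ.* 13)
    (subst NonNeg (sym (ups-13 (bound z) z)) (bound-NonNeg z (bound z) ℕ.≤-refl))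
  ... | inj₂ (k , ¬p , p) = suc k , p , up-minimal (iterate up k z) ¬p p
  ... | inj₁ p = 0 , p , first z p t0
    where
    first : ∀ {m} (zs : Vec ℤ (suc m)) → NonNeg zs → total zs ≡ + 0 → head zs ≡ + 0
    first (z ∷ zs) (p ∷ ps) e = ≤-antisym
      (≤-trans (subst (_≤ z + total zs) (+-identityʳ z) (+-monoʳ-≤ z (NonNeg-total-0 zs ps))) (≤-reflexive e)) p

  charges-surjective : ∀ z → total z ≡ + 0 → ∃ λ cs → z ≡ charges cs
  charges-surjective z t0 with normalised z t0
  ... | k , p , h0 = go (iterate up k z) refl p h0
    where
    go : ∀ w → iterate up k z ≡ w → NonNeg w → head w ≡ + 0 → ∃ λ cs → z ≡ charges cs
    go (_ ∷ ws) e (_ ∷ ps) refl with toℕ ws ps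
    ... | cs , refl = cs , trans z≡
      (cong (λ k → iterate down k (start cs)) (+-injective (trans k≡ (total-beads 1 cs))))
      where
      z≡ : z ≡ iterate down k (start cs)
      z≡ = trans (sym (downs-ups k z)) (cong (iterate down k) e)
      l : ∀ t k → k ≡ (t - (t - k))
      l = solve-∀
      k≡ : + k ≡ total (fromℕ cs)
      k≡ = trans (l (total (start cs)) (+ k))
        (trans (cong (_-_ (total (start cs)))
          (trans (sym (total-downs k (start cs))) (trans (cong total (sym z≡)) t0)))
        (trans (+-identityʳ _) (+-identityˡ _)))

  downs-injective : ∀ k {z w : Vec ℤ 13} → iterate down k z ≡ iterate down k w → z ≡ w
  downs-injective k {z} {w} e = trans (sym (ups-downs k z)) (trans (cong (iterate up k) e) (ups-downs k w))

  -- Each step up from non-negative charges makes the head positive, while a starting vector has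
  -- head 0.
  starts-differ : ∀ d cs ds → start cs ≡ iterate down d (start ds) → d ≡ 0
  starts-differ zero cs ds _ = refl
  starts-differ (suc d) cs ds e = contradiction
    (cong head (trans (cong (iterate up (suc d)) e) (ups-downs (suc d) (start ds))))
    (proj₂ (up-NonNeg (iterate up d (start cs)) (ups-NonNeg d (start cs) (+≤+ ℕ.z≤n ∷ fromℕ-NonNeg cs))))

  charges-injective : ∀ cs ds → charges cs ≡ charges ds → cs ≡ ds
  charges-injective cs ds e = by (ℕ.≤-total (List.length (beads 13 1 cs)) (List.length (beads 13 1 ds)))
    where
    go : ∀ cs ds → charges cs ≡ charges ds → List.length (beads 13 1 cs) ℕ.≤ List.length (beads 13 1 ds) → cs ≡ ds
    go cs ds e le = fromℕ-injective cs ds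
      (∷-injectiveʳ (subst (λ d → start cs ≡ iterate down d (start ds)) (starts-differ d cs ds eq) eq))
      where
      k = List.length (beads 13 1 cs)
      d = List.length (beads 13 1 ds) ℕ.∸ k
      eq : start cs ≡ iterate down d (start ds)
      eq = downs-injective k (trans e (trans (cong (λ m → iterate down m (start ds)) (sym (ℕ.m+[n∸m]≡n le)))
        (iterate-+ down k d (start ds))))
    by : List.length (beads 13 1 cs) ℕ.≤ List.length (beads 13 1 ds) ⊎ List.length (beads 13 1 ds) ℕ.≤
      List.length (beads 13 1 cs) → cs ≡ ds
    by (inj₁ le) = go cs ds e le
    by (inj₂ le) = sym (go ds cs (sym e) le)

  charges-spread : ∀ n cs → Abacus n cs → Charges n (charges cs)
  charges-spread n cs e = t0 , trans (spread-downs k (start cs))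
    (trans (spread-beads cs) (trans (cong (λ u → + 2366 + + 169 * (u - + k * + k)) e′) (l (+ n) (+ k * + k))))
    where
    B = beads 13 1 cs
    k = List.length B
    t0 : total (charges cs) ≡ + 0
    t0 = trans (total-downs k (start cs)) (trans (cong (_- + k) (trans (+-identityˡ _) (total-beads 1 cs)))
      (+-inverseʳ (+ k)))
    e′ : + 2 * + sum B + + k ≡ + 2 * + n + + k * + k
    e′ = trans (cong (_+ + k) (sym (pos-* 2 (sum B))))
      (trans (cong (λ m → + m) e) (cong₂ _+_ (pos-* 2 n) (pos-* k k)))
    l : ∀ n q → + 2366 + + 169 * (+ 2 * n + q - q) ≡ + 338 * n + + 2366
    l = solve-∀

  charges-abacus : ∀ n cs → Charges n (charges cs) → Abacus n cs
  charges-abacus n cs (_ , e) = +-injective (trans (cong (_+ + k) (pos-* 2 (sum B)))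
    (trans e′ (sym (cong₂ _+_ (pos-* 2 n) (pos-* k k)))))
    where
    B = beads 13 1 cs
    k = List.length B
    l₁ : ∀ s q → + 169 * s ≡ (+ 2366 + + 169 * (s - q)) + + 169 * q - + 2366
    l₁ = solve-∀
    l₂ : ∀ n q → (+ 338 * n + + 2366) + + 169 * q - + 2366 ≡ + 169 * (+ 2 * n + q)
    l₂ = solve-∀
    e′ : + 2 * + sum B + + k ≡ + 2 * + n + + k * + k
    e′ = *-cancelˡ-≡ (+ 169) (+ 2 * + sum B + + k) (+ 2 * + n + + k * + k)
      (trans (l₁ (+ 2 * + sum B + + k) (+ k * + k))
      (trans (cong (λ u → u + + 169 * (+ k * + k) - + 2366)
        (trans (sym (spread-beads cs)) (trans (sym (spread-downs k (start cs))) e))) (l₂ (+ n) (+ k * + k))))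

  abacus≅charges : ∀ n → Abacus n ≅ Charges n via λ cs z → z ≡ charges cs
  abacus≅charges n = record
    { total = λ {cs} a → charges cs , charges-spread n cs a , refl
    ; surjective = λ {z} c → let (cs , e) = charges-surjective z (proj₁ c) in cs , charges-abacus n cs
      (subst (Charges n) e c) , e
    ; functional = λ _ _ _ r s → trans r (sym s)
    ; injective = λ {cs} {ds} _ _ _ r s → charges-injective cs ds (trans (sym r) s)
    }

  -- Conjugation and self-conjugate cores

  _≟₁₃_ : DecidableEquality (Vec ℤ 13)
  _≟₁₃_ = Vec.≡-dec _≟_

  reflect : ∀ {m} → Vec ℤ m → Vec ℤ m
  reflect = map (λ x → + 12 - x)

  -- Conjugation of partitions, in terms of charges.
  conjugate : Vec ℤ 13 → Vec ℤ 13
  conjugate z = map (-_) (reverse z)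

  conjugate-involutive : ∀ z → conjugate (conjugate z) ≡ z
  conjugate-involutive z = trans (cong (map (-_)) (sym (map-reverse (-_) (reverse z))))
    (trans (cong (map (-_) ∘ map (-_)) (reverse-involutive z))
    (trans (sym (map-∘ (-_) (-_) z)) (trans (map-cong neg-involutive z) (map-id z))))

  total-neg : ∀ {m} (zs : Vec ℤ m) → total (map (-_) zs) ≡ - total zs
  total-neg [] = refl
  total-neg (z ∷ zs) = trans (cong (_+_ (- z)) (total-neg zs)) (sym (neg-distrib-+ z (total zs)))

  total-reverse : ∀ {m} (zs : Vec ℤ m) → total (reverse zs) ≡ total zs
  total-reverse [] = refl
  total-reverse (z ∷ zs) = trans (cong total (reverse-∷ z zs))
    (trans (total-∷ʳ (reverse zs) z) (cong (_+_ z) (total-reverse zs)))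

  sumsq-reverse : ∀ {m} (zs : Vec ℤ m) → sumsq (reverse zs) ≡ sumsq zs
  sumsq-reverse [] = refl
  sumsq-reverse (z ∷ zs) = trans (cong sumsq (reverse-∷ z zs))
    (trans (sumsq-∷ʳ (reverse zs) z) (cong (_+_ (z * z)) (sumsq-reverse zs)))

  total-reflect : ∀ {m} (zs : Vec ℤ m) → total (reflect zs) ≡ + 12 * + m - total zs
  total-reflect [] = refl
  total-reflect {suc m} (z ∷ zs) = trans (cong (_+_ (+ 12 - z)) (total-reflect zs)) (l z (total zs) (+ m))
    where
    l : ∀ z t m → + 12 - z + (+ 12 * m - t) ≡ + 12 * (+ 1 + m) - (z + t)
    l = solve-∀

  sumsq-reflect : ∀ {m} (zs : Vec ℤ m) → sumsq (reflect zs) ≡ + 144 * + m - + 24 * total zs + sumsq zs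
  sumsq-reflect [] = refl
  sumsq-reflect {suc m} (z ∷ zs) = trans (cong (_+_ ((+ 12 - z) * (+ 12 - z))) (sumsq-reflect zs))
    (l z (total zs) (sumsq zs) (+ m))
    where
    l : ∀ z t s m → (+ 12 - z) * (+ 12 - z) + (+ 144 * m - + 24 * t + s) ≡ + 144 * (+ 1 + m) - + 24 * (z + t) +
      (z * z + s)
    l = solve-∀

  spread-reflect : ∀ e → spread (reflect (reverse e)) ≡ spread e
  spread-reflect e = trans (cong₂ (λ s t → + 13 * s - t * t)
      (trans (sumsq-reflect (reverse e)) (cong₂ (λ t s → + 144 * + 13 - + 24 * t + s) (total-reverse e)
        (sumsq-reverse e)))
      (trans (total-reflect (reverse e)) (cong (λ t → + 12 * + 13 - t) (total-reverse e))))
    (l (sumsq e) (total e))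
    where
    l : ∀ s t → + 13 * (+ 1872 - + 24 * t + s) - (+ 156 - t) * (+ 156 - t) ≡ + 13 * s - t * t
    l = solve-∀

  -- Conjugation exchanges runners i and 12 - i and reflects positions by x ↦ 12 - x, which leaves
  -- the spread alone.
  ends-conjugate : ∀ z → ends 0 (conjugate z) ≡ reflect (reverse (ends 0 z))
  ends-conjugate (z0 ∷ z1 ∷ z2 ∷ z3 ∷ z4 ∷ z5 ∷ z6 ∷ z7 ∷ z8 ∷ z9 ∷ z10 ∷ z11 ∷ z12 ∷ []) =
    cong₂ _∷_ (l (+ 0) (+ 12) z12)
      ( cong₂ _∷_ (l (+ 1) (+ 11) z11)
        ( cong₂ _∷_ (l (+ 2) (+ 10) z10)
          ( cong₂ _∷_ (l (+ 3) (+ 9) z9)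
            ( cong₂ _∷_ (l (+ 4) (+ 8) z8)
              ( cong₂ _∷_ (l (+ 5) (+ 7) z7)
                ( cong₂ _∷_ (l (+ 6) (+ 6) z6)
                  ( cong₂ _∷_ (l (+ 7) (+ 5) z5)
                    ( cong₂ _∷_ (l (+ 8) (+ 4) z4)
                      ( cong₂ _∷_ (l (+ 9) (+ 3) z3)
                        ( cong₂ _∷_ (l (+ 10) (+ 2) z2)
                          ( cong₂ _∷_ (l (+ 11) (+ 1) z1) (cong₂ _∷_ (l (+ 12) (+ 0) z0) refl))))))))))))
    where
    l : ∀ i j z → i + + 13 * - z ≡ (i + j) - (j + + 13 * z)
    l = solve-∀

  conjugate-charges : ∀ {n z} → Charges n z → Charges n (conjugate z)
  conjugate-charges {n} {z} (t , e) =
    trans (total-neg (reverse z)) (cong -_ (trans (total-reverse z) t)) ,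
    trans (cong spread (ends-conjugate z)) (trans (spread-reflect (ends 0 z)) e)

  symmetric : ℤ⁶ → Vec ℤ 13
  symmetric (a , b , c , d , e , f) = - f ∷ - e ∷ - d ∷ - c ∷ - b ∷ - a ∷ + 0 ∷ a ∷ b ∷ c ∷ d ∷ e ∷ f ∷ []

  symmetric-fixed : ∀ q → conjugate (symmetric q) ≡ symmetric q
  symmetric-fixed (a , b , c , d , e , f) =
    cong₂ _∷_ refl (cong₂ _∷_ refl (cong₂ _∷_ refl (cong₂ _∷_ refl (cong₂ _∷_ refl (cong₂ _∷_ refl (cong₂ _∷_ refl
    (cong₂ _∷_ (neg-involutive a) (cong₂ _∷_ (neg-involutive b)
      (cong₂ _∷_ (neg-involutive c) (cong₂ _∷_ (neg-involutive d)
    (cong₂ _∷_ (neg-involutive e) (cong₂ _∷_ (neg-involutive f) refl))))))))))))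

  fixed-symmetric : ∀ z → conjugate z ≡ z → ∃ λ q → z ≡ symmetric q
  fixed-symmetric (z0 ∷ z1 ∷ z2 ∷ z3 ∷ z4 ∷ z5 ∷ z6 ∷ z7 ∷ z8 ∷ z9 ∷ z10 ∷ z11 ∷ z12 ∷ []) eq =
    (z7 , z8 , z9 , z10 , z11 , z12) ,
    cong₂ _∷_ (at (# 0)) (cong₂ _∷_ (at (# 1))
      (cong₂ _∷_ (at (# 2)) (cong₂ _∷_ (at (# 3)) (cong₂ _∷_ (at (# 4)) (cong₂ _∷_ (at (# 5))
    (cong₂ _∷_ (self-neg (sym (at (# 6)))) refl))))))
    where
    at : (i : Fin 13) → lookup (z0 ∷ z1 ∷ z2 ∷ z3 ∷ z4 ∷ z5 ∷ z6 ∷ z7 ∷ z8 ∷ z9 ∷ z10 ∷ z11 ∷ z12 ∷ []) i ≡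
      lookup (conjugate (z0 ∷ z1 ∷ z2 ∷ z3 ∷ z4 ∷ z5 ∷ z6 ∷ z7 ∷ z8 ∷ z9 ∷ z10 ∷ z11 ∷ z12 ∷ [])) i
    at i = cong (λ v → lookup v i) (sym eq)

  symmetric-injective : ∀ p q → symmetric p ≡ symmetric q → p ≡ q
  symmetric-injective p@(_ , _ , _ , _ , _ , _) q@(_ , _ , _ , _ , _ , _) e = cong right {symmetric p} {symmetric q} e
    where
    right : Vec ℤ 13 → ℤ⁶
    right (z0 ∷ z1 ∷ z2 ∷ z3 ∷ z4 ∷ z5 ∷ z6 ∷ z7 ∷ z8 ∷ z9 ∷ z10 ∷ z11 ∷ z12 ∷ []) = z7 , z8 , z9 , z10 , z11 , z12

  total-ends-symmetric : ∀ q → total (ends 0 (symmetric q)) ≡ + 78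
  total-ends-symmetric (a , b , c , d , e , f) = l a b c d e f
    where
    l : ∀ a b c d e f → (+ 0 + + 13 * - f) +
      ((+ 1 + + 13 * - e) + ((+ 2 + + 13 * - d) +
        ((+ 3 + + 13 * - c) + ((+ 4 + + 13 * - b) +
          ((+ 5 + + 13 * - a) + ((+ 6 + + 13 * + 0) +
            ((+ 7 + + 13 * a) + ((+ 8 + + 13 * b) +
              ((+ 9 + + 13 * c) + ((+ 10 + + 13 * d) +
                ((+ 11 + + 13 * e) + ((+ 12 + + 13 * f) + + 0)))))))))))) ≡ + 78
    l = solve-∀

  -- The coordinates are ordered by their residues 1, 2, 4, 8, 16, 32 modulo 13.
  coords : ℤ⁶ → ℤ⁶
  coords (a , b , c , d , e , f) = + 1 + + 13 * a , + 2 + + 13 * b , + 4 + + 13 * d , - (+ 5 + + 13 * e) ,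
    + 3 + + 13 * c , + 6 + + 13 * f

  -- The first empty positions are 6 and the pairs 6 ± u, with u running over the coordinates up to
  -- sign and order. Hence 13 · 36 = 468, and the cross terms cancel.
  sumsq-symmetric : ∀ q → sumsq (ends 0 (symmetric q)) ≡ + 468 + + 2 * norm₆ (coords q)
  sumsq-symmetric (a , b , c , d , e , f) = l a b c d e f
    where
    l : ∀ a b c d e f → (+ 0 + + 13 * - f) * (+ 0 + + 13 * - f) + ((+ 1 + + 13 * - e) * (+ 1 + + 13 * - e) +
      ((+ 2 + + 13 * - d) * (+ 2 + + 13 * - d) + ((+ 3 + + 13 * - c) * (+ 3 + + 13 * - c) +
        ((+ 4 + + 13 * - b) * (+ 4 + + 13 * - b) + ((+ 5 + + 13 * - a) * (+ 5 + + 13 * - a) +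
          ((+ 6 + + 13 * + 0) * (+ 6 + + 13 * + 0) +
            ((+ 7 + + 13 * a) * (+ 7 + + 13 * a) +
              ((+ 8 + + 13 * b) * (+ 8 + + 13 * b) +
                ((+ 9 + + 13 * c) * (+ 9 + + 13 * c) + ((+ 10 + + 13 * d) * (+ 10 + + 13 * d) +
                  ((+ 11 + + 13 * e) * (+ 11 + + 13 * e) +
                    ((+ 12 + + 13 * f) * (+ 12 + + 13 * f) + + 0)))))))))))) ≡ + 468 + + 2 *
                      ((+ 1 + + 13 * a) * (+ 1 + + 13 * a) + (+ 2 + + 13 * b) * (+ 2 + + 13 * b) +
                        (+ 4 + + 13 * d) * (+ 4 + + 13 * d) + - (+ 5 + + 13 * e) * - (+ 5 + + 13 * e) +
                          (+ 3 + + 13 * c) * (+ 3 + + 13 * c) + (+ 6 + + 13 * f) * (+ 6 + + 13 * f))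
    l = solve-∀

  spread-symmetric : ∀ q → spread (ends 0 (symmetric q)) ≡ + 26 * norm₆ (coords q)
  spread-symmetric q = trans (cong₂ (λ s t → + 13 * s - t * t) (sumsq-symmetric q) (total-ends-symmetric q))
    (l (norm₆ (coords q)))
    where
    l : ∀ n → + 13 * (+ 468 + + 2 * n) - + 78 * + 78 ≡ + 26 * n
    l = solve-∀

  total-symmetric : ∀ q → total (symmetric q) ≡ + 0
  total-symmetric (a , b , c , d , e , f) = l a b c d e f
    where
    l : ∀ a b c d e f → - f + (- e +
      (- d + (- c + (- b + (- a + (+ 0 + (a + (b + (c + (d + (e + (f + + 0)))))))))))) ≡ + 0
    l = solve-∀

  coords-injective : ∀ p q → coords p ≡ coords q → p ≡ q
  coords-injective (a , b , c , d , e , f) (a′ , b′ , c′ , d′ , e′ , f′) eq =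
    tuple₆ (go 1 a a′ (cong proj₁ eq)) (go 2 b b′ (cong (λ x → proj₁ (proj₂ x)) eq))
      (go 3 c c′ (cong (λ x → proj₁ (proj₂ (proj₂ (proj₂ (proj₂ x))))) eq))
        (go 4 d d′ (cong (λ x → proj₁ (proj₂ (proj₂ x))) eq))
      (go 5 e e′ (neg-injective (cong (λ x → proj₁ (proj₂ (proj₂ (proj₂ x)))) eq)))
        (go 6 f f′ (cong (λ x → proj₂ (proj₂ (proj₂ (proj₂ (proj₂ x))))) eq))
    where
    l : ∀ i x → + 13 * x ≡ i + + 13 * x - i
    l = solve-∀
    go : ∀ i x y → + i + + 13 * x ≡ + i + + 13 * y → x ≡ y
    go i x y e = *-cancelˡ-≡ (+ 13) x y (trans (l (+ i) x) (trans (cong (_- + i) e) (sym (l (+ i) y))))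

  coords-class : ∀ q → Class (+ 1) (coords q)
  coords-class (a , b , c , d , e , f) = mod13 a refl , mod13 b refl , mod13 d refl , mod13 (- (+ 1 + e))
    (l₃ e) , mod13 (c - + 1) (l₄ c) , mod13 (f - + 2) (l₅ f)
    where
    l₃ : ∀ e → - (+ 5 + + 13 * e) ≡ + 8 + + 13 * - (+ 1 + e)
    l₃ = solve-∀
    l₄ : ∀ c → + 3 + + 13 * c ≡ + 16 + + 13 * (c - + 1)
    l₄ = solve-∀
    l₅ : ∀ f → + 6 + + 13 * f ≡ + 32 + + 13 * (f - + 2)
    l₅ = solve-∀

  class-coords : ∀ x → Class (+ 1) x → ∃ λ q → x ≡ coords q
  class-coords (x0 , x1 , x2 , x3 , x4 , x5) (mod13 a refl , mod13 b refl , mod13 d refl , mod13 e refl ,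
    mod13 c refl , mod13 f refl) =
    (a , b , c + + 1 , d , - (+ 1 + e) , f + + 2) , tuple₆ refl refl refl (l₃ e) (l₄ c) (l₅ f)
    where
    l₃ : ∀ e → + 8 + + 13 * e ≡ - (+ 5 + + 13 * - (+ 1 + e))
    l₃ = solve-∀
    l₄ : ∀ c → + 16 + + 13 * c ≡ + 3 + + 13 * (c + + 1)
    l₄ = solve-∀
    l₅ : ∀ f → + 32 + + 13 * f ≡ + 6 + + 13 * (f + + 2)
    l₅ = solve-∀

  charges≅sextuples : ∀ n → (λ z → Charges n z × conjugate z ≡ z) ≅ Sextuple (+ 13 * + n + + 91) via λ z x →
    ∃ λ q → z ≡ symmetric q × x ≡ coords q
  charges≅sextuples n = record
    { total = λ { {z} ((_ , s) , e) → let (q , e′) = fixed-symmetric z e in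
        coords q , (coords-class q , to q (trans (cong (λ z → spread (ends 0 z)) (sym e′)) s)) , q , e′ , refl }
    ; surjective = λ { {x} (c , s) → let (q , e′) = class-coords x c in
        symmetric q , ((total-symmetric q , from q (trans (cong norm₆ (sym e′)) s)) , symmetric-fixed q) , q ,
          refl , e′ }
    ; functional = λ { _ _ _ (p , r , s) (q , r′ , s′) → trans s
      (trans (cong coords (symmetric-injective p q (trans (sym r) r′))) (sym s′)) }
    ; injective = λ { _ _ _ (p , r , s) (q , r′ , s′) → trans r
      (trans (cong symmetric (coords-injective p q (trans (sym s) s′))) (sym r′)) }
    }
    where
    l : ∀ n → + 338 * n + + 2366 ≡ + 26 * (+ 13 * n + + 91)
    l = solve-∀
    to : ∀ q → spread (ends 0 (symmetric q)) ≡ + 338 * + n + + 2366 → norm₆ (coords q) ≡ + 13 * + n + + 91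
    to q s = *-cancelˡ-≡ (+ 26) (norm₆ (coords q)) (+ 13 * + n + + 91)
      (trans (sym (spread-symmetric q)) (trans s (l (+ n))))
    from : ∀ q → norm₆ (coords q) ≡ + 13 * + n + + 91 → spread (ends 0 (symmetric q)) ≡ + 338 * + n + + 2366
    from q s = trans (spread-symmetric q) (trans (cong (+ 26 *_) s) (sym (l (+ n))))

open Charge using (runner-sum; abacus≅charges; charges≅sextuples; conjugate; conjugate-charges;
  conjugate-involutive; _≟₁₃_)

open import Defs
open import Data.Nat using (ℕ; zero; suc; _≤_; _<_; s≤s; _+_; _*_; _∸_; _^_; _/_; _%_; _≟_; NonZero)
open import Data.Nat.Divisibility using (_∣_; divides; ∣⇒≤; m∣m*n)
open import Data.Nat.DivMod using (m≡m%n+[m/n]*n; m%n<n; [m+kn]%n≡m%n; m*n/n≡m; %-distribˡ-*)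
open import Data.Nat.ListAction using (sum)
open import Data.Nat.Primality using (Prime; euclidsLemma)
open import Data.Nat.Properties
open import Data.Nat.Tactic.RingSolver using (solve-∀)
open import Data.Integer using (+_; -_; _-_; 1ℤ; -1ℤ) renaming (_*_ to _*ℤ_; _+_ to _+ℤ_)
import Data.Integer.DivMod as ℤ
open import Data.Integer.Divisibility using () renaming (_∣_ to _∣ℤ_)
import Data.Integer.Divisibility.Signed as Signed
import Data.Integer.Properties as ℤ
import Data.Integer.Tactic.RingSolver as ℤSolver
import Data.List as List
import Data.List.Properties as List
open import Data.List.Relation.Unary.Any using (any?)
open import Data.Vec using (Vec; []; _∷_)

-- Squares as the parity criterion

IsSquare : ℕ → Set
IsSquare n = ∃ λ s → s * s ≡ n

-- The single runner holds 1, 3, ..., 2c - 1, with sum c².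
beads₂ : ∀ c → let B = beads 2 1 (c ∷ []) in List.length B ≡ c × 2 * sum B ≡ 2 * (c * c)
beads₂ c = trans (cong List.length B≡) (List.length-applyUpTo (λ k → 1 + k * 2) c) ,
  +-cancelʳ-≡ (2 * c) _ _ (trans (cong (λ B → 2 * sum B + 2 * c) B≡)
    (trans (runner-sum 2 (λ k → 1 + k * 2) 1 (λ _ → refl) c) (+-comm (2 * c) (2 * (c * c)))))
  where
  B≡ : beads 2 1 (c ∷ []) ≡ runner 2 1 c
  B≡ = List.++-identityʳ (runner 2 1 c)

-- The size equation reduces to c² + c = 2n, and the square is completed.
abacus₂⇔ : ∀ n c → Abacus {1} n (c ∷ []) ⇔ (2 * c + 1) * (2 * c + 1) ≡ 8 * n + 1
abacus₂⇔ n c = mk⇔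
  (λ e → trans (l₁ c) (trans (cong (λ u → 4 * u + 1) (+-cancelʳ-≡ (c * c) _ _
    (trans (l₃ c) (trans (sym (cong₂ _+_ sum≡ len)) (trans e (cong (λ u → 2 * n + u * u) len)))))) (l₂ n)))
  (λ e → trans (cong₂ _+_ sum≡ len) (trans (sym (l₃ c)) (trans (cong (_+ c * c)
    (*-cancelˡ-≡ _ _ 4 (+-cancelʳ-≡ 1 _ _ (trans (sym (l₁ c)) (trans e (sym (l₂ n)))))))
    (cong (λ u → 2 * n + u * u) (sym len)))))
  where
  len = proj₁ (beads₂ c)
  sum≡ = proj₂ (beads₂ c)
  l₁ : ∀ c → (2 * c + 1) * (2 * c + 1) ≡ 4 * (c * c + c) + 1
  l₁ = solve-∀
  l₂ : ∀ n → 4 * (2 * n) + 1 ≡ 8 * n + 1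
  l₂ = solve-∀
  l₃ : ∀ c → c * c + c + c * c ≡ 2 * (c * c) + c
  l₃ = solve-∀

odd?-spec : ∀ n → ∃ λ h → (odd? n ≡ false × n ≡ 2 * h) ⊎ (odd? n ≡ true × n ≡ 2 * h + 1)
odd?-spec zero = 0 , inj₁ (refl , refl)
odd?-spec (suc n) with odd?-spec n
... | h , inj₁ (e , refl) rewrite e = h , inj₂ (refl , +-comm 1 (2 * h))
... | h , inj₂ (e , refl) rewrite e = suc h , inj₁ (refl , l h)
  where
  l : ∀ h → suc (2 * h + 1) ≡ 2 * suc h
  l = solve-∀

a₂-odd : ∀ n → (odd? (a 2 n) ≡ true → IsSquare (8 * n + 1)) × (IsSquare (8 * n + 1) → odd? (a 2 n) ≡ true)
a₂-odd n = (λ e → to (proj₁ spec e)) , λ s → proj₂ spec (from s)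
  where
  uniq : ∀ {cs ds : Vec ℕ 1} → Abacus n cs → Abacus n ds → cs ≡ ds
  uniq {c ∷ []} {d ∷ []} p q = cong (_∷ []) (*-cancelˡ-≡ c d 2 (+-cancelʳ-≡ 1 (2 * c) (2 * d)
    (square-injective (trans (Equivalence.to (abacus₂⇔ n c) p) (sym (Equivalence.to (abacus₂⇔ n d) q))))))
  spec = subsingleton-parity uniq (abacus-parity n)
  to : ∃ (Abacus n) → IsSquare (8 * n + 1)
  to (c ∷ [] , e) = 2 * c + 1 , Equivalence.to (abacus₂⇔ n c) e
  from : IsSquare (8 * n + 1) → ∃ (Abacus n)
  from (s , e) with odd?-spec s
  ... | h , inj₂ (_ , refl) = h ∷ [] , Equivalence.from (abacus₂⇔ n h) e
  -- A root of the odd number 8n + 1 cannot be even.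
  ... | h , inj₁ (_ , refl) = contradiction (trans (l₁ n) (trans (cong (_% 2) (sym e)) (l₂ h))) λ ()
    where
    l₁ : ∀ n → 1 ≡ (8 * n + 1) % 2
    l₁ n = sym (trans (cong (_% 2) (m n)) ([m+kn]%n≡m%n 1 (4 * n) 2))
      where
      m : ∀ n → 8 * n + 1 ≡ 1 + 4 * n * 2
      m = solve-∀
    l₂ : ∀ h → (2 * h) * (2 * h) % 2 ≡ 0
    l₂ h = trans (cong (_% 2) (m h)) ([m+kn]%n≡m%n 0 (2 * h * h) 2)
      where
      m : ∀ h → (2 * h) * (2 * h) ≡ 0 + 2 * h * h * 2
      m = solve-∀

-- The norm of the sextuples is 13 (104m + 6) + 91 = 169 (8m + 1).
a₁₃-odd : ∀ m → (odd? (a 13 (104 * m + 6)) ≡ true → IsSquare (8 * m + 1)) ×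
  (IsSquare (8 * m + 1) → odd? (a 13 (104 * m + 6)) ≡ true)
a₁₃-odd m = proj₁ result , λ s → proj₂ result s (m≤n+m 1 (8 * m))
  where
  n = 104 * m + 6
  l : ∀ m → + 13 *ℤ (+ 104 *ℤ m +ℤ + 6) +ℤ + 91 ≡ + 169 *ℤ (+ 8 *ℤ m +ℤ + 1)
  l = ℤSolver.solve-∀
  T≡ : + 13 *ℤ + n +ℤ + 91 ≡ + 169 *ℤ (+ 8 *ℤ + m +ℤ + 1)
  T≡ = trans (cong (λ u → + 13 *ℤ (u +ℤ + 6) +ℤ + 91) (ℤ.pos-* 104 m)) (l (+ m))
  result = lattice-parity m (8 * m + 1) (cong (_+ℤ + 1) (ℤ.pos-* 8 m)) T≡
    (transfer (charges≅sextuples n) (involution _≟₁₃_ conjugate (λ {z} → conjugate-charges {n} {z})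
      (λ {z} _ → conjugate-involutive z)
      (transfer (abacus≅charges n) (abacus-parity n))))

prime-square-cancel : ∀ {p} → Prime p → .{{_ : NonZero p}} → ∀ K → IsSquare (p * p * K) → IsSquare K
prime-square-cancel {p} pr K (x , e) with p∣x
  where
  p∣x : p ∣ x
  p∣x with euclidsLemma x x pr (subst (p ∣_) (sym (trans e (*-assoc p p K))) (m∣m*n (p * K)))
  ... | inj₁ d = d
  ... | inj₂ d = d
... | divides y refl = y , *-cancelˡ-≡ (y * y) K (p * p) {{m*n≢0 p p}} (trans (l y p) e)
  where
  l : ∀ y p → p * p * (y * y) ≡ y * p * (y * p)
  l = solve-∀

bool-≡ : ∀ {b c} → (b ≡ true → c ≡ true) → (c ≡ true → b ≡ true) → b ≡ c
bool-≡ {true}  {c}     f g = sym (f refl)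
bool-≡ {false} {false} f g = refl
bool-≡ {false} {true}  f g = g refl

same-residue : ∀ x y → odd? x ≡ odd? y → ∃ λ h → ∃ λ k → ∃ λ b → x ≡ 2 * h + b × y ≡ 2 * k + b
same-residue x y e with odd?-spec x | odd?-spec y
... | h , inj₁ (_ , x≡) | k , inj₁ (_ , y≡) = h , k , 0 , trans x≡ (sym (+-identityʳ (2 * h))) , trans y≡
  (sym (+-identityʳ (2 * k)))
... | h , inj₂ (_ , x≡) | k , inj₂ (_ , y≡) = h , k , 1 , x≡ , y≡
... | h , inj₁ (p , _) | k , inj₂ (q , _) = contradiction (trans (sym p) (trans e q)) λ ()
... | h , inj₂ (p , _) | k , inj₁ (q , _) = contradiction (trans (sym p) (trans e q)) λ ()

-- A sign is invisible modulo 2: the difference is twice `h - k`, or twice `h + k + b`.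
2∣-twisted-difference : ∀ x y {ε} → ε ≡ 1ℤ ⊎ ε ≡ -1ℤ → odd? x ≡ odd? y → (+ 2) ∣ℤ ((+ x) - (- ε) *ℤ (+ y))
2∣-twisted-difference x y ε e with same-residue x y e
... | h , k , b , refl , refl = Signed.∣⇒∣ᵤ (go ε)
  where
  l₁ : ∀ h k b → (+ 2 *ℤ h +ℤ b) - (- 1ℤ) *ℤ (+ 2 *ℤ k +ℤ b) ≡ (h +ℤ k +ℤ b) *ℤ + 2
  l₁ = ℤSolver.solve-∀
  l₂ : ∀ h k b → (+ 2 *ℤ h +ℤ b) - (- -1ℤ) *ℤ (+ 2 *ℤ k +ℤ b) ≡ (h - k) *ℤ + 2
  l₂ = ℤSolver.solve-∀
  cast : ∀ h → + (2 * h + b) ≡ + 2 *ℤ + h +ℤ + b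
  cast h = cong (_+ℤ + b) (ℤ.pos-* 2 h)
  go : ∀ {ε} → ε ≡ 1ℤ ⊎ ε ≡ -1ℤ → + 2 Signed.∣ (+ (2 * h + b)) - (- ε) *ℤ (+ (2 * k + b))
  go (inj₁ refl) = Signed.divides (+ h +ℤ + k +ℤ + b)
    (trans (cong₂ (λ u v → u - (- 1ℤ) *ℤ v) (cast h) (cast k)) (l₁ (+ h) (+ k) (+ b)))
  go (inj₂ refl) = Signed.divides (+ h - + k) (trans (cong₂ (λ u v → u - (- -1ℤ) *ℤ v) (cast h) (cast k))
    (l₂ (+ h) (+ k) (+ b)))

legendre-unit : ∀ x q → ¬ (x ℤ.%ℕ suc q ≡ 0) → legendre x (suc q) ≡ 1ℤ ⊎ legendre x (suc q) ≡ -1ℤ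
legendre-unit x q x≢0 with (x ℤ.%ℕ suc q) ≟ 0
... | yes x≡0 = contradiction x≡0 x≢0
... | no _ with any? (λ y → ((y * y) % suc q) ≟ (x ℤ.%ℕ suc q)) (List.upTo (suc q))
...   | yes _ = inj₁ refl
...   | no _  = inj₂ refl

≡7-∤2 : ∀ p → p % 8 ≡ 7 → ¬ p ∣ 2
≡7-∤2 0 ()
≡7-∤2 1 ()
≡7-∤2 2 ()
≡7-∤2 (suc (suc (suc _))) _ p∣2 = contradiction (∣⇒≤ p∣2) λ { (s≤s (s≤s ())) }

-- A zero symbol would break the congruence; it would need `p` to divide 2, which the residue 7
-- modulo 8 excludes.
legendre[-2] : ∀ p → p % 8 ≡ 7 → legendre (- + 2) p ≡ 1ℤ ⊎ legendre (- + 2) p ≡ -1ℤ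
legendre[-2] zero ()
legendre[-2] p@(suc q) p%8 = legendre-unit (- + 2) q λ e → ≡7-∤2 p p%8 (Signed.∣⇒∣ᵤ (Signed.divides ((- + 2) ℤ./ℕ p)
    (trans (ℤ.a≡a%ℕn+[a/ℕn]*n (- + 2) p) (trans (cong (λ r → + r +ℤ (((- + 2) ℤ./ℕ p) *ℤ + p)) e)
      (ℤ.+-identityˡ _)))))

-- Comparison of the two indices

module _ (p r : ℕ) .{{_ : NonZero p}} (p%8≡7 : p % 8 ≡ 7) (p∣8r+7 : p ∣ 8 * r + 7) where

  w : ℕ
  w = p / 8

  p≡ : p ≡ 8 * w + 7
  p≡ = trans (m≡m%n+[m/n]*n p 8) (trans (cong (_+ w * 8) p%8≡7) (trans (+-comm 7 (w * 8)) (cong (_+ 7) (*-comm w 8))))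

  -- Both `p` and 8r + 7 are -1 modulo 8, so their quotient is 1 modulo 8.
  cofactor : ∃ λ u → p * (8 * u + 1) ≡ 8 * r + 7
  cofactor = go p∣8r+7
    where
    go : p ∣ 8 * r + 7 → ∃ λ u → p * (8 * u + 1) ≡ 8 * r + 7
    go (divides s e) = s / 8 , trans (*-comm p (8 * (s / 8) + 1)) (trans (cong (_* p) (sym s≡)) (sym e))
      where
      7s : (7 * (s % 8)) % 8 ≡ 7
      7s = trans (sym (trans (%-distribˡ-* p s 8) (cong (λ v → (v * (s % 8)) % 8) p%8≡7)))
        (trans (cong (_% 8) (trans (*-comm p s) (sym e)))
          (trans (cong (_% 8) (trans (+-comm (8 * r) 7) (cong (λ m → 7 + m) (*-comm 8 r)))) ([m+kn]%n≡m%n 7 r 8)))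
      one : ∀ v → v < 8 → (7 * v) % 8 ≡ 7 → v ≡ 1
      one 1 _ _ = refl
      one 0 _ ()
      one 2 _ ()
      one 3 _ ()
      one 4 _ ()
      one 5 _ ()
      one 6 _ ()
      one 7 _ ()
      one (suc (suc (suc (suc (suc (suc (suc (suc v)))))))) (s≤s (s≤s (s≤s (s≤s (s≤s (s≤s (s≤s (s≤s ())))))))) _
      s≡ : s ≡ 8 * (s / 8) + 1
      s≡ = trans (m≡m%n+[m/n]*n s 8) (trans (cong (_+ s / 8 * 8) (one (s % 8) (m%n<n s 8) 7s))
        (trans (+-comm 1 _) (cong (_+ 1) (*-comm (s / 8) 8))))

  u : ℕ
  u = proj₁ cofactor

  pu : p * (8 * u + 1) ≡ 8 * r + 7
  pu = proj₂ cofactor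

  [7p-1]/8 : (7 * p ∸ 1) / 8 ≡ 7 * w + 6
  [7p-1]/8 = trans (cong (λ q → (7 * q ∸ 1) / 8) p≡) (trans (cong (λ q → (q ∸ 1) / 8) (l w)) (m*n/n≡m (7 * w + 6) 8))
    where
    l : ∀ w → 7 * (8 * w + 7) ≡ suc ((7 * w + 6) * 8)
    l = solve-∀

  [8r+7-p]/8p : ((8 * r + 7 ∸ p) / 8) / p ≡ u
  [8r+7-p]/8p = trans (cong (λ q → (q ∸ p) / 8 / p) (sym pu)) (trans (cong (λ q → (q ∸ p) / 8 / p) (l p u))
    (trans (cong (λ q → q / 8 / p) (m+n∸n≡m (u * p * 8) p)) (trans (cong (_/ p) (m*n/n≡m (u * p) 8)) (m*n/n≡m u p))))
    where
    l : ∀ p u → p * (8 * u + 1) ≡ u * p * 8 + p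
    l = solve-∀

  [104r+91]/p : (104 * r + 91) / p ≡ 104 * u + 13
  [104r+91]/p = trans (cong (_/ p) (trans (l₁ r) (trans (cong (13 *_) (sym pu)) (l₂ p u)))) (m*n/n≡m (104 * u + 13) p)
    where
    l₁ : ∀ r → 104 * r + 91 ≡ 13 * (8 * r + 7)
    l₁ = solve-∀
    l₂ : ∀ p u → 13 * (p * (8 * u + 1)) ≡ (104 * u + 13) * p
    l₂ = solve-∀

  module _ (pr : Prime p) (k n : ℕ) where

    -- The arguments of `a 2` on the two sides, with the exponent of the theorem written as `suc k`.
    big small : ℕ
    big   = p ^ (suc k + 1) * n + p * r + (7 * w + 6)
    small = p ^ k * n + u

    p^ : p ^ (suc k + 1) ≡ p * p * p ^ k
    p^ = trans (cong (λ j → p * p ^ j) (+-comm k 1)) (sym (*-assoc p p (p ^ k)))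

    -- From 8 (7w + 6) + 1 = 7p, the terms free of `n` add up to p (8r + 7) = p² (8u + 1).
    big-small : 8 * big + 1 ≡ p * p * (8 * small + 1)
    big-small = trans (cong (λ q → 8 * (q * n + p * r + (7 * w + 6)) + 1) p^) (trans (l₁ p (p ^ k) n r w)
      (trans (cong (λ q → 8 * (p * p * p ^ k * n) + 8 * (p * r) + 7 * q) (sym p≡)) (trans (l₂ p (p ^ k) n r)
      (trans (cong (λ q → 8 * (p * p * p ^ k * n) + p * q) (sym pu)) (l₃ p (p ^ k) n u)))))
      where
      l₁ : ∀ p P n r w → 8 * (p * p * P * n + p * r + (7 * w + 6)) + 1 ≡ 8 * (p * p * P * n) + 8 *
        (p * r) + 7 * (8 * w + 7)
      l₁ = solve-∀
      l₂ : ∀ p P n r → 8 * (p * p * P * n) + 8 * (p * r) + 7 * p ≡ 8 * (p * p * P * n) + p * (8 * r + 7)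
      l₂ = solve-∀
      l₃ : ∀ p P n u → 8 * (p * p * P * n) + p * (p * (8 * u + 1)) ≡ p * p * (8 * (P * n + u) + 1)
      l₃ = solve-∀

    squares : (IsSquare (8 * big + 1) → IsSquare (8 * small + 1)) ×
      (IsSquare (8 * small + 1) → IsSquare (8 * big + 1))
    squares = (λ s → prime-square-cancel pr (8 * small + 1) (subst IsSquare big-small s)) ,
      λ { (s , e) → p * s , trans (l p s) (trans (cong (p * p *_) e) (sym big-small)) }
      where
      l : ∀ p s → p * s * (p * s) ≡ p * p * (s * s)
      l = solve-∀

    same-parity₂ : odd? (a 2 big) ≡ odd? (a 2 small)
    same-parity₂ = bool-≡ (λ e → proj₂ (a₂-odd small) (proj₁ squares (proj₁ (a₂-odd big) e)))
      (λ e → proj₂ (a₂-odd big) (proj₂ squares (proj₁ (a₂-odd small) e)))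

    same-parity₁₃ : odd? (a 13 (104 * big + 6)) ≡ odd? (a 13 (104 * small + 6))
    same-parity₁₃ = bool-≡ (λ e → proj₂ (a₁₃-odd small) (proj₁ squares (proj₁ (a₁₃-odd big) e)))
      (λ e → proj₂ (a₁₃-odd big) (proj₂ squares (proj₁ (a₁₃-odd small) e)))

    -- Since 91p = 13 · 7p = 104 (7w + 6) + 13, subtracting 7 leaves the residue 6 modulo 104.
    index-big : 104 * p ^ (suc k + 1) * n + 104 * p * r + 91 * p ∸ 7 ≡ 104 * big + 6
    index-big = trans (cong (λ q → 104 * p ^ (suc k + 1) * n + 104 * p * r + 91 * q ∸ 7) p≡)
      (trans (cong (_∸ 7) (l (p ^ (suc k + 1)) n (p * r) w (104 * p * r) (*-assoc 104 p r)))
        (m+n∸n≡m (104 * big + 6) 7))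
      where
      l′ : ∀ Q n m w → 104 * Q * n + 104 * m + 91 * (8 * w + 7) ≡ 104 * (Q * n + m + (7 * w + 6)) + 6 + 7
      l′ = solve-∀
      l : ∀ Q n m w m′ → m′ ≡ 104 * m → 104 * Q * n + m′ + 91 * (8 * w + 7) ≡ 104 * (Q * n + m + (7 * w + 6)) + 6 + 7
      l Q n m w _ refl = l′ Q n m w

    index-small : 104 * p ^ k * n + (104 * r + 91) / p ∸ 7 ≡ 104 * small + 6
    index-small = trans (cong (λ q → 104 * p ^ k * n + q ∸ 7) [104r+91]/p)
      (trans (cong (_∸ 7) (l (p ^ k) n u)) (m+n∸n≡m (104 * small + 6) 7))
      where
      l : ∀ Q n u → 104 * Q * n + (104 * u + 13) ≡ 104 * (Q * n + u) + 6 + 7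
      l = solve-∀

theorem1p3 : (k p r : ℕ) → 1 ≤ k → Prime p → p % 8 ≡ 7 → p ∣ 8 * r + 7 →
    .{{_ : NonZero p}} → (n : ℕ) →
    ((+ 2) ∣ℤ ((+ a 2 (p ^ (k + 1) * n + p * r + (7 * p ∸ 1) / 8))
    - (- (legendre (- + 2) p)) *ℤ (+ a 2 (p ^ (k ∸ 1) * n + ((8 * r + 7 ∸ p) / 8) / p))))
    × ((+ 2) ∣ℤ ((+ a 13 (104 * p ^ (k + 1) * n + 104 * p * r + 91 * p ∸ 7))
    - (- (legendre (- + 2) p)) *ℤ (+ a 13 (104 * p ^ (k ∸ 1) * n + (104 * r + 91) / p ∸ 7))))
theorem1p3 (suc k) p r _ pr p%8≡7 p∣8r+7 n =
  2∣-twisted-difference _ _ ε (trans (cong (λ i → odd? (a 2 (p ^ (suc k + 1) * n + p * r + i)))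
    ([7p-1]/8 p r p%8≡7 p∣8r+7))
    (trans (same-parity₂ p r p%8≡7 p∣8r+7 pr k n) (cong (λ i → odd? (a 2 (p ^ k * n + i)))
      (sym ([8r+7-p]/8p p r p%8≡7 p∣8r+7))))) ,
  2∣-twisted-difference _ _ ε (trans (cong (λ i → odd? (a 13 i)) (index-big p r p%8≡7 p∣8r+7 pr k n))
    (trans (same-parity₁₃ p r p%8≡7 p∣8r+7 pr k n)
      (cong (λ i → odd? (a 13 i)) (sym (index-small p r p%8≡7 p∣8r+7 pr k n)))))
  where
  ε = legendre[-2] p p%8≡7
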